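{- There exists a graph that admits a planar storyplan but does not admit a planar geometric storyplan.
   Context: A storyplan of a graph $G$ on time steps $[\ell]=\{1,\dots,\ell\}$, $\ell\in\mathbb{N}$, is a pair $(A,\mathcal{D})$ where: $A$ assigns to each vertex $v$ a nonempty interval $A(v)=[s_v,e_v]\subseteq[\ell]$ of consecutive integers (the visible interval; $v$ is visible at each $t\in A(v)$); for every edge $uv$ of $G$ we have $A(u)\cap A(v)\neq\emptyset$; and $\mathcal{D}$ assigns to each vertex a point of the plane and to each edge a curve between the points of its endpoints (one fixed drawing of each vertex and edge, used in all time steps). For $t\in[\ell]$, the frame at $t$ is the drawing under $\mathcal{D}$ of the induced subgraph $G[\{v : t\in A(v)\}]$, and each frame must be a simple drawing. Several vertices may appear in the same time step. A storyplan is planar if every frame is a planar drawing (no crossings), and planar geometric if every frame is a planar drawing in which every edge is a straight-line segment. -}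

module Defs where

open import Data.Bool.Base using (Bool; false; T)
import Data.Fin.Base as Fin
open Fin using (Fin)
open import Data.Nat.Base as ℕ using (ℕ; _⊔_)
import Data.Nat.Properties as ℕ
open import Data.Product.Base using (_×_; _,_; proj₁; proj₂; ∃-syntax; Σ-syntax)
open import Data.Rational.Base as ℚ using (ℚ; 0ℚ; 1ℚ; ½)
import Data.Rational.Properties as ℚ
open import Data.Rational.Solver using (module +-*-Solver)
open import Data.Sum.Base using (_⊎_)
open import Function.Bundles using (_⇔_)
open import Level using (0ℓ)
open import Relation.Binary.PropositionalEquality
  using (_≡_; _≢_; refl; sym; trans; cong; subst; subst₂)
open import Relation.Nullary.Negation.Core using (¬_)
open import Relation.Unary using (Pred)

-- Real numbers are Cauchy sequences of rationals up to the equality _≈_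

dist : ℚ → ℚ → ℚ
dist p q = ℚ.∣ p ℚ.- q ∣

Cauchy : (ℕ → ℚ) → Set
Cauchy f = ∀ ε → 0ℚ ℚ.< ε →
  ∃[ N ] (∀ m n → N ℕ.≤ m → N ℕ.≤ n → dist (f m) (f n) ℚ.≤ ε)

record ℝ : Set where
  constructor mkℝ
  field
    seq    : ℕ → ℚ
    cauchy : Cauchy seq

open ℝ public

-- Abstract because unfolding these proofs makes type checking infeasible.
abstract
  half-pos : ∀ {ε} → 0ℚ ℚ.< ε → 0ℚ ℚ.< ½ ℚ.* ε
  half-pos {ε} 0<ε =
    ℚ.positive⁻¹ (½ ℚ.* ε) {{ℚ.pos*pos⇒pos ½ ε {{ℚ.positive 0<ε}}}}

  half+half : ∀ ε → ½ ℚ.* ε ℚ.+ ½ ℚ.* ε ≡ ε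
  half+half ε = trans (sym (ℚ.*-distribʳ-+ ε ½ ½)) (ℚ.*-identityˡ ε)

  const-cauchy : ∀ q → Cauchy (λ _ → q)
  const-cauchy q ε 0<ε = 0 , λ _ _ _ _ →
    subst (ℚ._≤ ε) (sym (cong ℚ.∣_∣ (ℚ.+-inverseʳ q))) (ℚ.<⇒≤ 0<ε)

  +-cauchy : ∀ {f g} → Cauchy f → Cauchy g → Cauchy (λ n → f n ℚ.+ g n)
  +-cauchy {f} {g} cf cg ε 0<ε
    with cf (½ ℚ.* ε) (half-pos 0<ε) | cg (½ ℚ.* ε) (half-pos 0<ε)
  ... | M , hf | N , hg = M ⊔ N , λ m n p q →
    subst₂ ℚ._≤_ (cong ℚ.∣_∣ (regroup (f m) (g m) (f n) (g n))) (half+half ε)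
      (ℚ.≤-trans
        (ℚ.∣p+q∣≤∣p∣+∣q∣ (f m ℚ.- f n) (g m ℚ.- g n))
        (ℚ.+-mono-≤
          (hf m n (ℕ.m⊔n≤o⇒m≤o M N p) (ℕ.m⊔n≤o⇒m≤o M N q))
          (hg m n (ℕ.m⊔n≤o⇒n≤o M N p) (ℕ.m⊔n≤o⇒n≤o M N q))))
    where
    open +-*-Solver
    regroup : ∀ a b c d →
      (a ℚ.- c) ℚ.+ (b ℚ.- d) ≡ (a ℚ.+ b) ℚ.- (c ℚ.+ d)
    regroup = solve 4
      (λ a b c d → (a :- c) :+ (b :- d) := (a :+ b) :- (c :+ d)) refl

  neg-cauchy : ∀ {f} → Cauchy f → Cauchy (λ n → ℚ.- f n)
  neg-cauchy {f} cf ε 0<ε with cf ε 0<ε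
  ... | N , hf = N , λ m n p q →
    subst (ℚ._≤ ε)
      (trans (sym (ℚ.∣-p∣≡∣p∣ (f m ℚ.- f n)))
             (cong ℚ.∣_∣ (ℚ.neg-distrib-+ (f m) (ℚ.- f n))))
      (hf m n p q)

  bounded : ∀ {f} → Cauchy f →
    ∃[ B ] ∃[ N ] (0ℚ ℚ.< B × (∀ n → N ℕ.≤ n → ℚ.∣ f n ∣ ℚ.≤ B))
  bounded {f} cf with cf 1ℚ (ℚ.positive⁻¹ 1ℚ)
  ... | N , hf = 1ℚ ℚ.+ ℚ.∣ f N ∣ , N
    , ℚ.+-mono-<-≤ (ℚ.positive⁻¹ 1ℚ) (ℚ.0≤∣p∣ (f N))
    , λ n p → ℚ.≤-trans
        (subst (λ z → ℚ.∣ z ∣ ℚ.≤ dist (f n) (f N) ℚ.+ ℚ.∣ f N ∣)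
          (split (f n) (f N)) (ℚ.∣p+q∣≤∣p∣+∣q∣ (f n ℚ.- f N) (f N)))
        (ℚ.+-monoˡ-≤ ℚ.∣ f N ∣ (hf n N p ℕ.≤-refl))
    where
    open +-*-Solver
    split : ∀ a b → (a ℚ.- b) ℚ.+ b ≡ a
    split = solve 2 (λ a b → (a :- b) :+ b := a) refl

  ∣*∣-mono : ∀ p q {B C} → 0ℚ ℚ.< B →
    ℚ.∣ p ∣ ℚ.≤ B → ℚ.∣ q ∣ ℚ.≤ C → ℚ.∣ p ℚ.* q ∣ ℚ.≤ B ℚ.* C
  ∣*∣-mono p q {B} 0<B p≤B q≤C =
    subst (ℚ._≤ _) (sym (ℚ.∣p*q∣≡∣p∣*∣q∣ p q))
      (ℚ.≤-trans
        (ℚ.*-monoʳ-≤-nonNeg ℚ.∣ q ∣ {{ℚ.∣-∣-nonNeg q}} p≤B)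
        (ℚ.*-monoˡ-≤-nonNeg B {{ℚ.nonNegative (ℚ.<⇒≤ 0<B)}} q≤C))

  dist-* : ∀ a b c d {B C δ} → 0ℚ ℚ.< B → 0ℚ ℚ.< C →
    ℚ.∣ a ∣ ℚ.≤ B → ℚ.∣ d ∣ ℚ.≤ C → dist a c ℚ.≤ δ → dist b d ℚ.≤ δ →
    dist (a ℚ.* b) (c ℚ.* d) ℚ.≤ B ℚ.* δ ℚ.+ C ℚ.* δ
  dist-* a b c d 0<B 0<C a≤B d≤C ac≤δ bd≤δ =
    subst (ℚ._≤ _) (cong ℚ.∣_∣ (regroup a b c d))
      (ℚ.≤-trans
        (ℚ.∣p+q∣≤∣p∣+∣q∣ (a ℚ.* (b ℚ.- d)) (d ℚ.* (a ℚ.- c)))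
        (ℚ.+-mono-≤ (∣*∣-mono a (b ℚ.- d) 0<B a≤B bd≤δ)
                    (∣*∣-mono d (a ℚ.- c) 0<C d≤C ac≤δ)))
    where
    open +-*-Solver
    regroup : ∀ a b c d →
      a ℚ.* (b ℚ.- d) ℚ.+ d ℚ.* (a ℚ.- c) ≡ a ℚ.* b ℚ.- c ℚ.* d
    regroup = solve 4
      (λ a b c d → a :* (b :- d) :+ d :* (a :- c) := a :* b :- c :* d) refl

  divide : ∀ B C ε → 0ℚ ℚ.< B → 0ℚ ℚ.< C → 0ℚ ℚ.< ε →
    ∃[ δ ] (0ℚ ℚ.< δ × B ℚ.* δ ℚ.+ C ℚ.* δ ≡ ε)
  divide B C ε 0<B 0<C 0<ε = inv ℚ.* ε
    , ℚ.positive⁻¹ (inv ℚ.* ε)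
        {{ℚ.pos*pos⇒pos inv {{ℚ.1/pos⇒pos (B ℚ.+ C)}} ε {{ℚ.positive 0<ε}}}}
    , trans (sym (ℚ.*-distribʳ-+ (inv ℚ.* ε) B C))
      (trans (sym (ℚ.*-assoc (B ℚ.+ C) inv ε))
      (trans (cong (ℚ._* ε) (ℚ.*-inverseʳ (B ℚ.+ C)))
             (ℚ.*-identityˡ ε)))
    where
    instance
      B+C-pos : ℚ.Positive (B ℚ.+ C)
      B+C-pos = ℚ.positive (ℚ.+-mono-< 0<B 0<C)

      B+C-nonZero : ℚ.NonZero (B ℚ.+ C)
      B+C-nonZero = ℚ.pos⇒nonZero (B ℚ.+ C)

    inv : ℚ
    inv = ℚ.1/ (B ℚ.+ C)

  *-cauchy : ∀ {f g} → Cauchy f → Cauchy g → Cauchy (λ n → f n ℚ.* g n)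
  *-cauchy {f} {g} cf cg ε 0<ε =
    let B , K , 0<B , f≤B = bounded cf
        C , L , 0<C , g≤C = bounded cg
        δ , 0<δ , Bδ+Cδ≡ε = divide B C ε 0<B 0<C 0<ε
        M , hf = cf δ 0<δ
        N , hg = cg δ 0<δ
    in (K ⊔ L) ⊔ (M ⊔ N) , λ m n p q →
      let m≥KL = ℕ.m⊔n≤o⇒m≤o (K ⊔ L) (M ⊔ N) p
          m≥MN = ℕ.m⊔n≤o⇒n≤o (K ⊔ L) (M ⊔ N) p
          n≥KL = ℕ.m⊔n≤o⇒m≤o (K ⊔ L) (M ⊔ N) q
          n≥MN = ℕ.m⊔n≤o⇒n≤o (K ⊔ L) (M ⊔ N) q
      in subst (dist (f m ℚ.* g m) (f n ℚ.* g n) ℚ.≤_) Bδ+Cδ≡ε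
           (dist-* (f m) (g m) (f n) (g n) {B} {C} {δ} 0<B 0<C
             (f≤B m (ℕ.m⊔n≤o⇒m≤o K L m≥KL))
             (g≤C n (ℕ.m⊔n≤o⇒n≤o K L n≥KL))
             (hf m n (ℕ.m⊔n≤o⇒m≤o M N m≥MN) (ℕ.m⊔n≤o⇒m≤o M N n≥MN))
             (hg m n (ℕ.m⊔n≤o⇒n≤o M N m≥MN) (ℕ.m⊔n≤o⇒n≤o M N n≥MN)))

infix  4 _≈_ _<_ _≤_
infixl 6 _+_ _-_
infixl 7 _*_
infix  8 -_

record _≈_ (x y : ℝ) : Set where
  constructor mk≈
  field
    close : ∀ ε → 0ℚ ℚ.< ε →
      ∃[ N ] (∀ n → N ℕ.≤ n → dist (seq x n) (seq y n) ℚ.≤ ε)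

record _<_ (x y : ℝ) : Set where
  constructor mk<
  field
    gap        : ℚ
    gap-pos    : 0ℚ ℚ.< gap
    from       : ℕ
    separation : ∀ n → from ℕ.≤ n → seq x n ℚ.+ gap ℚ.≤ seq y n

_≤_ : ℝ → ℝ → Set
x ≤ y = ¬ (y < x)

fromℚ : ℚ → ℝ
fromℚ q = mkℝ (λ _ → q) (const-cauchy q)

abstract
  fromℚ-mono-≤ : ∀ {p q} → p ℚ.≤ q → fromℚ p ≤ fromℚ q
  fromℚ-mono-≤ {p} {q} p≤q (mk< ε 0<ε N h) = ℚ.<-irrefl refl
    (ℚ.<-≤-trans
      (subst (ℚ._< q ℚ.+ ε) (ℚ.+-identityʳ q)
        (ℚ.+-mono-≤-< (ℚ.≤-refl {q}) 0<ε))
      (ℚ.≤-trans (h N ℕ.≤-refl) p≤q))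

  0≤1 : 0ℚ ℚ.≤ 1ℚ
  0≤1 = ℚ.<⇒≤ (ℚ.positive⁻¹ 1ℚ)

0ℝ 1ℝ : ℝ
0ℝ = fromℚ 0ℚ
1ℝ = fromℚ 1ℚ

_+_ : ℝ → ℝ → ℝ
x + y = mkℝ (λ n → seq x n ℚ.+ seq y n)
  (+-cauchy {seq x} {seq y} (cauchy x) (cauchy y))

_*_ : ℝ → ℝ → ℝ
x * y = mkℝ (λ n → seq x n ℚ.* seq y n)
  (*-cauchy {seq x} {seq y} (cauchy x) (cauchy y))

-_ : ℝ → ℝ
- x = mkℝ (λ n → ℚ.- seq x n)
  (neg-cauchy {seq x} (cauchy x))

_-_ : ℝ → ℝ → ℝ
x - y = x + (- y)

-- |x - y| < ε
Near : ℝ → ℝ → ℝ → Set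
Near ε x y = x < y + ε × y < x + ε

Point : Set
Point = ℝ × ℝ

infix 4 _≈ₚ_

_≈ₚ_ : Point → Point → Set
(x , y) ≈ₚ (x′ , y′) = x ≈ x′ × y ≈ y′

-- Closeness in the maximum metric, which induces the usual topology.
Nearₚ : ℝ → Point → Point → Set
Nearₚ ε (x , y) (x′ , y′) = Near ε x x′ × Near ε y y′

record UnitInterval : Set where
  constructor mkI
  field
    val : ℝ
    0≤  : 0ℝ ≤ val
    ≤1  : val ≤ 1ℝ

open UnitInterval public

0I 1I : UnitInterval
0I = mkI 0ℝ (fromℚ-mono-≤ ℚ.≤-refl) (fromℚ-mono-≤ 0≤1)
1I = mkI 1ℝ (fromℚ-mono-≤ 0≤1) (fromℚ-mono-≤ ℚ.≤-refl)

-- Continuity implies that the function respects _≈_ on parameters.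
record Curve : Set where
  field
    at         : UnitInterval → Point
    continuous : ∀ s ε → 0ℝ < ε → Σ[ δ ∈ ℝ ] (0ℝ < δ ×
                   (∀ t → Near δ (val s) (val t) → Nearₚ ε (at s) (at t)))

open Curve public

infix 4 _∈ᶜ_

_∈ᶜ_ : Point → Curve → Set
p ∈ᶜ γ = ∃[ s ] (at γ s ≈ₚ p)

InteriorOf : Curve → Point → Set
InteriorOf γ p = ∃[ s ] (0ℝ < val s × val s < 1ℝ × at γ s ≈ₚ p)

SimpleArc : Curve → Set
SimpleArc γ = ∀ s t → at γ s ≈ₚ at γ t → val s ≈ val t

between : Point → Point → UnitInterval → Point
between (a₁ , a₂) (b₁ , b₂) t =
    (1ℝ - val t) * a₁ + val t * b₁
  , (1ℝ - val t) * a₂ + val t * b₂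

OnSegment : Point → Point → Point → Set
OnSegment a b p = ∃[ t ] (between a b t ≈ₚ p)

ContinuousMap : (Point → Point) → Set
ContinuousMap f = ∀ p ε → 0ℝ < ε → Σ[ δ ∈ ℝ ] (0ℝ < δ ×
  (∀ q → Nearₚ δ p q → Nearₚ ε (f p) (f q)))

record PlaneHomeomorphism : Set where
  field
    to        : Point → Point
    from      : Point → Point
    to-cont   : ContinuousMap to
    from-cont : ContinuousMap from
    to-from   : ∀ p → to (from p) ≈ₚ p
    from-to   : ∀ p → from (to p) ≈ₚ p

-- γ and δ cross at p: p is interior to both, and up to a homeomorphism they
-- look near p like the two coordinate axes (so they do not merely touch).
-- Taking a homeomorphism of the whole plane instead of one of a
-- neighbourhood of p is no restriction, by the Schoenflies theorem.
record CrossAt (γ δ : Curve) (p : Point) : Set where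
  field
    interiorˡ : InteriorOf γ p
    interiorʳ : InteriorOf δ p
    homeo     : PlaneHomeomorphism
  open PlaneHomeomorphism homeo
  field
    radius     : ℝ
    radius-pos : 0ℝ < radius
    axisˡ : ∀ q → Nearₚ radius p q → q ∈ᶜ γ ⇔ proj₂ (to q) ≈ 0ℝ
    axisʳ : ∀ q → Nearₚ radius p q → q ∈ᶜ δ ⇔ proj₁ (to q) ≈ 0ℝ

record Graph : Set where
  field
    order  : ℕ
    adj    : Fin order → Fin order → Bool
    symm   : ∀ u v → adj u v ≡ adj v u
    noLoop : ∀ v → adj v v ≡ false

  Vertex : Set
  Vertex = Fin order

  -- An undirected edge is listed once, from its smaller endpoint.  The
  -- proofs are irrelevant, so an edge is determined by its endpoints.
  record Edge : Set where
    constructor edge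
    field
      source target : Vertex
      .ordered      : source Fin.< target
      .adjacent     : T (adj source target)

  open Edge public

  EndpointOf : Edge → Pred Vertex 0ℓ
  EndpointOf e v = v ≡ source e ⊎ v ≡ target e

  EdgeWithin : Pred Vertex 0ℓ → Pred Edge 0ℓ
  EdgeWithin W e = W (source e) × W (target e)

record Drawing (G : Graph) : Set where
  open Graph G
  field
    point  : Vertex → Point
    curve  : Edge → Curve
    begins : ∀ e → at (curve e) 0I ≈ₚ point (source e)
    ends   : ∀ e → at (curve e) 1I ≈ₚ point (target e)

-- W is the set of visible vertices.
module _ {G : Graph} (D : Drawing G) (W : Pred (Graph.Vertex G) 0ℓ) where
  open Graph G
  open Drawing D

  CommonEndpointAt : Edge → Edge → Point → Set
  CommonEndpointAt e f p =
    ∃[ v ] (EndpointOf e v × EndpointOf f v × point v ≈ₚ p)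

  record SimpleDrawing : Set where
    field
      distinct  : ∀ u v → W u → W v → u ≢ v → ¬ (point u ≈ₚ point v)
      arcs      : ∀ e → EdgeWithin W e → SimpleArc (curve e)
      avoiding  : ∀ e v → EdgeWithin W e → W v → ¬ EndpointOf e v →
                  ¬ (point v ∈ᶜ curve e)
      atMostOne : ∀ e f → EdgeWithin W e → EdgeWithin W f → e ≢ f →
                  ∀ p q → p ∈ᶜ curve e → p ∈ᶜ curve f →
                          q ∈ᶜ curve e → q ∈ᶜ curve f → p ≈ₚ q
      proper    : ∀ e f → EdgeWithin W e → EdgeWithin W f → e ≢ f →
                  ∀ p → p ∈ᶜ curve e → p ∈ᶜ curve f →
                  CommonEndpointAt e f p ⊎ CrossAt (curve e) (curve f) p

  CrossingFree : Set
  CrossingFree = ∀ e f → EdgeWithin W e → EdgeWithin W f → e ≢ f →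
    ∀ p → ¬ CrossAt (curve e) (curve f) p

  StraightLine : Set
  StraightLine = ∀ e → EdgeWithin W e →
    ∀ p → p ∈ᶜ curve e ⇔ OnSegment (point (source e)) (point (target e)) p

-- The time steps 1, …, ℓ are represented by Fin ℓ.
record Storyplan (G : Graph) (ℓ : ℕ) : Set where
  open Graph G
  field
    start end : Vertex → Fin ℓ
    nonempty  : ∀ v → start v Fin.≤ end v

  VisibleAt : Fin ℓ → Pred Vertex 0ℓ
  VisibleAt t v = start v Fin.≤ t × t Fin.≤ end v

  field
    meet    : ∀ u v → T (adj u v) → ∃[ t ] (VisibleAt t u × VisibleAt t v)
    drawing : Drawing G
    simple  : ∀ t → SimpleDrawing drawing (VisibleAt t)

module _ {G : Graph} {ℓ : ℕ} (S : Storyplan G ℓ) where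
  open Storyplan S

  Planar : Set
  Planar = ∀ t → CrossingFree drawing (VisibleAt t)

  PlanarGeometric : Set
  PlanarGeometric = ∀ t →
    CrossingFree drawing (VisibleAt t) × StraightLine drawing (VisibleAt t)

AdmitsPlanarStoryplan : Graph → Set
AdmitsPlanarStoryplan G = ∃[ ℓ ] Σ[ S ∈ Storyplan G ℓ ] Planar S

AdmitsPlanarGeometricStoryplan : Graph → Set
AdmitsPlanarGeometricStoryplan G =
  ∃[ ℓ ] Σ[ S ∈ Storyplan G ℓ ] PlanarGeometric S

{-# OPTIONS --safe #-}
module Submission where

-- A base edge A C and a set Z of eight points, indexed by the subsets of a
-- three-element set, are meant to be visible throughout.  The i-th of three
-- gadgets adds a hub X joined to A, C and Z, a vertex W joined to
-- A, C, X and the points of Z whose index contains i, and a vertex W′ joined to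
-- A, C, X and the other points.  Then the triangle A C X separates W from W′
-- (they are the two vertices left over by a K₅ minus an edge), hence it splits
-- Z according to i.  Curves can realise the three splits, but straight lines
-- cannot: whether a point lies in a triangle over A C depends only on its
-- directions from A and from C, and three such triangles with apices on one
-- side of A C never cut out all eight patterns.
--
-- That a gadget must be shown together with Z is forced by giving X three
-- copies.  If they were ever all visible together with A, C and W, two of them
-- would lie on the same side of the triangle A C W; so two copies have disjoint
-- intervals, and all their common neighbours are visible in the gap.

-- Order and equality of Cauchy reals are not decidable, so the geometric argument makes its sign
-- distinctions in continuation form towards `⊥`; its conclusion is a negation, so nothing is lost.
-- Signs pass from one orientation determinant to another by polynomial identities, checked term by
-- term on the rational sequences. It is not determined which of W and W′ lies inside the triangle,
-- nor on which side of A C the apex X lies. A Boolean for each gadget absorbs the first freedom,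
-- since complementing one digit only permutes the eight patterns. The second is harmless: triangles
-- on opposite sides of A C would have to enclose a common point of Z. In the planar storyplan a
-- time step is a pair of a gadget and a copy of its hub. A frame thus has thirteen vertices, and
-- the copies of X may share one position. Frames of different gadgets have only A, C and Z in
-- common, so three straight-line drawings, each sheared in its own way, have to agree only there.
-- Integer coordinates make all sign conditions checkable by evaluation.

open import Defs
open import Data.Bool.Base using (Bool; true; false; not; T; _∧_; _∨_; if_then_else_)
import Data.Bool.Properties as Bool
open import Data.Empty using (⊥; ⊥-elim)
open import Data.Fin.Base as Fin using (Fin; zero; suc; _↑ˡ_; _↑ʳ_; combine; remQuot; splitAt)
open import Data.Fin.Patterns using (0F; 1F; 2F; 3F; 4F; 5F; 6F; 7F; 8F)
import Data.Fin.Properties as Fin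
open import Data.Integer.Base as ℤ using (ℤ; +_; -[1+_])
import Data.Integer.Properties as ℤ
open import Data.Nat.Base as ℕ using (ℕ)
import Data.Nat.Properties as ℕ
open import Data.Product.Base using (_×_; _,_; proj₁; proj₂; ∃-syntax; Σ-syntax)
open import Data.Rational.Base as ℚ using (ℚ; 0ℚ; 1ℚ; ½; fromℚᵘ; toℚᵘ)
import Data.Rational.Properties as ℚ
open import Data.Rational.Solver using (module +-*-Solver)
open import Data.Rational.Unnormalised.Base as ℚᵘ using (mkℚᵘ; *≡*)
import Data.Rational.Unnormalised.Properties as ℚᵘ
open import Data.Sum.Base using (_⊎_; inj₁; inj₂)
open import Data.Vec.Base using (Vec; []; _∷_; lookup)
open import Function.Bundles using (Equivalence)
open import Relation.Binary.Definitions using (tri<; tri≈; tri>)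
open import Relation.Binary.PropositionalEquality
  using (_≡_; _≢_; refl; sym; trans; cong; cong₂; subst; subst₂)
open import Relation.Nullary.Decidable
  using (Dec; yes; no; does; toWitness; map′; _→-dec_; _×-dec_; _⊎-dec_; ¬?; recompute)
open import Relation.Nullary.Negation.Core using (¬_)

open +-*-Solver using (Polynomial; solve; _:=_; _:+_; _:*_; _:-_; :-_; con)

-- Real numbers

-- NN stands for nonnegative.
Pos NN Null : ℝ → Set
Pos x = 0ℝ < x
NN x = ¬ Pos (- x)
Null x = x ≈ 0ℝ

infix 4 _≐_

-- Finer than `_≈_`, but it is what the ring solver over the rationals delivers, at each index
-- separately. The polynomial identities below have this form.
_≐_ : ℝ → ℝ → Set
x ≐ y = ∀ n → seq x n ≡ seq y n

p≤∣p∣ : ∀ p → p ℚ.≤ ℚ.∣ p ∣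
p≤∣p∣ p with ℚ.≤-total 0ℚ p
... | inj₁ 0≤p = ℚ.≤-reflexive (sym (ℚ.0≤p⇒∣p∣≡p 0≤p))
... | inj₂ p≤0 = ℚ.≤-trans p≤0 (ℚ.0≤∣p∣ p)

-- Meant for two terms of a Cauchy sequence: a tolerance of `½ ε` leaves half of a bound `ε` that
-- was reached once.
eventually-≥ : ∀ {ε u v} → ε ℚ.≤ u → u ℚ.- v ℚ.≤ ½ ℚ.* ε → ½ ℚ.* ε ℚ.≤ v
eventually-≥ {ε} {u} {v} e h = subst₂ ℚ._≤_
  (solve 1 (λ e → e :- con ½ :* e := con ½ :* e) refl ε)
  (solve 2 (λ u v → u :- (u :- v) := v) refl u v)
  (ℚ.+-mono-≤ e (ℚ.neg-antimono-≤ h))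

0<* : ∀ {p q} → 0ℚ ℚ.< p → 0ℚ ℚ.< q → 0ℚ ℚ.< p ℚ.* q
0<* {p} {q} 0<p 0<q = ℚ.positive⁻¹ (p ℚ.* q)
  {{ℚ.pos*pos⇒pos p {{ℚ.positive 0<p}} q {{ℚ.positive 0<q}}}}

*-mono-≤ : ∀ {p q r s} → 0ℚ ℚ.≤ q → 0ℚ ℚ.≤ r → p ℚ.≤ q → r ℚ.≤ s → p ℚ.* r ℚ.≤ q ℚ.* s
*-mono-≤ {q = q} {r} 0≤q 0≤r p≤q r≤s = ℚ.≤-trans
  (ℚ.*-monoʳ-≤-nonNeg r {{ℚ.nonNegative 0≤r}} p≤q)
  (ℚ.*-monoˡ-≤-nonNeg q {{ℚ.nonNegative 0≤q}} r≤s)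

pos : ∀ {x} g → 0ℚ ℚ.< g → ∀ N → (∀ n → N ℕ.≤ n → g ℚ.≤ seq x n) → Pos x
pos g 0<g N h = mk< g 0<g N λ n p → subst (ℚ._≤ _) (sym (ℚ.+-identityˡ g)) (h n p)

posBound : ∀ {x} (x>0 : Pos x) n → _<_.from x>0 ℕ.≤ n → _<_.gap x>0 ℚ.≤ seq x n
posBound (mk< g _ _ h) n p = subst (ℚ._≤ _) (ℚ.+-identityˡ g) (h n p)

pos-≐ : ∀ {x y} → x ≐ y → Pos x → Pos y
pos-≐ e (mk< g 0<g N h) = mk< g 0<g N λ n p → subst (_ ℚ.≤_) (e n) (h n p)

pos-+ : ∀ {x y} → Pos x → Pos y → Pos (x + y)
pos-+ {x} {y} p@(mk< g 0<g M _) q@(mk< h 0<h N _) =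
  pos {x + y} (g ℚ.+ h) (ℚ.+-mono-< 0<g 0<h) (M ℕ.⊔ N) λ n l →
    ℚ.+-mono-≤ (posBound p n (ℕ.m⊔n≤o⇒m≤o M N l)) (posBound q n (ℕ.m⊔n≤o⇒n≤o M N l))

pos-* : ∀ {x y} → Pos x → Pos y → Pos (x * y)
pos-* {x} {y} p@(mk< g 0<g M _) q@(mk< h 0<h N _) =
  pos {x * y} (g ℚ.* h) (0<* 0<g 0<h) (M ℕ.⊔ N) λ n l →
    let g≤x = posBound p n (ℕ.m⊔n≤o⇒m≤o M N l) in
    *-mono-≤ (ℚ.≤-trans (ℚ.<⇒≤ 0<g) g≤x) (ℚ.<⇒≤ 0<h)
      g≤x (posBound q n (ℕ.m⊔n≤o⇒n≤o M N l))

pos⇒nn : ∀ {x} → Pos x → NN x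
pos⇒nn {x} p q with pos-+ {x} { - x} p q
... | r@(mk< g 0<g N _) = ℚ.<-irrefl refl (ℚ.<-≤-trans 0<g
  (subst (g ℚ.≤_) (ℚ.+-inverseʳ (seq x N)) (posBound r N ℕ.≤-refl)))

null-bound : ∀ {x} → Null x → ∀ ε → 0ℚ ℚ.< ε →
  ∃[ N ] (∀ n → N ℕ.≤ n → ℚ.∣ seq x n ∣ ℚ.≤ ε)
null-bound {x} (mk≈ c) ε 0<ε with c ε 0<ε
... | N , h = N , λ n p → subst (λ z → ℚ.∣ z ∣ ℚ.≤ ε) (ℚ.+-identityʳ (seq x n)) (h n p)

mkNull : ∀ {x} → (∀ ε → 0ℚ ℚ.< ε → ∃[ N ] (∀ n → N ℕ.≤ n → ℚ.∣ seq x n ∣ ℚ.≤ ε)) → Null x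
mkNull {x} c = mk≈ λ ε 0<ε → let N , h = c ε 0<ε in
  N , λ n p → subst (λ z → ℚ.∣ z ∣ ℚ.≤ ε) (sym (ℚ.+-identityʳ (seq x n))) (h n p)

null-≐ : ∀ {x y} → x ≐ y → Null x → Null y
null-≐ e (mk≈ c) = mk≈ λ ε 0<ε → let N , h = c ε 0<ε in
  N , λ n p → subst (λ z → dist z 0ℚ ℚ.≤ ε) (e n) (h n p)

≈⇒null : ∀ {x y} → x ≈ y → Null (x - y)
≈⇒null {x} {y} (mk≈ c) = mkNull {x - y} c

null⇒≈ : ∀ {x y} → Null (x - y) → x ≈ y
null⇒≈ {x} {y} n = mk≈ (null-bound {x - y} n)

≐⇒≈ : ∀ {x y} → x ≐ y → x ≈ y
≐⇒≈ {x} {y} e = mk≈ λ ε 0<ε → 0 , λ n _ →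
  subst (ℚ._≤ ε) (sym (trans (cong (λ z → ℚ.∣ z ℚ.- seq y n ∣) (e n))
    (cong ℚ.∣_∣ (ℚ.+-inverseʳ (seq y n))))) (ℚ.<⇒≤ 0<ε)

null-+ : ∀ {x y} → Null x → Null y → Null (x + y)
null-+ {x} {y} a b = mkNull {x + y} λ ε 0<ε →
  let M , f = null-bound {x} a (½ ℚ.* ε) (half-pos 0<ε)
      N , g = null-bound {y} b (½ ℚ.* ε) (half-pos 0<ε)
  in M ℕ.⊔ N , λ n l → subst (_ ℚ.≤_) (half+half ε)
    (ℚ.≤-trans (ℚ.∣p+q∣≤∣p∣+∣q∣ (seq x n) (seq y n))
      (ℚ.+-mono-≤ (f n (ℕ.m⊔n≤o⇒m≤o M N l)) (g n (ℕ.m⊔n≤o⇒n≤o M N l))))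

null-neg : ∀ {x} → Null x → Null (- x)
null-neg {x} a = mkNull { - x} λ ε 0<ε → let N , f = null-bound {x} a ε 0<ε in
  N , λ n l → subst (ℚ._≤ ε) (sym (ℚ.∣-p∣≡∣p∣ (seq x n))) (f n l)

null-* : ∀ c {x} → Null x → Null (c * x)
null-* c {x} a = mkNull {c * x} λ ε 0<ε →
  let B , M , 0<B , b = bounded {seq c} (cauchy c)
      δ , 0<δ , e = divide B B ε 0<B 0<B 0<ε
      N , f = null-bound {x} a δ 0<δ
  in M ℕ.⊔ N , λ n l → ℚ.≤-trans
    (∣*∣-mono (seq c n) (seq x n) 0<B (b n (ℕ.m⊔n≤o⇒m≤o M N l)) (f n (ℕ.m⊔n≤o⇒n≤o M N l)))
    (subst (B ℚ.* δ ℚ.≤_) e (subst (ℚ._≤ B ℚ.* δ ℚ.+ B ℚ.* δ) (ℚ.+-identityʳ (B ℚ.* δ))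
      (ℚ.+-monoʳ-≤ (B ℚ.* δ) (ℚ.<⇒≤ (0<* 0<B 0<δ)))))

-- Positivity respects `_≈_`: half of the gap survives once the sequences are within the other half
-- of each other.
pos-null : ∀ {x y} → Pos x → Null (x - y) → Pos y
pos-null {x} {y} p@(mk< g 0<g M _) a =
  let N , f = null-bound {x - y} a (½ ℚ.* g) (half-pos 0<g)
  in pos {y} (½ ℚ.* g) (half-pos 0<g) (M ℕ.⊔ N) λ n l →
    subst₂ ℚ._≤_ (lhs g) (rhs (seq x n) (seq y n))
      (ℚ.+-mono-≤ (posBound p n (ℕ.m⊔n≤o⇒m≤o M N l))
        (ℚ.neg-antimono-≤ (ℚ.≤-trans (p≤∣p∣ (seq x n ℚ.- seq y n)) (f n (ℕ.m⊔n≤o⇒n≤o M N l)))))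
  where
  lhs : ∀ g → g ℚ.- ½ ℚ.* g ≡ ½ ℚ.* g
  lhs = solve 1 (λ g → g :- con ½ :* g := con ½ :* g) refl
  rhs : ∀ x y → x ℚ.- (x ℚ.- y) ≡ y
  rhs = solve 2 (λ x y → x :- (x :- y) := y) refl

pos⇒¬null : ∀ {x} → Pos x → ¬ Null x
pos⇒¬null {x} p a = pos⇒nn {0ℝ} 0>0 (pos-≐ {0ℝ} { - 0ℝ} (λ _ → refl) 0>0)
  where
  0>0 : Pos 0ℝ
  0>0 = pos-null {x} {0ℝ} p (null-≐ {x} {x - 0ℝ} (λ n → solve 1 (λ x → x := x :- con 0ℚ) refl (seq x n)) a)

-- Rationals can be compared, so each late term can be tested. One of absolute value above `ε` would
-- keep all late terms beyond `½ ε` on its side of 0, which makes `x` or `- x` positive.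
nn-null : ∀ {x} → NN x → NN (- x) → Null x
nn-null {x} a b = mkNull {x} λ ε 0<ε →
  let N , f = cauchy x (½ ℚ.* ε) (half-pos 0<ε) in N , λ n p → small ε 0<ε N f n p
  where
  small : ∀ ε → 0ℚ ℚ.< ε → ∀ N →
    (∀ m n → N ℕ.≤ m → N ℕ.≤ n → dist (seq x m) (seq x n) ℚ.≤ ½ ℚ.* ε) →
    ∀ n → N ℕ.≤ n → ℚ.∣ seq x n ∣ ℚ.≤ ε
  small ε 0<ε N f n p with ℚ.∣ seq x n ∣ ℚ.≤? ε
  ... | yes q = q
  ... | no ¬q with ℚ.∣p∣≡p∨∣p∣≡-p (seq x n)
  ...   | inj₁ e = ⊥-elim (b (pos-≐ {x} { - (- x)} (λ n → solve 1 (λ x → x := :- (:- x)) refl (seq x n))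
            (pos {x} (½ ℚ.* ε) (half-pos 0<ε) N λ m q →
              eventually-≥ (subst (ε ℚ.≤_) e (ℚ.<⇒≤ (ℚ.≰⇒> ¬q)))
                (ℚ.≤-trans (p≤∣p∣ _) (f n m p q)))))
  ...   | inj₂ e = ⊥-elim (a
            (pos { - x} (½ ℚ.* ε) (half-pos 0<ε) N λ m q →
              eventually-≥ (subst (ε ℚ.≤_) e (ℚ.<⇒≤ (ℚ.≰⇒> ¬q)))
                (subst (ℚ._≤ ½ ℚ.* ε)
                  (solve 2 (λ u v → v :- u := (:- u) :- (:- v)) refl (seq x n) (seq x m))
                  (ℚ.≤-trans (p≤∣p∣ _) (f m n q p)))))

-- Trichotomy as an elimination into `⊥`; constructively the three cases cannot be offered as a sum.
-- The sign distinctions of the geometric argument go through it or through `weak`.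
tri : ∀ x → (Pos x → ⊥) → (Null x → ⊥) → (Pos (- x) → ⊥) → ⊥
tri x p z n = z (nn-null {x} n λ q → p (pos-≐ { - (- x)} {x}
  (λ n → solve 1 (λ x → :- (:- x) := x) refl (seq x n)) q))

-- A late term of `y` below `- ½ g` would make `- y` positive, so half of the gap `g` of `x`
-- survives in the sum.
pos-nn : ∀ {x y} → Pos x → NN y → Pos (x + y)
pos-nn {x} {y} p@(mk< g 0<g M _) ¬y =
  let N , f = cauchy y (½ ℚ.* ε) (half-pos 0<ε)
  in pos {x + y} ε 0<ε (M ℕ.⊔ N) λ n l →
    subst (ℚ._≤ _) (half g) (ℚ.+-mono-≤
      (posBound p n (ℕ.m⊔n≤o⇒m≤o M N l))
      (above N f n (ℕ.m⊔n≤o⇒n≤o M N l)))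
  where
  ε = ½ ℚ.* g
  0<ε = half-pos 0<g
  half : ∀ g → g ℚ.- ½ ℚ.* g ≡ ½ ℚ.* g
  half = solve 1 (λ g → g :- con ½ :* g := con ½ :* g) refl
  above : ∀ N → (∀ m n → N ℕ.≤ m → N ℕ.≤ n → dist (seq y m) (seq y n) ℚ.≤ ½ ℚ.* ε) →
    ∀ n → N ℕ.≤ n → ℚ.- ε ℚ.≤ seq y n
  above N f n l with (ℚ.- ε) ℚ.≤? seq y n
  ... | yes q = q
  ... | no ¬q = ⊥-elim (¬y (pos { - y} (½ ℚ.* ε) (half-pos 0<ε) N λ m l′ →
    eventually-≥ (subst (ℚ._≤ ℚ.- seq y n) (solve 1 (λ e → :- (:- e) := e) refl ε)
        (ℚ.neg-antimono-≤ (ℚ.<⇒≤ (ℚ.≰⇒> ¬q))))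
      (subst (ℚ._≤ ½ ℚ.* ε)
        (solve 2 (λ u v → v :- u := (:- u) :- (:- v)) refl (seq y n) (seq y m))
        (ℚ.≤-trans (p≤∣p∣ _) (f m n l′ l)))))

nn-≐ : ∀ {x y} → x ≐ y → NN x → NN y
nn-≐ {x} {y} e f p = f (pos-≐ { - y} { - x} (λ n → cong ℚ.-_ (sym (e n))) p)

null⇒nn : ∀ {x} → Null x → NN x
null⇒nn {x} a p = pos⇒¬null { - x} p (null-neg {x} a)

nn-+ : ∀ {x y} → NN x → NN y → NN (x + y)
nn-+ {x} {y} a b p = a (pos-≐ {(- (x + y)) + y} { - x}
  (λ n → solve 2 (λ x y → :- (x :+ y) :+ y := :- x) refl (seq x n) (seq y n))
  (pos-nn { - (x + y)} {y} p b))

nn-* : ∀ {x y} → NN x → NN y → NN (x * y)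
nn-* {x} {y} a b p = tri x
  (λ x>0 → tri y
    (λ y>0 → pos⇒nn {x * y} (pos-* {x} {y} x>0 y>0) p)
    (λ y≈0 → pos⇒¬null { - (x * y)} p (null-neg {x * y} (null-* x {y} y≈0)))
    b)
  (λ x≈0 → pos⇒¬null { - (x * y)} p (null-neg {x * y}
    (null-≐ {y * x} {x * y} (λ n → ℚ.*-comm (seq y n) (seq x n)) (null-* y {x} x≈0))))
  a

weak : ∀ x → (NN x → ⊥) → (NN (- x) → ⊥) → ⊥
weak x f g = tri x (λ p → f (pos⇒nn {x} p)) (λ z → f (null⇒nn {x} z)) (λ n → g (pos⇒nn { - x} n))

0<1 : Pos 1ℝ
0<1 = pos {1ℝ} 1ℚ (ℚ.positive⁻¹ 1ℚ) 0 λ _ _ → ℚ.≤-refl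

≈-sym : ∀ {x y} → x ≈ y → y ≈ x
≈-sym {x} {y} e = null⇒≈ {y} {x} (null-≐ { - (x - y)} {y - x}
  (λ n → solve 2 (λ x y → :- (x :- y) := y :- x) refl (seq x n) (seq y n))
  (null-neg {x - y} (≈⇒null {x} {y} e)))

≈-trans : ∀ {x y z} → x ≈ y → y ≈ z → x ≈ z
≈-trans {x} {y} {z} e f = null⇒≈ {x} {z} (null-≐ {(x - y) + (y - z)} {x - z}
  (λ n → solve 3 (λ x y z → (x :- y) :+ (y :- z) := x :- z) refl (seq x n) (seq y n) (seq z n))
  (null-+ {x - y} {y - z} (≈⇒null {x} {y} e) (≈⇒null {y} {z} f)))

inverse : ∀ {x} → Pos x → Σ[ y ∈ ℝ ] (Pos y × Null (x * y - 1ℝ))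
inverse {x} p@(mk< g 0<g M _) = y , y>0 , xy≈1
  where
  -- Clamping at the gap `g` makes every term invertible, and from index `M` on it changes nothing.
  d : ℕ.ℕ → ℚ
  d n = seq x n ℚ.⊔ g
  instance
    g+ : ℚ.Positive g
    g+ = ℚ.positive 0<g
    g≢0 : ℚ.NonZero g
    g≢0 = ℚ.pos⇒nonZero g
    d+ : ∀ {n} → ℚ.Positive (d n)
    d+ {n} = ℚ.positive (ℚ.<-≤-trans 0<g (ℚ.p≤q⊔p (seq x n) g))
    d≢0 : ∀ {n} → ℚ.NonZero (d n)
    d≢0 {n} = ℚ.pos⇒nonZero (d n)
  i : ℕ.ℕ → ℚ
  i n = ℚ.1/ d n
  w : ℚ
  w = ℚ.1/ g
  0≤i : ∀ n → 0ℚ ℚ.≤ i n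
  0≤i n = ℚ.<⇒≤ (ℚ.positive⁻¹ (i n) {{ℚ.1/pos⇒pos (d n)}})
  0<w : 0ℚ ℚ.< w
  0<w = ℚ.positive⁻¹ w {{ℚ.1/pos⇒pos g}}
  0≤w : 0ℚ ℚ.≤ w
  0≤w = ℚ.<⇒≤ 0<w
  d≡x : ∀ n → M ℕ.≤ n → d n ≡ seq x n
  d≡x n l = ℚ.p≥q⇒p⊔q≡p (posBound p n l)
  i≤w : ∀ n → i n ℚ.≤ w
  i≤w n = subst₂ ℚ._≤_
    (trans (cong (i n ℚ.*_) (ℚ.*-inverseʳ g)) (ℚ.*-identityʳ (i n)))
    (trans (sym (ℚ.*-assoc (i n) (d n) w)) (trans (cong (ℚ._* w) (ℚ.*-inverseˡ (d n))) (ℚ.*-identityˡ w)))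
    (ℚ.*-monoˡ-≤-nonNeg (i n) {{ℚ.nonNegative (0≤i n)}}
      (ℚ.*-monoʳ-≤-nonNeg w {{ℚ.nonNegative 0≤w}} (ℚ.p≤q⊔p (seq x n) g)))
  diff : ∀ m n → i m ℚ.- i n ≡ (i m ℚ.* i n) ℚ.* (d n ℚ.- d m)
  diff m n = trans (sym (cong₂ ℚ._-_
      (trans (cong (i m ℚ.*_) (ℚ.*-inverseˡ (d n))) (ℚ.*-identityʳ (i m)))
      (trans (cong (i n ℚ.*_) (ℚ.*-inverseˡ (d m))) (ℚ.*-identityʳ (i n)))))
    (solve 4 (λ i j d e → i :* (j :* e) :- j :* (i :* d) := (i :* j) :* (e :- d)) refl
      (i m) (i n) (d m) (d n))
  ∣i∣ : ∀ n → ℚ.∣ i n ∣ ℚ.≤ w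
  ∣i∣ n = subst (ℚ._≤ w) (sym (ℚ.0≤p⇒∣p∣≡p (0≤i n))) (i≤w n)
  i-cauchy : Cauchy i
  i-cauchy ε 0<ε =
    -- Reciprocals of numbers that are at least `g` differ by at most `1 / g²` times the difference
    -- of the numbers, hence the tolerance `g² ε`.
    let N , f = cauchy x ((g ℚ.* g) ℚ.* ε) (0<* (0<* 0<g 0<g) 0<ε) in
    M ℕ.⊔ N , λ m n k l → subst₂ ℚ._≤_ (cong ℚ.∣_∣ (sym (diff m n))) ww
      (∣*∣-mono (i m ℚ.* i n) (d n ℚ.- d m) (0<* 0<w 0<w)
        (∣*∣-mono (i m) (i n) 0<w (∣i∣ m) (∣i∣ n))
        (subst (ℚ._≤ (g ℚ.* g) ℚ.* ε)
          (sym (cong₂ (λ a b → ℚ.∣ a ℚ.- b ∣) (d≡x n (ℕ.m⊔n≤o⇒m≤o M N l)) (d≡x m (ℕ.m⊔n≤o⇒m≤o M N k))))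
          (f n m (ℕ.m⊔n≤o⇒n≤o M N l) (ℕ.m⊔n≤o⇒n≤o M N k))))
    where
    ww : (w ℚ.* w) ℚ.* ((g ℚ.* g) ℚ.* ε) ≡ ε
    ww = trans (solve 3 (λ w g e → (w :* w) :* ((g :* g) :* e) := (w :* g) :* ((w :* g) :* e)) refl w g ε)
      (trans (cong (λ u → u ℚ.* (u ℚ.* ε)) (ℚ.*-inverseˡ g))
        (trans (ℚ.*-identityˡ _) (ℚ.*-identityˡ ε)))
  y : ℝ
  y = mkℝ i i-cauchy
  xy≈1 : Null (x * y - 1ℝ)
  xy≈1 = mkNull {x * y - 1ℝ} λ ε 0<ε → M , λ n l → subst (ℚ._≤ ε)
    (sym (cong ℚ.∣_∣ (trans (cong (λ u → u ℚ.* i n ℚ.- 1ℚ) (sym (d≡x n l)))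
      (trans (cong (ℚ._- 1ℚ) (ℚ.*-inverseʳ (d n))) (ℚ.+-inverseʳ 1ℚ))))) (ℚ.<⇒≤ 0<ε)
  y>0 : Pos y
  y>0 = let B , N , 0<B , b = bounded {seq x} (cauchy x)
            instance
              B+ : ℚ.Positive B
              B+ = ℚ.positive 0<B
              B≢0 : ℚ.NonZero B
              B≢0 = ℚ.pos⇒nonZero B
            v = ℚ.1/ B
            0<v = ℚ.positive⁻¹ v {{ℚ.1/pos⇒pos B}}
        in pos {y} v 0<v (M ℕ.⊔ N) λ n l → subst₂ ℚ._≤_
          (trans (cong (ℚ._* v) (ℚ.*-inverseˡ (d n))) (ℚ.*-identityˡ v))
          (trans (ℚ.*-assoc (i n) B v) (trans (cong (i n ℚ.*_) (ℚ.*-inverseʳ B)) (ℚ.*-identityʳ (i n))))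
          (ℚ.*-monoʳ-≤-nonNeg v {{ℚ.nonNegative (ℚ.<⇒≤ 0<v)}}
            (ℚ.*-monoˡ-≤-nonNeg (i n) {{ℚ.nonNegative (0≤i n)}}
              (subst (ℚ._≤ B) (sym (d≡x n (ℕ.m⊔n≤o⇒m≤o M N l)))
                (ℚ.≤-trans (p≤∣p∣ (seq x n)) (b n (ℕ.m⊔n≤o⇒n≤o M N l))))))

pos-cancel : ∀ {h y} → Pos h → Pos (h * y) → Pos y
pos-cancel {h} {y} h>0 hy>0 = let ι , ι>0 , hι≈1 = inverse {h} h>0 in
  pos-null {ι * (h * y)} {y} (pos-* {ι} {h * y} ι>0 hy>0)
    (null-≐ {y * (h * ι - 1ℝ)} {ι * (h * y) - y}
      (λ n → solve 3 (λ y h i → y :* (h :* i :- con 1ℚ) := i :* (h :* y) :- y) refl (seq y n) (seq h n) (seq ι n))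
      (null-* y {h * ι - 1ℝ} hι≈1))

<⇒pos : ∀ {x y} → x < y → Pos (y - x)
<⇒pos {x} {y} (mk< g 0<g N h) = pos {y - x} g 0<g N λ n l →
  subst (ℚ._≤ seq y n ℚ.- seq x n)
    (solve 2 (λ x g → (x :+ g) :- x := g) refl (seq x n) g)
    (ℚ.+-monoˡ-≤ (ℚ.- seq x n) (h n l))

pos⇒< : ∀ {x y} → Pos (y - x) → x < y
pos⇒< {x} {y} p@(mk< g 0<g N _) = mk< g 0<g N λ n l →
  subst₂ ℚ._≤_ (ℚ.+-comm g (seq x n))
    (solve 2 (λ x y → (y :- x) :+ x := y) refl (seq x n) (seq y n))
    (ℚ.+-monoˡ-≤ (seq x n) (posBound p n l))

-- Orientations and crossings

-- Twice the signed area of the triangle `p q r`, positive for a counterclockwise turn.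
D : Point → Point → Point → ℝ
D p q r =
  (proj₁ q - proj₁ p) * (proj₂ r - proj₂ p) - (proj₂ q - proj₂ p) * (proj₁ r - proj₁ p)

Pointₚ : ℕ → Set
Pointₚ n = Polynomial n × Polynomial n

Dₚ : ∀ {n} → Pointₚ n → Pointₚ n → Pointₚ n → Polynomial n
Dₚ (p₁ , p₂) (q₁ , q₂) (r₁ , r₂) = (q₁ :- p₁) :* (r₂ :- p₂) :- (q₂ :- p₂) :* (r₁ :- p₁)

D-cyclic : ∀ p q r → D p q r ≐ D q r p
D-cyclic (a , b) (c , d) (e , f) n = solve 6 (λ a b c d e f →
  let p = a , b ; q = c , d ; r = e , f in Dₚ p q r := Dₚ q r p) refl
  (seq a n) (seq b n) (seq c n) (seq d n) (seq e n) (seq f n)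

D-swap : ∀ p q r → - D p q r ≐ D q p r
D-swap (a , b) (c , d) (e , f) n = solve 6 (λ a b c d e f →
  let p = a , b ; q = c , d ; r = e , f in :- Dₚ p q r := Dₚ q p r) refl
  (seq a n) (seq b n) (seq c n) (seq d n) (seq e n) (seq f n)

-- The three-term Grassmann-Plücker relation for the vectors from `o`. It is the tool for deducing
-- the sign of one determinant from the signs of the others.
plücker : ∀ o a b c d → D o a c * D o b d ≐ D o a b * D o c d + D o a d * D o b c
plücker (o , o′) (a , a′) (b , b′) (c , c′) (d , d′) n = solve 10
  (λ o o′ a a′ b b′ c c′ d d′ →
    let O = o , o′ ; A = a , a′ ; B = b , b′ ; C = c , c′ ; E = d , d′ in
    Dₚ O A C :* Dₚ O B E := Dₚ O A B :* Dₚ O C E :+ Dₚ O A E :* Dₚ O B C) refl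
  (seq o n) (seq o′ n) (seq a n) (seq a′ n) (seq b n) (seq b′ n)
  (seq c n) (seq c′ n) (seq d n) (seq d′ n)

-- Four points of the plane satisfy an affine dependence whose coefficients are, with alternating
-- signs, the orientations of the four triples. Here and in `D-affine₁` and `D-affine₂` the terms of
-- `p` and `r` are collected on one side, those of `q` and `s` on the other.
D-split : ∀ p q r s → D q r s + D p q s ≐ D p r s + D p q r
D-split (a , b) (c , d) (e , f) (g , h) n = solve 8 (λ a b c d e f g h →
  let p = a , b ; q = c , d ; r = e , f ; s = g , h in
  Dₚ q r s :+ Dₚ p q s := Dₚ p r s :+ Dₚ p q r) refl
  (seq a n) (seq b n) (seq c n) (seq d n) (seq e n) (seq f n) (seq g n) (seq h n)

D-affine₁ : ∀ p q r s →
  D q r s * proj₁ p + D p q s * proj₁ r ≐ D p r s * proj₁ q + D p q r * proj₁ s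
D-affine₁ (a , b) (c , d) (e , f) (g , h) n = solve 8 (λ a b c d e f g h →
  let p = a , b ; q = c , d ; r = e , f ; s = g , h in
  Dₚ q r s :* a :+ Dₚ p q s :* e := Dₚ p r s :* c :+ Dₚ p q r :* g) refl
  (seq a n) (seq b n) (seq c n) (seq d n) (seq e n) (seq f n) (seq g n) (seq h n)

D-affine₂ : ∀ p q r s →
  D q r s * proj₂ p + D p q s * proj₂ r ≐ D p r s * proj₂ q + D p q r * proj₂ s
D-affine₂ (a , b) (c , d) (e , f) (g , h) n = solve 8 (λ a b c d e f g h →
  let p = a , b ; q = c , d ; r = e , f ; s = g , h in
  Dₚ q r s :* b :+ Dₚ p q s :* f := Dₚ p r s :* d :+ Dₚ p q r :* h) refl
  (seq a n) (seq b n) (seq c n) (seq d n) (seq e n) (seq f n) (seq g n) (seq h n)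

Meet : Point → Point → Point → Point → Set
Meet p q r s = Σ[ x ∈ Point ] (OnSegment p q x × OnSegment r s x)

combination : ℝ → ℝ → ℝ → Point → Point → Point
combination ι α β (p₁ , p₂) (q₁ , q₂) = ι * (α * p₁ + β * q₁) , ι * (α * p₂ + β * q₂)

nn-scaled : ∀ {σ ι α} → Pos σ → Null (σ * ι - 1ℝ) → NN α → NN (α * ι)
nn-scaled {σ} {ι} {α} σ>0 e α≥0 p = α≥0 (pos-null {σ * - (α * ι)} { - α}
  (pos-* {σ} { - (α * ι)} σ>0 p)
  (null-≐ {(- α) * (σ * ι - 1ℝ)} {σ * - (α * ι) - (- α)}
    (λ n → solve 3 (λ s i a → (:- a) :* (s :* i :- con 1ℚ) := s :* (:- (a :* i)) :- (:- a)) refl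
      (seq σ n) (seq ι n) (seq α n))
    (null-* (- α) {σ * ι - 1ℝ} e)))

combination-on : ∀ {α β ι} p q → Pos (α + β) → Null ((α + β) * ι - 1ℝ) → NN α → NN β →
  OnSegment p q (combination ι α β p q)
combination-on {α} {β} {ι} (p₁ , p₂) (q₁ , q₂) σ>0 e α≥0 β≥0 =
  mkI (β * ι) 0≤t t≤1 , same p₁ q₁ , same p₂ q₂
  where
  0≤t : 0ℝ ≤ β * ι
  0≤t t<0 = nn-scaled {α + β} {ι} {β} σ>0 e β≥0 (lt⇒pos t<0)
    where
    lt⇒pos : β * ι < 0ℝ → Pos (- (β * ι))
    lt⇒pos l = pos-≐ {0ℝ - β * ι} { - (β * ι)}
      (λ n → solve 1 (λ x → con 0ℚ :- x := :- x) refl (seq (β * ι) n))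
      (<⇒pos {β * ι} {0ℝ} l)
  t≤1 : β * ι ≤ 1ℝ
  t≤1 1<t = nn-scaled {α + β} {ι} {α} σ>0 e α≥0 (pos-null {β * ι - 1ℝ} { - (α * ι)}
    (<⇒pos {1ℝ} {β * ι} 1<t)
    (null-≐ {(α + β) * ι - 1ℝ} {(β * ι - 1ℝ) - (- (α * ι))}
      (λ n → solve 3 (λ a b i → (a :+ b) :* i :- con 1ℚ := (b :* i :- con 1ℚ) :- (:- (a :* i))) refl
        (seq α n) (seq β n) (seq ι n)) e))
  same : ∀ x y → (1ℝ - β * ι) * x + (β * ι) * y ≈ ι * (α * x + β * y)
  same x y = null⇒≈ {(1ℝ - β * ι) * x + (β * ι) * y} {ι * (α * x + β * y)}
    (null-≐ {(- x) * ((α + β) * ι - 1ℝ)} {((1ℝ - β * ι) * x + (β * ι) * y) - ι * (α * x + β * y)}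
      (λ n → solve 5 (λ a b i x y → (:- x) :* ((a :+ b) :* i :- con 1ℚ) :=
          ((con 1ℚ :- b :* i) :* x :+ (b :* i) :* y) :- i :* (a :* x :+ b :* y)) refl
        (seq α n) (seq β n) (seq ι n) (seq x n) (seq y n))
      (null-* (- x) {(α + β) * ι - 1ℝ} e))

-- Dividing both combinations by their common total weight shows one point on both segments.
balanced-meet : ∀ {α β γ δ} p q r s → NN α → NN β → NN γ → NN δ → Pos (α + β) →
  α + β ≐ γ + δ →
  α * proj₁ p + β * proj₁ q ≐ γ * proj₁ r + δ * proj₁ s →
  α * proj₂ p + β * proj₂ q ≐ γ * proj₂ r + δ * proj₂ s →
  Meet p q r s
balanced-meet {α} {β} {γ} {δ} p@(p₁ , p₂) q@(q₁ , q₂) r@(r₁ , r₂) s@(s₁ , s₂)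
  α≥0 β≥0 γ≥0 δ≥0 σ>0 e₀ e₁ e₂ =
  let ι , _ , σι≈1 = inverse {α + β} σ>0
      t , h₁ , h₂ = combination-on {γ} {δ} {ι} r s (pos-≐ {α + β} {γ + δ} e₀ σ>0)
        (null-≐ {(α + β) * ι - 1ℝ} {(γ + δ) * ι - 1ℝ}
          (λ n → cong (λ z → z ℚ.* seq ι n ℚ.- 1ℚ) (e₀ n)) σι≈1) γ≥0 δ≥0
  in combination ι α β p q
   , combination-on {α} {β} {ι} p q σ>0 σι≈1 α≥0 β≥0
   , t
   , ≈-trans h₁ (≐⇒≈ {ι * (γ * r₁ + δ * s₁)} {ι * (α * p₁ + β * q₁)} λ n → cong (seq ι n ℚ.*_) (sym (e₁ n)))
   , ≈-trans h₂ (≐⇒≈ {ι * (γ * r₂ + δ * s₂)} {ι * (α * p₂ + β * q₂)} λ n → cong (seq ι n ℚ.*_) (sym (e₂ n)))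

-- The hypotheses say that p q r s is weakly convex.
diagonals-meet : ∀ p q r s →
  NN (D p q r) → NN (D q r s) → NN (D p r s) → NN (D p q s) → Pos (D q r s + D p q s) →
  Meet p r q s
diagonals-meet p q r s pqr qrs prs pqs σ>0 =
  balanced-meet {D q r s} {D p q s} {D p r s} {D p q r} p r q s qrs pqs prs pqr σ>0
    (D-split p q r s) (D-affine₁ p q r s) (D-affine₂ p q r s)

D-swap₂ : ∀ p q r → - D p q r ≐ D p r q
D-swap₂ (a , b) (c , d) (e , f) n = solve 6 (λ a b c d e f →
  let p = a , b ; q = c , d ; r = e , f in :- Dₚ p q r := Dₚ p r q) refl
  (seq a n) (seq b n) (seq c n) (seq d n) (seq e n) (seq f n)

D-sum : ∀ b u v t → D b u v + (D b v t + D b t u) ≐ D u v t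
D-sum (a , b) (c , d) (e , f) (g , h) n = solve 8 (λ a b c d e f g h →
  let p = a , b ; q = c , d ; r = e , f ; s = g , h in
  Dₚ p q r :+ (Dₚ p r s :+ Dₚ p s q) := Dₚ q r s) refl
  (seq a n) (seq b n) (seq c n) (seq d n) (seq e n) (seq f n) (seq g n) (seq h n)

≐-sym : ∀ {x y} → x ≐ y → y ≐ x
≐-sym e n = sym (e n)

pos-cyclic : ∀ p q r → Pos (D p q r) → Pos (D q r p)
pos-cyclic p q r = pos-≐ {D p q r} {D q r p} (D-cyclic p q r)

nn-cyclic : ∀ p q r → NN (D p q r) → NN (D q r p)
nn-cyclic p q r = nn-≐ {D p q r} {D q r p} (D-cyclic p q r)

pos-swap : ∀ p q r → Pos (- D p q r) → Pos (D q p r)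
pos-swap p q r = pos-≐ { - D p q r} {D q p r} (D-swap p q r)

pos-swap₂ : ∀ p q r → Pos (- D p q r) → Pos (D p r q)
pos-swap₂ p q r = pos-≐ { - D p q r} {D p r q} (D-swap₂ p q r)

nn-swap : ∀ p q r → NN (- D p q r) → NN (D q p r)
nn-swap p q r = nn-≐ { - D p q r} {D q p r} (D-swap p q r)

pos*neg : ∀ {x y} → Pos x → Pos (- y) → Pos (- (x * y))
pos*neg {x} {y} p q = pos-≐ {x * - y} { - (x * y)}
  (λ n → solve 2 (λ x y → x :* (:- y) := :- (x :* y)) refl (seq x n) (seq y n)) (pos-* {x} { - y} p q)

neg*neg : ∀ {x y} → Pos (- x) → Pos (- y) → Pos (x * y)
neg*neg {x} {y} p q = pos-≐ {(- x) * - y} {x * y}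
  (λ n → solve 2 (λ x y → (:- x) :* (:- y) := x :* y) refl (seq x n) (seq y n)) (pos-* { - x} { - y} p q)

pos-quotient : ∀ {x y h z} → x ≐ y + h * z → Pos x → Pos (- y) → Pos h → Pos z
pos-quotient {x} {y} {h} {z} e x>0 y<0 h>0 = pos-cancel {h} {z} h>0
  (pos-≐ {x + - y} {h * z}
    (λ n → trans (cong (ℚ._+ ℚ.- seq y n) (e n))
      (solve 3 (λ y h z → (y :+ h :* z) :+ (:- y) := h :* z) refl (seq y n) (seq h n) (seq z n)))
    (pos-+ {x} { - y} x>0 y<0))

-- Position of a point relative to a triangle

module _ (u v t b : Point) where

  -- The determinants are the barycentric coordinates of `b` with respect to `u v t`, multiplied by
  -- `D u v t`, which is positive wherever this is used.
  Inside : Set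
  Inside = Pos (D b u v) × Pos (D b v t) × Pos (D b t u)

  -- b lies beyond the vertex t, in the cone opposite to the triangle u v t.
  Beyond : Set
  Beyond = Pos (D b u v) × Pos (- D b v t) × Pos (- D b t u)

  -- Here `b` lies across the edge `u v` as seen from `t`, so `u b v t` is weakly convex and its
  -- diagonals `u v` and `b t` meet.
  beyond-edge : ¬ Meet u v b t → Pos (D u v t) →
    NN (- D b u v) → NN (D b v t) → NN (D b t u) → ⊥
  beyond-edge ¬m Δ>0 τ≤0 υ≥0 ν≥0 = ¬m (diagonals-meet u b v t
    ubv υ≥0 (pos⇒nn {D u v t} Δ>0) (nn-cyclic t u b (nn-cyclic b t u ν≥0))
    (pos-≐ {D u v t + D u b v} {D b v t + D u b t} (≐-sym {D b v t + D u b t} {D u v t + D u b v} (D-split u b v t))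
      (pos-nn {D u v t} {D u b v} Δ>0 ubv)))
    where
    ubv : NN (D u b v)
    ubv = nn-swap b u v τ≤0

-- A point of the line `u v` belongs to the edge, or one end of the edge lies between the point and
-- the other end. In each position some edge from `b` meets the opposite side of the triangle.
edge-line : ∀ u v t b → ¬ Meet u v b t → ¬ Meet v t b u → ¬ Meet t u b v → Pos (D u v t) →
  ¬ Null (D b u v)
edge-line u v t b ¬uv ¬vt ¬tu Δ>0 β≈0 = weak (D b v t)
  (λ υ≥0 → weak (D b t u)
    (λ ν≥0 → beyond-edge u v t b ¬uv Δ>0 (null⇒nn { - D b u v} (null-neg {D b u v} β≈0)) υ≥0 ν≥0)
    (λ ν≤0 → beyond-edge t u v b ¬tu (pos-cyclic v t u (pos-cyclic u v t Δ>0)) ν≤0 (null⇒nn {D b u v} β≈0) υ≥0))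
  (λ υ≤0 → weak (D b t u)
    (λ ν≥0 → beyond-edge v t u b ¬vt (pos-cyclic u v t Δ>0) υ≤0 ν≥0 (null⇒nn {D b u v} β≈0))
    (λ ν≤0 → nn-+ { - D b u v} { - D b v t + - D b t u}
      (null⇒nn { - D b u v} (null-neg {D b u v} β≈0))
      (nn-+ { - D b v t} { - D b t u} υ≤0 ν≤0)
      (pos-≐ {D u v t} { - (- D b u v + (- D b v t + - D b t u))}
        (λ n → trans (sym (D-sum b u v t n))
          (solve 3 (λ x y z → x :+ (y :+ z) := :- ((:- x) :+ ((:- y) :+ (:- z)))) refl
            (seq (D b u v) n) (seq (D b v t) n) (seq (D b t u) n))) Δ>0)))

-- The three coordinates add up to `D u v t`, so they are not all negative. Zeros are excluded by
-- `edge-line`, and a single negative coordinate causes a crossing by `beyond-edge`. What remains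
-- are three positive coordinates or exactly one.
K₄-position : ∀ u v t b → ¬ Meet u v b t → ¬ Meet v t b u → ¬ Meet t u b v → Pos (D u v t) →
  (Inside u v t b → ⊥) →
  (Beyond u v t b → ⊥) → (Beyond v t u b → ⊥) → (Beyond t u v b → ⊥) → ⊥
K₄-position u v t b ¬uv ¬vt ¬tu Δ>0 inside beyond-t beyond-u beyond-v =
  tri (D b u v)
    (λ τ>0 → tri (D b v t)
      (λ υ>0 → tri (D b t u)
        (λ ν>0 → inside (τ>0 , υ>0 , ν>0))
        ¬ν≈0
        (λ ν<0 → beyond-edge t u v b ¬tu Δ″>0 (pos⇒nn { - D b t u} ν<0)
          (pos⇒nn {D b u v} τ>0) (pos⇒nn {D b v t} υ>0)))
      ¬υ≈0
      (λ υ<0 → tri (D b t u)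
        (λ ν>0 → beyond-edge v t u b ¬vt Δ′>0 (pos⇒nn { - D b v t} υ<0)
          (pos⇒nn {D b t u} ν>0) (pos⇒nn {D b u v} τ>0))
        ¬ν≈0
        (λ ν<0 → beyond-t (τ>0 , υ<0 , ν<0))))
    (edge-line u v t b ¬uv ¬vt ¬tu Δ>0)
    (λ τ<0 → tri (D b v t)
      (λ υ>0 → tri (D b t u)
        (λ ν>0 → beyond-edge u v t b ¬uv Δ>0 (pos⇒nn { - D b u v} τ<0)
          (pos⇒nn {D b v t} υ>0) (pos⇒nn {D b t u} ν>0))
        ¬ν≈0
        (λ ν<0 → beyond-u (υ>0 , ν<0 , τ<0)))
      ¬υ≈0
      (λ υ<0 → tri (D b t u)
        (λ ν>0 → beyond-v (ν>0 , τ<0 , υ<0))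
        ¬ν≈0
        (λ ν<0 → pos⇒nn {D u v t} Δ>0
          (pos-≐ { - D b u v + (- D b v t + - D b t u)} { - D u v t}
            (λ n → trans (solve 3 (λ x y z → (:- x) :+ ((:- y) :+ (:- z)) := :- (x :+ (y :+ z))) refl
                (seq (D b u v) n) (seq (D b v t) n) (seq (D b t u) n))
              (cong ℚ.-_ (D-sum b u v t n)))
            (pos-+ { - D b u v} { - D b v t + - D b t u} τ<0
              (pos-+ { - D b v t} { - D b t u} υ<0 ν<0))))))
  where
  Δ′>0 : Pos (D v t u)
  Δ′>0 = pos-cyclic u v t Δ>0
  Δ″>0 : Pos (D t u v)
  Δ″>0 = pos-cyclic v t u Δ′>0
  ¬υ≈0 : ¬ Null (D b v t)
  ¬υ≈0 = edge-line v t u b ¬vt ¬tu ¬uv Δ′>0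
  ¬ν≈0 : ¬ Null (D b t u)
  ¬ν≈0 = edge-line t u v b ¬tu ¬uv ¬vt Δ″>0

-- Straight-line drawings of K₅ minus an edge

SameSign : ℝ → ℝ → Set
SameSign x y = (Pos x × Pos y) ⊎ (Pos (- x) × Pos (- y))

WeaklySameSign : ℝ → ℝ → Set
WeaklySameSign x y = (NN x × NN y) ⊎ (NN (- x) × NN (- y))

module _ (b d : Point) where

  -- If `u` and `v` also lie weakly on one side of the line `d b`, the four points are in weakly
  -- convex position with `d b` and `u v` as opposite sides, and the two diagonals are among the
  -- excluded pairs.
  same-side-meet : ∀ u v → Pos (D b u v) → Pos (D d u v) → ¬ Meet b u d v → ¬ Meet d u b v →
    ¬ WeaklySameSign (D d b u) (D d b v)
  same-side-meet u v β δ _ ¬m (inj₁ (y , z)) = ¬m (diagonals-meet d b u v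
    y (pos⇒nn {D b u v} β) (pos⇒nn {D d u v} δ) z (pos-nn {D b u v} {D d b v} β z))
  same-side-meet u v β δ ¬m _ (inj₂ (y , z)) = ¬m (diagonals-meet b d u v
    (nn-swap d b u y) (pos⇒nn {D d u v} δ) (pos⇒nn {D b u v} β) (nn-swap d b v z)
    (pos-nn {D d u v} {D b d v} δ (nn-swap d b v z)))

  SameSide : Point → Point → Set
  SameSide u v = SameSign (D b u v) (D d u v)

  same-side : ∀ u v → SameSide u v → ¬ Meet b u d v → ¬ Meet d u b v →
    ¬ WeaklySameSign (D d b u) (D d b v)
  same-side u v (inj₁ (β , δ)) ¬m ¬m′ = same-side-meet u v β δ ¬m ¬m′
  same-side u v (inj₂ (β , δ)) ¬m ¬m′ y = same-side-meet v u
    (pos-swap₂ b u v β) (pos-swap₂ d u v δ)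
    (λ (x , h , k) → ¬m′ (x , k , h)) (λ (x , h , k) → ¬m (x , k , h))
    (flip y)
    where
    flip : WeaklySameSign (D d b u) (D d b v) → WeaklySameSign (D d b v) (D d b u)
    flip (inj₁ (y , z)) = inj₁ (z , y)
    flip (inj₂ (y , z)) = inj₂ (z , y)

  -- Two of u, v, t lie weakly on the same side of the line d b.
  all-same-side : ∀ u v t → SameSide u v → SameSide v t → SameSide t u →
    ¬ Meet b u d v → ¬ Meet d u b v → ¬ Meet b v d t → ¬ Meet d v b t →
    ¬ Meet b t d u → ¬ Meet d t b u → ⊥
  all-same-side u v t uv vt tu m₁ m₂ m₃ m₄ m₅ m₆ = weak (D d b u)
    (λ y≥0 → weak (D d b v)
      (λ z≥0 → ¬uv (inj₁ (y≥0 , z≥0)))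
      (λ z≤0 → weak (D d b t)
        (λ w≥0 → ¬tu (inj₁ (w≥0 , y≥0)))
        (λ w≤0 → ¬vt (inj₂ (z≤0 , w≤0)))))
    (λ y≤0 → weak (D d b v)
      (λ z≥0 → weak (D d b t)
        (λ w≥0 → ¬vt (inj₁ (z≥0 , w≥0)))
        (λ w≤0 → ¬tu (inj₂ (w≤0 , y≤0))))
      (λ z≤0 → ¬uv (inj₂ (y≤0 , z≤0))))
    where
    ¬uv = same-side u v uv m₁ m₂
    ¬vt = same-side v t vt m₃ m₄
    ¬tu = same-side t u tu m₅ m₆

neg-cyclic : ∀ p q r → Pos (- D p q r) → Pos (- D q r p)
neg-cyclic p q r = pos-≐ { - D p q r} { - D q r p} (λ n → cong ℚ.-_ (D-cyclic p q r n))

neg*pos : ∀ {x y} → Pos (- x) → Pos y → Pos (- (x * y))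
neg*pos {x} {y} p q = pos-≐ {(- x) * y} { - (x * y)}
  (λ n → solve 2 (λ x y → (:- x) :* y := :- (x :* y)) refl (seq x n) (seq y n)) (pos-* { - x} {y} p q)

-- Since `b` lies beyond `u` and `d` beyond `v`, Plücker relations at `u` and at `v` make `b d v u`
-- convex, so its diagonals `b v` and `d u` meet.
beyond-distinct : ∀ u v t b d → Pos (D u v t) → ¬ Meet b v d u →
  Beyond v t u b → Beyond t u v d → ⊥
beyond-distinct u v t b d Δ>0 ¬m (β₁ , β₂ , β₃) (δ₁ , δ₂ , δ₃) = ¬m (diagonals-meet b d v u
  (pos⇒nn {D b d v} bdv) (pos⇒nn {D d v u} dvu)
  (pos⇒nn {D b v u} (pos-swap₂ b u v β₃)) (pos⇒nn {D b d u} bdu)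
  (pos-+ {D d v u} {D b d u} dvu bdu))
  where
  dvu : Pos (D d v u)
  dvu = pos-swap₂ d u v δ₂
  bdu : Pos (D b d u)
  bdu = pos-cyclic u b d (pos-quotient {D u v d * D u b t} {D u v b * D u d t} {D u v t} {D u b d}
    (plücker u v b d t)
    (neg*neg {D u v d} {D u b t} (neg-cyclic d u v δ₂) (neg-cyclic t u b (neg-cyclic b t u β₂)))
    (neg*pos {D u v b} {D u d t} (neg-cyclic b u v β₃) (pos-cyclic t u d (pos-cyclic d t u δ₁)))
    Δ>0)
  bdv : Pos (D b d v)
  bdv = pos-cyclic v b d (pos-quotient {D v t d * D v b u} {D v t b * D v d u} {D v t u} {D v b d}
    (plücker v t b d u)
    (neg*neg {D v t d} {D v b u} (neg-cyclic d v t δ₃) (neg-cyclic u v b (neg-cyclic b u v β₃)))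
    (pos*neg {D v t b} {D v d u} (pos-cyclic b v t β₁) (neg-cyclic u v d (neg-cyclic d u v δ₂)))
    (pos-cyclic u v t Δ>0))

-- The missing edge is `b d`. The fields after `Δ>0` are the twelve pairs of edges without a common
-- end.
record K₅⁻ (u v t b d : Point) : Set where
  field
    Δ>0   : Pos (D u v t)
    uv-bt : ¬ Meet u v b t
    vt-bu : ¬ Meet v t b u
    tu-bv : ¬ Meet t u b v
    uv-dt : ¬ Meet u v d t
    vt-du : ¬ Meet v t d u
    tu-dv : ¬ Meet t u d v
    bu-dv : ¬ Meet b u d v
    bv-du : ¬ Meet b v d u
    bv-dt : ¬ Meet b v d t
    bt-dv : ¬ Meet b t d v
    bt-du : ¬ Meet b t d u
    bu-dt : ¬ Meet b u d t

  Δ′>0 : Pos (D v t u)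
  Δ′>0 = pos-cyclic u v t Δ>0

  Δ″>0 : Pos (D t u v)
  Δ″>0 = pos-cyclic v t u Δ′>0

  not-all-same-side : SameSide b d u v → SameSide b d v t → SameSide b d t u → ⊥
  not-all-same-side uv vt tu = all-same-side b d u v t uv vt tu
    bu-dv (λ (x , h , k) → bv-du (x , k , h))
    bv-dt (λ (x , h , k) → bt-dv (x , k , h))
    bt-du (λ (x , h , k) → bu-dt (x , k , h))

  not-both-inside : Inside u v t b → Inside u v t d → ⊥
  not-both-inside (β₁ , β₂ , β₃) (δ₁ , δ₂ , δ₃) =
    not-all-same-side (inj₁ (β₁ , δ₁)) (inj₁ (β₂ , δ₂)) (inj₁ (β₃ , δ₃))

  -- An outside point lies beyond some vertex. If `b` and `d` lie beyond the same vertex, they are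
  -- on the same side of all three lines of the triangle; beyond different vertices
  -- `beyond-distinct` applies.
  not-both-outside : ¬ Inside u v t b → ¬ Inside u v t d → ⊥
  not-both-outside ¬b ¬d = position-b ¬b
    (λ b>t@(β₁ , β₂ , β₃) → position-d ¬d
      (λ (δ₁ , δ₂ , δ₃) → not-all-same-side (inj₁ (β₁ , δ₁)) (inj₂ (β₂ , δ₂)) (inj₂ (β₃ , δ₃)))
      (λ d>u → beyond-distinct t u v b d Δ″>0 bu-dt b>t d>u)
      (λ d>v → beyond-distinct v t u d b Δ′>0 (λ (x , h , k) → bv-dt (x , k , h)) d>v b>t))
    (λ b>u@(β₁ , β₂ , β₃) → position-d ¬d
      (λ d>t → beyond-distinct t u v d b Δ″>0 (λ (x , h , k) → bt-du (x , k , h)) d>t b>u)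
      (λ (δ₁ , δ₂ , δ₃) → not-all-same-side (inj₂ (β₃ , δ₃)) (inj₁ (β₁ , δ₁)) (inj₂ (β₂ , δ₂)))
      (λ d>v → beyond-distinct u v t b d Δ>0 bv-du b>u d>v))
    (λ b>v@(β₁ , β₂ , β₃) → position-d ¬d
      (λ d>t → beyond-distinct v t u b d Δ′>0 bt-dv b>v d>t)
      (λ d>u → beyond-distinct u v t d b Δ>0 (λ (x , h , k) → bu-dv (x , k , h)) d>u b>v)
      (λ (δ₁ , δ₂ , δ₃) → not-all-same-side (inj₂ (β₂ , δ₂)) (inj₂ (β₃ , δ₃)) (inj₁ (β₁ , δ₁))))
    where
    position-b = K₄-position u v t b uv-bt vt-bu tu-bv Δ>0
    position-d = K₄-position u v t d uv-dt vt-du tu-dv Δ>0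

-- Segments that do not cross the boundary of a triangle

pos-quotient′ : ∀ {h z x y} → h * z ≐ x + y → Pos h → Pos x → NN y → Pos z
pos-quotient′ {h} {z} {x} {y} e h>0 x>0 y≥0 = pos-cancel {h} {z} h>0
  (pos-≐ {x + y} {h * z} (≐-sym {h * z} {x + y} e) (pos-nn {x} {y} x>0 y≥0))

-- The ray from w towards z leaves the triangle through the edge u v.
exit-edge : ∀ u v t w z → Pos (D u v t) → Inside u v t w → ¬ Meet w z u v →
  NN (- D w z u) → NN (D w z v) → (Inside u v t z → ⊥) → ⊥
exit-edge u v t w z Δ>0 (ω-t , ω-u , ω-v) ¬m y-u y-v k = tri (D z u v)
  positive
  (λ ζ≈0 → leaves (null⇒nn { - D z u v} (null-neg {D z u v} ζ≈0)))
  (λ ζ<0 → leaves (pos⇒nn { - D z u v} ζ<0))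
  where
  wuz : NN (D w u z)
  wuz = nn-≐ { - D w z u} {D w u z} (D-swap₂ w z u) y-u
  leaves : NN (- D z u v) → ⊥
  leaves ζ = ¬m (diagonals-meet w u z v wuz uzv y-v (pos⇒nn {D w u v} ω-t)
    (pos-≐ {D w u v + D u z v} {D u z v + D w u v}
      (λ n → ℚ.+-comm (seq (D w u v) n) (seq (D u z v) n))
      (pos-nn {D w u v} {D u z v} ω-t uzv)))
    where
    uzv : NN (D u z v)
    uzv = nn-swap z u v ζ
  -- From `w` the point `z` is seen weakly between `u` and `v`, and it is on the near side of the
  -- line `u v`. Plücker relations at `v` and at `u` turn this into the two missing signs.
  positive : Pos (D z u v) → ⊥
  positive ζ = k (ζ
    , pos-cyclic t z v (pos-cyclic v t z (pos-quotient′ {D v w u} {D v t z} {D v w t * D v u z} {D v w z * D v t u}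
        (plücker v w t u z)
        (pos-cyclic u v w (pos-cyclic w u v ω-t))
        (neg*neg {D v w t} {D v u z}
          (pos-≐ {D w v t} { - D v w t} (≐-sym { - D v w t} {D w v t} (D-swap v w t)) ω-u)
          (pos-≐ {D v z u} { - D v u z} (≐-sym { - D v u z} {D v z u} (D-swap₂ v u z))
            (pos-cyclic u v z (pos-cyclic z u v ζ))))
        (nn-* {D v w z} {D v t u} (nn-cyclic z v w (nn-cyclic w z v y-v))
          (pos⇒nn {D v t u} (pos-cyclic u v t Δ>0)))))
    , pos-cyclic u z t (pos-quotient′ {D u v w} {D u z t} {D u v z * D u w t} {D u v t * D u z w}
        (plücker u v z w t)
        (pos-cyclic w u v ω-t)
        (pos-* {D u v z} {D u w t} (pos-cyclic z u v ζ) (pos-cyclic t u w (pos-cyclic w t u ω-v)))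
        (nn-* {D u v t} {D u z w} (pos⇒nn {D u v t} Δ>0) (nn-cyclic w u z wuz))))

-- Weighted by the barycentric coordinates of `w`, the vectors from `w` to `u`, `v` and `t` cancel;
-- the identity is the determinant of this sum with `z - w`.
D-balance : ∀ w z u v t → D w v t * D w z u + (D w t u * D w z v + D w u v * D w z t) ≐ 0ℝ
D-balance (w , w′) (z , z′) (u , u′) (v , v′) (t , t′) n = solve 10
  (λ w w′ z z′ u u′ v v′ t t′ →
    let W = w , w′ ; Z = z , z′ ; U = u , u′ ; V = v , v′ ; T = t , t′ in
    Dₚ W V T :* Dₚ W Z U :+ (Dₚ W T U :* Dₚ W Z V :+ Dₚ W U V :* Dₚ W Z T) := con 0ℚ) refl
  (seq w n) (seq w′ n) (seq z n) (seq z′ n) (seq u n) (seq u′ n)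
  (seq v n) (seq v′ n) (seq t n) (seq t′ n)

-- By `D-balance` the determinants of `u`, `v`, `t` against the direction from `w` to `z` are
-- neither all positive nor all negative. A change from negative to positive along the triangle
-- tells through which side the ray leaves, and `exit-edge` applies there.
inside-transfer : ∀ u v t w z → Pos (D u v t) → Inside u v t w →
  ¬ Meet w z u v → ¬ Meet w z v t → ¬ Meet w z t u → (Inside u v t z → ⊥) → ⊥
inside-transfer u v t w z Δ>0 w-in@(ω-t , ω-u , ω-v) ¬uv ¬vt ¬tu k = weak (D w z u)
  (λ u≥0 → weak (D w z v)
    (λ v≥0 → weak (D w z t)
      (λ t≥0 → tri (D w z u)
        (λ u>0 → zero-not-pos (pos-nn {D w v t * D w z u} {rest}
          (pos-* {D w v t} {D w z u} ω-u u>0)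
          (nn-+ {D w t u * D w z v} {D w u v * D w z t}
            (nn-* {D w t u} {D w z v} (pos⇒nn {D w t u} ω-v) v≥0)
            (nn-* {D w u v} {D w z t} (pos⇒nn {D w u v} ω-t) t≥0))))
        (λ u≈0 → exit-uv (null⇒nn { - D w z u} (null-neg {D w z u} u≈0)) v≥0)
        (λ u<0 → exit-uv (pos⇒nn { - D w z u} u<0) v≥0))
      (λ t≤0 → exit-tu t≤0 u≥0))
    (λ v≤0 → weak (D w z t)
      (λ t≥0 → exit-vt v≤0 t≥0)
      (λ t≤0 → exit-tu t≤0 u≥0)))
  (λ u≤0 → weak (D w z v)
    (λ v≥0 → exit-uv u≤0 v≥0)
    (λ v≤0 → weak (D w z t)
      (λ t≥0 → exit-vt v≤0 t≥0)
      (λ t≤0 → tri (D w z v)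
        (λ v>0 → exit-uv u≤0 (pos⇒nn {D w z v} v>0))
        (λ v≈0 → exit-uv u≤0 (null⇒nn {D w z v} v≈0))
        (λ v<0 → zero-not-pos (pos-≐ {total⁻} {total}
          (λ n → trans (solve 6 (λ a b c x y z →
              (b :* (:- y)) :+ (a :* (:- x) :+ c :* (:- z)) := :- (a :* x :+ (b :* y :+ c :* z))) refl
              (seq (D w v t) n) (seq (D w t u) n) (seq (D w u v) n)
              (seq (D w z u) n) (seq (D w z v) n) (seq (D w z t) n))
            (trans (cong ℚ.-_ (D-balance w z u v t n)) (sym (D-balance w z u v t n))))
          (pos-nn {D w t u * - D w z v} {D w v t * - D w z u + D w u v * - D w z t}
            (pos-* {D w t u} { - D w z v} ω-v v<0)
            (nn-+ {D w v t * - D w z u} {D w u v * - D w z t}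
              (nn-* {D w v t} { - D w z u} (pos⇒nn {D w v t} ω-u) u≤0)
              (nn-* {D w u v} { - D w z t} (pos⇒nn {D w u v} ω-t) t≤0))))))))
  where
  rest total total⁻ : ℝ
  rest = D w t u * D w z v + D w u v * D w z t
  total = D w v t * D w z u + rest
  total⁻ = D w t u * - D w z v + (D w v t * - D w z u + D w u v * - D w z t)
  zero-not-pos : Pos total → ⊥
  zero-not-pos p = pos⇒¬null {total} p (≐⇒≈ {total} {0ℝ} (D-balance w z u v t))
  exit-uv : NN (- D w z u) → NN (D w z v) → ⊥
  exit-uv p q = exit-edge u v t w z Δ>0 w-in ¬uv p q k
  exit-vt : NN (- D w z v) → NN (D w z t) → ⊥
  exit-vt p q = exit-edge v t u w z (pos-cyclic u v t Δ>0) (ω-u , ω-v , ω-t) ¬vt p q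
    (λ (a , b , c) → k (c , a , b))
  exit-tu : NN (- D w z t) → NN (D w z u) → ⊥
  exit-tu p q = exit-edge t u v w z (pos-cyclic v t u (pos-cyclic u v t Δ>0)) (ω-v , ω-t , ω-u) ¬tu p q
    (λ (a , b , c) → k (b , c , a))

-- Triangles over a common base

Dominated : (Fin 3 → Fin 3 → Set) → Fin 3 → Set
Dominated _≼_ i = ∃[ j ] (j ≢ i × i ≼ j)

-- A total relation on three elements leaves at most one element undominated.
two-dominated : (_≼_ : Fin 3 → Fin 3 → Set) →
  (∀ i j → (i ≼ j → ⊥) → (j ≼ i → ⊥) → ⊥) →
  (Dominated _≼_ 0F → Dominated _≼_ 1F → ⊥) →
  (Dominated _≼_ 1F → Dominated _≼_ 2F → ⊥) →
  (Dominated _≼_ 0F → Dominated _≼_ 2F → ⊥) → ⊥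
two-dominated _≼_ total k₀₁ k₁₂ k₀₂ = total 0F 1F
  (λ 0≼1 → total 1F 2F
    (λ 1≼2 → k₀₁ (1F , (λ ()) , 0≼1) (2F , (λ ()) , 1≼2))
    (λ 2≼1 → k₀₂ (1F , (λ ()) , 0≼1) (1F , (λ ()) , 2≼1)))
  (λ 1≼0 → total 0F 2F
    (λ 0≼2 → k₀₁ (2F , (λ ()) , 0≼2) (0F , (λ ()) , 1≼0))
    (λ 2≼0 → k₁₂ (0F , (λ ()) , 1≼0) (0F , (λ ()) , 2≼0)))

-- Each relation dominates two of the three elements, and two pairs in a set of three overlap.
commonly-dominated : (_≼_ _⊑_ : Fin 3 → Fin 3 → Set) →
  (∀ i j → (i ≼ j → ⊥) → (j ≼ i → ⊥) → ⊥) →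
  (∀ i j → (i ⊑ j → ⊥) → (j ⊑ i → ⊥) → ⊥) →
  (∀ i → Dominated _≼_ i → Dominated _⊑_ i → ⊥) → ⊥
commonly-dominated _≼_ _⊑_ ≼-total ⊑-total k = two-dominated _≼_ ≼-total
  (λ p q → two-dominated _⊑_ ⊑-total (λ r s → k 0F p r) (λ r s → k 1F q r) (λ r s → k 0F p r))
  (λ p q → two-dominated _⊑_ ⊑-total (λ r s → k 1F p s) (λ r s → k 1F p r) (λ r s → k 2F q s))
  (λ p q → two-dominated _⊑_ ⊑-total (λ r s → k 0F p r) (λ r s → k 2F q s) (λ r s → k 0F p r))

-- A triangle over the base a c is cut out by the directions of its apex as
-- seen from a and from c.  One of three apices is dominated in both respects,
-- hence no point lies outside its triangle only.
three-triangles : ∀ a c (x p : Fin 3 → Point) → (∀ i → Pos (D a c (x i))) →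
  (∀ i j → j ≢ i → ¬ ¬ Inside a c (x j) (p i)) →
  (∀ i → ¬ Inside a c (x i) (p i)) → ⊥
three-triangles a c x p h inside outside = commonly-dominated _≼_ _⊑_
  (λ i j f g → weak (D a (x j) (x i)) f
    (λ n → g (nn-≐ { - D a (x j) (x i)} {D a (x i) (x j)} (D-swap₂ a (x j) (x i)) n)))
  (λ i j f g → weak (D c (x i) (x j)) f
    (λ n → g (nn-≐ { - D c (x i) (x j)} {D c (x j) (x i)} (D-swap₂ c (x i) (x j)) n)))
  (λ i (j , j≢i , i≼j) (k , k≢i , i⊑k) →
    inside i j j≢i λ (_ , _ , zja) → inside i k k≢i λ (zac , zck , _) →
    outside i
      ( zac
      , pos-cyclic (x i) (p i) c (pos-cyclic c (x i) (p i) (at-c i k i⊑k zac zck))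
      , pos-cyclic a (p i) (x i) (at-a i j i≼j zac zja)))
  where
  _≼_ _⊑_ : Fin 3 → Fin 3 → Set
  -- The angle at `a` of the `i`-th triangle contains that of the `j`-th; `_⊑_` says the same about
  -- the angles at `c`.
  i ≼ j = NN (D a (x j) (x i))
  i ⊑ j = NN (D c (x i) (x j))
  at-a : ∀ i j {z} → i ≼ j → Pos (D z a c) → Pos (D z (x j) a) → Pos (D a z (x i))
  at-a i j {z} i≼j zac zja = pos-quotient′
    {D a c (x j)} {D a z (x i)} {D a c (x i) * D a z (x j)} {D a c z * D a (x j) (x i)}
    (λ n → trans (plücker a c z (x j) (x i) n)
      (solve 2 (λ x y → x :+ y := y :+ x) refl
        (seq (D a c z * D a (x j) (x i)) n) (seq (D a c (x i) * D a z (x j)) n)))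
    (h j)
    (pos-* {D a c (x i)} {D a z (x j)} (h i) (pos-cyclic (x j) a z (pos-cyclic z (x j) a zja)))
    (nn-* {D a c z} {D a (x j) (x i)} (pos⇒nn {D a c z} (pos-cyclic z a c zac)) i≼j)
  at-c : ∀ i j {z} → i ⊑ j → Pos (D z a c) → Pos (D z c (x j)) → Pos (D c (x i) z)
  at-c i j {z} i⊑j zac zcj = pos-quotient′
    {D c (x j) a} {D c (x i) z} {D c (x j) z * D c (x i) a} {D c (x i) (x j) * D c z a}
    (λ n → trans (plücker c (x j) (x i) a z n)
      (trans (cong₂ (λ u v → u ℚ.* v ℚ.+ seq (D c (x j) z * D c (x i) a) n)
          (sym (D-swap₂ c (x i) (x j) n)) (sym (D-swap₂ c z a n)))
        (solve 3 (λ x y z → (:- x) :* (:- y) :+ z := z :+ x :* y) refl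
          (seq (D c (x i) (x j)) n) (seq (D c z a) n) (seq (D c (x j) z * D c (x i) a) n))))
    (pos-cyclic a c (x j) (h j))
    (pos-* {D c (x j) z} {D c (x i) a} (pos-cyclic z c (x j) zcj) (pos-cyclic a c (x i) (h i)))
    (nn-* {D c (x i) (x j)} {D c z a} i⊑j
      (pos⇒nn {D c z a} (pos-cyclic a c z (pos-cyclic z a c zac))))

-- bit i j is the i-th binary digit of j.
bit : Fin 3 → Fin 8 → Bool
bit i j = lookup (lookup table j) i
  where
  table : Vec (Vec Bool 3) 8
  table = (false ∷ false ∷ false ∷ []) ∷ (true ∷ false ∷ false ∷ [])
        ∷ (false ∷ true ∷ false ∷ []) ∷ (true ∷ true ∷ false ∷ [])
        ∷ (false ∷ false ∷ true ∷ []) ∷ (true ∷ false ∷ true ∷ [])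
        ∷ (false ∷ true ∷ true ∷ []) ∷ (true ∷ true ∷ true ∷ []) ∷ []

pattern-with : (f : Fin 3 → Bool) → ∃[ j ] (∀ i → bit i j ≡ f i)
pattern-with f with f 0F in e₀ | f 1F in e₁ | f 2F in e₂
... | false | false | false = 0F , λ { 0F → sym e₀ ; 1F → sym e₁ ; 2F → sym e₂ }
... | true  | false | false = 1F , λ { 0F → sym e₀ ; 1F → sym e₁ ; 2F → sym e₂ }
... | false | true  | false = 2F , λ { 0F → sym e₀ ; 1F → sym e₁ ; 2F → sym e₂ }
... | true  | true  | false = 3F , λ { 0F → sym e₀ ; 1F → sym e₁ ; 2F → sym e₂ }
... | false | false | true  = 4F , λ { 0F → sym e₀ ; 1F → sym e₁ ; 2F → sym e₂ }
... | true  | false | true  = 5F , λ { 0F → sym e₀ ; 1F → sym e₁ ; 2F → sym e₂ }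
... | false | true  | true  = 6F , λ { 0F → sym e₀ ; 1F → sym e₁ ; 2F → sym e₂ }
... | true  | true  | true  = 7F , λ { 0F → sym e₀ ; 1F → sym e₁ ; 2F → sym e₂ }

-- The field `side` is needed because either of W and W′ may be the enclosed one. The double
-- negation in `inside` reflects that membership in a triangle cannot be decided.
record Splits (z : Fin 8 → Point) (i : Fin 3) (a c x : Point) : Set where
  field
    side     : Bool
    positive : Pos (D a c x)
    inside   : ∀ j → bit i j ≡ side → ¬ ¬ Inside a c x (z j)
    outside  : ∀ j → bit i j ≡ not side → ¬ Inside a c x (z j)

module _ (z : Fin 8 → Point) where
  open Splits

  -- All patterns occur, so some point is inside both triangles, although these lie on different
  -- sides of the line `a c`.
  opposite-bases : ∀ {a c i i′ x x′} → i ≢ i′ → Splits z i a c x → Splits z i′ c a x′ → ⊥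
  opposite-bases {a} {c} {i} {i′} i≢i′ s s′ =
    inside s j (trans (e i) at-i) λ (zac , _) → inside s′ j (trans (e i′) at-i′) λ (zca , _) →
      pos⇒nn {D (z j) a c} zac
        (pos-≐ {D (z j) c a} { - D (z j) a c} (≐-sym { - D (z j) a c} {D (z j) c a} (D-swap₂ (z j) a c)) zca)
    where
    f : Fin 3 → Bool
    f k = if does (k Fin.≟ i) then side s else side s′
    j = proj₁ (pattern-with f)
    e = proj₂ (pattern-with f)
    at-i : f i ≡ side s
    at-i with i Fin.≟ i
    ... | yes _ = refl
    ... | no i≢i = ⊥-elim (i≢i refl)
    at-i′ : f i′ ≡ side s′
    at-i′ with i′ Fin.≟ i
    ... | yes i′≡i = ⊥-elim (i≢i′ (sym i′≡i))
    ... | no _ = refl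

  -- For every `i` some index prescribes a point outside the `i`-th triangle and inside the other
  -- two, which `three-triangles` refutes.
  common-base : ∀ {a c} (x : Fin 3 → Point) → (∀ i → Splits z i a c (x i)) → ⊥
  common-base {a} {c} x s = three-triangles a c x (λ i → z (j i)) (λ i → positive (s i))
    (λ i k k≢i → inside (s k) (j i) (trans (e i k) (other i k k≢i)))
    (λ i → outside (s i) (j i) (trans (e i i) (own i)))
    where
    f : Fin 3 → Fin 3 → Bool
    f i k = if does (k Fin.≟ i) then not (side (s k)) else side (s k)
    j : Fin 3 → Fin 8
    j i = proj₁ (pattern-with (f i))
    e : ∀ i k → bit k (j i) ≡ f i k
    e i = proj₂ (pattern-with (f i))
    own : ∀ i → f i i ≡ not (side (s i))
    own i with i Fin.≟ i
    ... | yes _ = refl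
    ... | no i≢i = ⊥-elim (i≢i refl)
    other : ∀ i k → k ≢ i → f i k ≡ side (s k)
    other i k k≢i with k Fin.≟ i
    ... | yes k≡i = ⊥-elim (k≢i k≡i)
    ... | no _ = refl

  three-splits : ∀ a c (x : Fin 3 → Point) →
    (∀ i → (Splits z i a c (x i) → ⊥) → (Splits z i c a (x i) → ⊥) → ⊥) → ⊥
  three-splits a c x splits = splits 0F
    (λ s₀ → splits 1F
      (λ s₁ → splits 2F
        (λ s₂ → common-base x λ { 0F → s₀ ; 1F → s₁ ; 2F → s₂ })
        (λ s₂ → opposite-bases (λ ()) s₀ s₂))
      (λ s₁ → opposite-bases (λ ()) s₀ s₁))
    (λ s₀ → splits 1F
      (λ s₁ → opposite-bases (λ ()) s₁ s₀)
      (λ s₁ → splits 2F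
        (λ s₂ → opposite-bases (λ ()) s₂ s₀)
        (λ s₂ → common-base x λ { 0F → s₀ ; 1F → s₁ ; 2F → s₂ })))

-- Points on a common line

on-segment : ∀ {α β} p q r → Pos (α + β) → NN α → NN β →
  Null ((α * proj₁ p + β * proj₁ q) - (α + β) * proj₁ r) →
  Null ((α * proj₂ p + β * proj₂ q) - (α + β) * proj₂ r) → OnSegment p q r
on-segment {α} {β} (p₁ , p₂) (q₁ , q₂) (r₁ , r₂) σ>0 α≥0 β≥0 n₁ n₂ =
  let ι , _ , σι≈1 = inverse {α + β} σ>0
      t , h₁ , h₂ = combination-on {α} {β} {ι} (p₁ , p₂) (q₁ , q₂) σ>0 σι≈1 α≥0 β≥0
  in t , ≈-trans h₁ (scaled ι p₁ q₁ r₁ σι≈1 n₁) , ≈-trans h₂ (scaled ι p₂ q₂ r₂ σι≈1 n₂)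
  where
  scaled : ∀ ι x y z → Null ((α + β) * ι - 1ℝ) → Null ((α * x + β * y) - (α + β) * z) →
    ι * (α * x + β * y) ≈ z
  scaled ι x y z e n = null⇒≈ {ι * (α * x + β * y)} {z}
    (null-≐ {ι * ((α * x + β * y) - (α + β) * z) + z * ((α + β) * ι - 1ℝ)} {ι * (α * x + β * y) - z}
      (λ m → solve 6 (λ a b i x y z →
          i :* ((a :* x :+ b :* y) :- (a :+ b) :* z) :+ z :* ((a :+ b) :* i :- con 1ℚ) :=
          i :* (a :* x :+ b :* y) :- z) refl
        (seq α m) (seq β m) (seq ι m) (seq x m) (seq y m) (seq z m))
      (null-+ {ι * ((α * x + β * y) - (α + β) * z)} {z * ((α + β) * ι - 1ℝ)}
        (null-* ι {(α * x + β * y) - (α + β) * z} n) (null-* z {(α + β) * ι - 1ℝ} e)))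

nn-square : ∀ x → NN (x * x)
nn-square x p = weak x (λ x≥0 → nn-* {x} {x} x≥0 x≥0 p)
  (λ x≤0 → nn-* { - x} { - x} x≤0 x≤0 (pos-≐ { - (x * x)} { - ((- x) * (- x))}
    (λ n → solve 1 (λ x → :- (x :* x) := :- ((:- x) :* (:- x))) refl (seq x n)) p))

square-pos : ∀ {x} → Pos (- x) → Pos (x * x)
square-pos {x} n = neg*neg {x} {x} n n

-- The squared length `E` of `p q` and the inner product `k` give the parameter `k / E` of `r` on
-- the line; its place relative to 0 and 1 tells which point is in the middle. The equations needed
-- for this are multiples of `D p q r`.
collinear : ∀ p q r → ¬ (p ≈ₚ q) → Null (D p q r) →
  (OnSegment p q r → ⊥) → (OnSegment q r p → ⊥) → (OnSegment r p q → ⊥) → ⊥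
collinear p@(p₁ , p₂) q@(q₁ , q₂) r@(r₁ , r₂) p≉q pqr r-on p-on q-on = length-pos λ E>0 →
  tri k
    (λ k>0 → tri (E - k)
      (λ l>0 → r-between E>0 (pos⇒nn {E - k} l>0) (pos⇒nn {k} k>0))
      (λ l≈0 → r-between E>0 (null⇒nn {E - k} l≈0) (pos⇒nn {k} k>0))
      (λ l<0 → q-on (on-segment {E} {k - E} r p q
        (pos-+ {E} {k - E} E>0 (k>E l<0)) (pos⇒nn {E} E>0) (pos⇒nn {k - E} (k>E l<0))
        (null-≐ {(- e₂) * D p q r} {(E * r₁ + (k - E) * p₁) - (E + (k - E)) * q₁}
          (λ n → solve 6 (λ a b c d e f → let P = a , b ; Q = c , d ; R = e , f in
            (:- (d :- b)) :* Dₚ P Q R :=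
            (Eₚ P Q R :* e :+ (kₚ P Q R :- Eₚ P Q R) :* a) :- (Eₚ P Q R :+ (kₚ P Q R :- Eₚ P Q R)) :* c) refl
            (seq p₁ n) (seq p₂ n) (seq q₁ n) (seq q₂ n) (seq r₁ n) (seq r₂ n))
          (null-* (- e₂) {D p q r} pqr))
        (null-≐ {e₁ * D p q r} {(E * r₂ + (k - E) * p₂) - (E + (k - E)) * q₂}
          (λ n → solve 6 (λ a b c d e f → let P = a , b ; Q = c , d ; R = e , f in
            (c :- a) :* Dₚ P Q R :=
            (Eₚ P Q R :* f :+ (kₚ P Q R :- Eₚ P Q R) :* b) :- (Eₚ P Q R :+ (kₚ P Q R :- Eₚ P Q R)) :* d) refl
            (seq p₁ n) (seq p₂ n) (seq q₁ n) (seq q₂ n) (seq r₁ n) (seq r₂ n))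
          (null-* e₁ {D p q r} pqr)))))
    (λ k≈0 → r-between E>0 (λ l<0 → pos⇒¬null {E} E>0
        (nn-null {E} (pos⇒nn {E} E>0) (λ E>0′ → pos⇒¬null {k}
          (pos-≐ {(k - E) + E} {k} (λ n → solve 2 (λ k e → (k :- e) :+ e := k) refl (seq k n) (seq E n))
            (pos-+ {k - E} {E} (k>E l<0) E>0)) k≈0)))
      (null⇒nn {k} k≈0))
    (λ k<0 → p-on (on-segment { - k} {E} q r p
      (pos-+ { - k} {E} k<0 E>0) (pos⇒nn { - k} k<0) (pos⇒nn {E} E>0)
      (null-≐ {(- e₂) * D p q r} {((- k) * q₁ + E * r₁) - ((- k) + E) * p₁}
        (λ n → solve 6 (λ a b c d e f → let P = a , b ; Q = c , d ; R = e , f in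
          (:- (d :- b)) :* Dₚ P Q R :=
          ((:- kₚ P Q R) :* c :+ Eₚ P Q R :* e) :- ((:- kₚ P Q R) :+ Eₚ P Q R) :* a) refl
          (seq p₁ n) (seq p₂ n) (seq q₁ n) (seq q₂ n) (seq r₁ n) (seq r₂ n))
        (null-* (- e₂) {D p q r} pqr))
      (null-≐ {e₁ * D p q r} {((- k) * q₂ + E * r₂) - ((- k) + E) * p₂}
        (λ n → solve 6 (λ a b c d e f → let P = a , b ; Q = c , d ; R = e , f in
          (c :- a) :* Dₚ P Q R :=
          ((:- kₚ P Q R) :* d :+ Eₚ P Q R :* f) :- ((:- kₚ P Q R) :+ Eₚ P Q R) :* b) refl
          (seq p₁ n) (seq p₂ n) (seq q₁ n) (seq q₂ n) (seq r₁ n) (seq r₂ n))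
        (null-* e₁ {D p q r} pqr))))
  where
  e₁ e₂ E k : ℝ
  e₁ = q₁ - p₁
  e₂ = q₂ - p₂
  E = e₁ * e₁ + e₂ * e₂
  k = e₁ * (r₁ - p₁) + e₂ * (r₂ - p₂)
  Eₚ kₚ : ∀ {n} → Pointₚ n → Pointₚ n → Pointₚ n → Polynomial n
  Eₚ (a , b) (c , d) _ = (c :- a) :* (c :- a) :+ (d :- b) :* (d :- b)
  kₚ (a , b) (c , d) (e , f) = (c :- a) :* (e :- a) :+ (d :- b) :* (f :- b)
  k>E : Pos (- (E - k)) → Pos (k - E)
  k>E = pos-≐ { - (E - k)} {k - E}
    (λ n → solve 2 (λ e k → :- (e :- k) := k :- e) refl (seq E n) (seq k n))
  swap-sum : ∀ x y → Pos (y * y) → Pos (x * x + y * y)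
  swap-sum x y p = pos-≐ {y * y + x * x} {x * x + y * y}
    (λ n → ℚ.+-comm (seq y n ℚ.* seq y n) (seq x n ℚ.* seq x n)) (pos-nn {y * y} {x * x} p (nn-square x))
  length-pos : (Pos E → ⊥) → ⊥
  length-pos f = tri e₁
    (λ a → f (pos-nn {e₁ * e₁} {e₂ * e₂} (pos-* {e₁} {e₁} a a) (nn-square e₂)))
    (λ a → tri e₂
      (λ b → f (swap-sum e₁ e₂ (pos-* {e₂} {e₂} b b)))
      (λ b → p≉q (≈-sym (null⇒≈ {q₁} {p₁} a) , ≈-sym (null⇒≈ {q₂} {p₂} b)))
      (λ b → f (swap-sum e₁ e₂ (square-pos {e₂} b))))
    (λ a → f (pos-nn {e₁ * e₁} {e₂ * e₂} (square-pos {e₁} a) (nn-square e₂)))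
  r-between : Pos E → NN (E - k) → NN k → ⊥
  r-between E>0 l≥0 k≥0 = r-on (on-segment {E - k} {k} p q r
    (pos-≐ {E} {(E - k) + k} (λ n → solve 2 (λ e k → e := (e :- k) :+ k) refl (seq E n) (seq k n)) E>0)
    l≥0 k≥0
    (null-≐ {e₂ * D p q r} {((E - k) * p₁ + k * q₁) - ((E - k) + k) * r₁}
      (λ n → solve 6 (λ a b c d e f → let P = a , b ; Q = c , d ; R = e , f in
        (d :- b) :* Dₚ P Q R :=
        ((Eₚ P Q R :- kₚ P Q R) :* a :+ kₚ P Q R :* c) :- ((Eₚ P Q R :- kₚ P Q R) :+ kₚ P Q R) :* e) refl
        (seq p₁ n) (seq p₂ n) (seq q₁ n) (seq q₂ n) (seq r₁ n) (seq r₂ n))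
      (null-* e₂ {D p q r} pqr))
    (null-≐ {(- e₁) * D p q r} {((E - k) * p₂ + k * q₂) - ((E - k) + k) * r₂}
      (λ n → solve 6 (λ a b c d e f → let P = a , b ; Q = c , d ; R = e , f in
        (:- (c :- a)) :* Dₚ P Q R :=
        ((Eₚ P Q R :- kₚ P Q R) :* b :+ kₚ P Q R :* d) :- ((Eₚ P Q R :- kₚ P Q R) :+ kₚ P Q R) :* f) refl
        (seq p₁ n) (seq p₂ n) (seq q₁ n) (seq q₂ n) (seq r₁ n) (seq r₂ n))
      (null-* (- e₁) {D p q r} pqr)))

complement : UnitInterval → UnitInterval
complement (mkI t 0≤t t≤1) = mkI (1ℝ - t)
  (λ l → t≤1 (pos⇒< {1ℝ} {t} (pos-≐ {0ℝ - (1ℝ - t)} {t - 1ℝ}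
    (λ n → solve 1 (λ t → con 0ℚ :- (con 1ℚ :- t) := t :- con 1ℚ) refl (seq t n)) (<⇒pos {1ℝ - t} {0ℝ} l))))
  (λ l → 0≤t (pos⇒< {t} {0ℝ} (pos-≐ {(1ℝ - t) - 1ℝ} {0ℝ - t}
    (λ n → solve 1 (λ t → (con 1ℚ :- t) :- con 1ℚ := con 0ℚ :- t) refl (seq t n)) (<⇒pos {1ℝ} {1ℝ - t} l))))

on-segment-sym : ∀ p q x → OnSegment p q x → OnSegment q p x
on-segment-sym (p₁ , p₂) (q₁ , q₂) (x₁ , x₂) (t , e₁ , e₂) =
  complement t , back p₁ q₁ x₁ e₁ , back p₂ q₂ x₂ e₂
  where
  back : ∀ p q x → (1ℝ - val t) * p + val t * q ≈ x →
    (1ℝ - (1ℝ - val t)) * q + (1ℝ - val t) * p ≈ x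
  back p q x = ≈-trans {(1ℝ - (1ℝ - val t)) * q + (1ℝ - val t) * p} {(1ℝ - val t) * p + val t * q} {x}
    (≐⇒≈ {(1ℝ - (1ℝ - val t)) * q + (1ℝ - val t) * p} {(1ℝ - val t) * p + val t * q}
      λ n → solve 3 (λ t p q → (con 1ℚ :- (con 1ℚ :- t)) :* q :+ (con 1ℚ :- t) :* p :=
        (con 1ℚ :- t) :* p :+ t :* q) refl (seq (val t) n) (seq p n) (seq q n))

-- Bent segments

pos-half : ∀ {x} → Pos (x + x) → Pos x
pos-half {x} p = pos-≐ {fromℚ ½ * (x + x)} {x}
  (λ n → solve 1 (λ x → con ½ :* (x :+ x) := x) refl (seq x n))
  (pos-* {fromℚ ½} {x + x} (pos {fromℚ ½} ½ (ℚ.positive⁻¹ ½) 0 λ _ _ → ℚ.≤-refl) p)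

bound : ∀ c → Σ[ m ∈ ℝ ] (Pos m × Pos (m - c) × Pos (m + c))
bound c =
  let b , N , 0<b , h = bounded {seq c} (cauchy c)
      0<1ℚ = ℚ.positive⁻¹ 1ℚ
  in fromℚ (1ℚ ℚ.+ b)
   , pos {fromℚ (1ℚ ℚ.+ b)} (1ℚ ℚ.+ b) (ℚ.+-mono-< 0<1ℚ 0<b) 0 (λ _ _ → ℚ.≤-refl)
   , pos {fromℚ (1ℚ ℚ.+ b) - c} 1ℚ 0<1ℚ N (λ n l → lower 1ℚ b (seq c n) (ℚ.≤-trans (p≤∣p∣ (seq c n)) (h n l)))
   , pos {fromℚ (1ℚ ℚ.+ b) + c} 1ℚ 0<1ℚ N (λ n l → subst (λ z → 1ℚ ℚ.≤ 1ℚ ℚ.+ b ℚ.+ z)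
       (solve 1 (λ c → :- (:- c) := c) refl (seq c n))
       (lower 1ℚ b (ℚ.- seq c n) (ℚ.≤-trans (subst (ℚ.- seq c n ℚ.≤_) (ℚ.∣-p∣≡∣p∣ (seq c n)) (p≤∣p∣ (ℚ.- seq c n))) (h n l))))
  where
  lower : ∀ a b c → c ℚ.≤ b → a ℚ.≤ a ℚ.+ b ℚ.- c
  lower a b c l = subst₂ ℚ._≤_
    (solve 2 (λ a c → a :+ c :- c := a) refl a c)
    refl
    (ℚ.+-monoˡ-≤ (ℚ.- c) (ℚ.+-monoʳ-≤ a l))

-- Strict and one-sided to fit `Near`: exchanging `s` and `t` gives the other inequality, and the
-- bound `d` on the distance replaces an absolute value.
Lipschitz : (UnitInterval → ℝ) → Set
Lipschitz f = Σ[ k ∈ ℝ ] (Pos k × (∀ s t d → Pos d →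
  Pos (d - (val s - val t)) → Pos (d + (val s - val t)) → Pos (k * d - (f s - f t))))

lipschitz-≐ : ∀ {f g} → (∀ s → f s ≐ g s) → Lipschitz f → Lipschitz g
lipschitz-≐ {f} {g} e (k , k>0 , h) = k , k>0 , λ s t d d>0 p q →
  pos-≐ {k * d - (f s - f t)} {k * d - (g s - g t)}
    (λ n → cong₂ (λ x y → seq (k * d) n ℚ.- (x ℚ.- y)) (e s n) (e t n)) (h s t d d>0 p q)

lipschitz-const : ∀ c → Lipschitz (λ _ → c)
lipschitz-const c = 1ℝ , 0<1 , λ s t d d>0 _ _ → pos-≐ {d} {1ℝ * d - (c - c)}
  (λ n → solve 2 (λ c d → d := con 1ℚ :* d :- (c :- c)) refl (seq c n) (seq d n)) d>0

lipschitz-val : Lipschitz val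
lipschitz-val = 1ℝ , 0<1 , λ s t d _ p _ → pos-≐ {d - (val s - val t)} {1ℝ * d - (val s - val t)}
  (λ n → cong (ℚ._- seq (val s - val t) n) (sym (ℚ.*-identityˡ (seq d n)))) p

lipschitz-+ : ∀ {f g} → Lipschitz f → Lipschitz g → Lipschitz (λ s → f s + g s)
lipschitz-+ {f} {g} (k , k>0 , h) (l , l>0 , h′) = k + l , pos-+ {k} {l} k>0 l>0 , λ s t d d>0 p q →
  pos-≐ {(k * d - (f s - f t)) + (l * d - (g s - g t))} {(k + l) * d - ((f s + g s) - (f t + g t))}
    (λ n → solve 7 (λ k l d a b a′ b′ →
        (k :* d :- (a :- b)) :+ (l :* d :- (a′ :- b′)) := (k :+ l) :* d :- ((a :+ a′) :- (b :+ b′))) refl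
      (seq k n) (seq l n) (seq d n) (seq (f s) n) (seq (f t) n) (seq (g s) n) (seq (g t) n))
    (pos-+ {k * d - (f s - f t)} {l * d - (g s - g t)} (h s t d d>0 p q) (h′ s t d d>0 p q))

nn-val : ∀ s → NN (val s)
nn-val s p = UnitInterval.0≤ s (pos⇒< {val s} {0ℝ} (pos-≐ { - val s} {0ℝ - val s}
  (λ n → sym (ℚ.+-identityˡ _)) p))

nn-1-val : ∀ s → NN (1ℝ - val s)
nn-1-val s p = UnitInterval.≤1 s (pos⇒< {1ℝ} {val s} (pos-≐ { - (1ℝ - val s)} {val s - 1ℝ}
  (λ n → solve 1 (λ s → :- (con 1ℚ :- s) := s :- con 1ℚ) refl (seq (val s) n)) p))

-- 3d − (s² − t²) = d + (d − (s − t)) (s + t) + d (1 − s) + d (1 − t)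
lipschitz-square : Lipschitz (λ s → val s * val s)
lipschitz-square = three , pos-+ {1ℝ + 1ℝ} {1ℝ} (pos-+ {1ℝ} {1ℝ} 0<1 0<1) 0<1 , λ s t d d>0 p _ →
  let x = val s ; y = val t in
  pos-≐ {d + ((d - (x - y)) * (x + y) + d * ((1ℝ - x) + (1ℝ - y)))} {three * d - (x * x - y * y)}
    (λ n → solve 3 (λ d x y →
        d :+ ((d :- (x :- y)) :* (x :+ y) :+ d :* ((con 1ℚ :- x) :+ (con 1ℚ :- y))) :=
        (con 1ℚ :+ con 1ℚ :+ con 1ℚ) :* d :- (x :* x :- y :* y)) refl (seq d n) (seq x n) (seq y n))
    (pos-nn {d} {(d - (x - y)) * (x + y) + d * ((1ℝ - x) + (1ℝ - y))} d>0
      (nn-+ {(d - (x - y)) * (x + y)} {d * ((1ℝ - x) + (1ℝ - y))}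
        (nn-* {d - (x - y)} {x + y} (pos⇒nn {d - (x - y)} p) (nn-+ {x} {y} (nn-val s) (nn-val t)))
        (nn-* {d} {(1ℝ - x) + (1ℝ - y)} (pos⇒nn {d} d>0)
          (nn-+ {1ℝ - x} {1ℝ - y} (nn-1-val s) (nn-1-val t)))))
  where
  three : ℝ
  three = (1ℝ + 1ℝ) + 1ℝ

flip-gap : ∀ s t d → Pos (d + (s - t)) → Pos (d - (t - s))
flip-gap s t d = pos-≐ {d + (s - t)} {d - (t - s)}
  (λ n → solve 3 (λ s t d → d :+ (s :- t) := d :- (t :- s)) refl (seq s n) (seq t n) (seq d n))

flip-gap′ : ∀ s t d → Pos (d - (s - t)) → Pos (d + (t - s))
flip-gap′ s t d = pos-≐ {d - (s - t)} {d + (t - s)}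
  (λ n → solve 3 (λ s t d → d :- (s :- t) := d :+ (t :- s)) refl (seq s n) (seq t n) (seq d n))

-- With e± = k d ∓ (f s − f t), twice the claimed gap is (m + c) e₊ + (m − c) e₋.
lipschitz-* : ∀ c {f} → Lipschitz f → Lipschitz (λ s → c * f s)
lipschitz-* c {f} (k , k>0 , h) =
  let m , m>0 , m-c , m+c = bound c in
  m * k , pos-* {m} {k} m>0 k>0 , λ s t d d>0 p q →
    let e₊ = k * d - (f s - f t)
        e₋ = k * d - (f t - f s)
        g  = (m * k) * d - (c * f s - c * f t)
    in pos-half {g} (pos-≐ {(m + c) * e₊ + (m - c) * e₋} {g + g}
      (λ n → solve 6 (λ m c k d x y →
          (m :+ c) :* (k :* d :- (x :- y)) :+ (m :- c) :* (k :* d :- (y :- x)) :=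
          ((m :* k) :* d :- (c :* x :- c :* y)) :+ ((m :* k) :* d :- (c :* x :- c :* y))) refl
        (seq m n) (seq c n) (seq k n) (seq d n) (seq (f s) n) (seq (f t) n))
      (pos-+ {(m + c) * e₊} {(m - c) * e₋}
        (pos-* {m + c} {e₊} m+c (h s t d d>0 p q))
        (pos-* {m - c} {e₋} m-c (h t s d d>0 (flip-gap (val s) (val t) d q) (flip-gap′ (val s) (val t) d p)))))

lipschitz⇒near : ∀ {f} ((k , k>0 , _) : Lipschitz f) → ∀ s t d → Pos d →
  Near d (val s) (val t) → Near (k * d) (f s) (f t)
lipschitz⇒near {f} (k , k>0 , h) s t d d>0 (s<t , t<s) =
    pos⇒< {f s} {f t + k * d} (rearrange (f s) (f t) (k * d) (h s t d d>0 p q))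
  , pos⇒< {f t} {f s + k * d} (rearrange (f t) (f s) (k * d) (h t s d d>0 (flip-gap (val s) (val t) d q) (flip-gap′ (val s) (val t) d p)))
  where
  p : Pos (d - (val s - val t))
  p = pos-≐ {(val t + d) - val s} {d - (val s - val t)}
    (λ n → solve 3 (λ s t d → (t :+ d) :- s := d :- (s :- t)) refl (seq (val s) n) (seq (val t) n) (seq d n))
    (<⇒pos {val s} {val t + d} s<t)
  q : Pos (d + (val s - val t))
  q = pos-≐ {(val s + d) - val t} {d + (val s - val t)}
    (λ n → solve 3 (λ s t d → (s :+ d) :- t := d :+ (s :- t)) refl (seq (val s) n) (seq (val t) n) (seq d n))
    (<⇒pos {val t} {val s + d} t<s)
  rearrange : ∀ a b e → Pos (e - (a - b)) → Pos ((b + e) - a)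
  rearrange a b e = pos-≐ {e - (a - b)} {(b + e) - a}
    (λ n → solve 3 (λ a b e → e :- (a :- b) := (b :+ e) :- a) refl (seq a n) (seq b n) (seq e n))

near-mono : ∀ {δ ε x y} → Pos (ε - δ) → Near δ x y → Near ε x y
near-mono {δ} {ε} {x} {y} δ<ε (a , b) = widen x y a , widen y x b
  where
  widen : ∀ x y → x < y + δ → x < y + ε
  widen x y l = pos⇒< {x} {y + ε} (pos-≐ {((y + δ) - x) + (ε - δ)} {(y + ε) - x}
    (λ n → solve 4 (λ x y d e → ((y :+ d) :- x) :+ (e :- d) := (y :+ e) :- x) refl
      (seq x n) (seq y n) (seq δ n) (seq ε n))
    (pos-+ {(y + δ) - x} {ε - δ} (<⇒pos {x} {y + δ} l) δ<ε))

lipschitz-curve : (f g : UnitInterval → ℝ) → Lipschitz f → Lipschitz g → Curve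
lipschitz-curve f g lf@(k , k>0 , _) lg@(l , l>0 , _) = record
  { at = λ s → f s , g s
  ; continuous = λ s ε ε>0 →
      let m = k + l
          ι , ι>0 , mι≈1 = inverse {m} (pos-+ {k} {l} k>0 l>0)
          -- With `δ = ε / (k + l)` the remainders `ε - k δ = l δ` and `ε - l δ = k δ` are positive,
          -- so one `δ` serves both coordinates.
          δ = ι * ε
          δ>0 = pos-* {ι} {ε} ι>0 ε>0
      in δ , δ>0 , λ t st →
           near-mono {k * δ} {ε} {f s} {f t} (remaining k l ι ε l>0 ι>0 ε>0 mι≈1) (lipschitz⇒near lf s t δ δ>0 st)
         , near-mono {l * δ} {ε} {g s} {g t}
             (remaining l k ι ε k>0 ι>0 ε>0
               (null-≐ {(k + l) * ι - 1ℝ} {(l + k) * ι - 1ℝ}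
                 (λ n → cong (λ z → z ℚ.* seq ι n ℚ.- 1ℚ) (ℚ.+-comm (seq k n) (seq l n))) mι≈1))
             (lipschitz⇒near lg s t δ δ>0 st)
  }
  where
  remaining : ∀ k l ι ε → Pos l → Pos ι → Pos ε → Null ((k + l) * ι - 1ℝ) → Pos (ε - k * (ι * ε))
  remaining k l ι ε l>0 ι>0 ε>0 e = pos-null {l * (ι * ε)} {ε - k * (ι * ε)}
    (pos-* {l} {ι * ε} l>0 (pos-* {ι} {ε} ι>0 ε>0))
    (null-≐ {ε * ((k + l) * ι - 1ℝ)} {l * (ι * ε) - (ε - k * (ι * ε))}
      (λ n → solve 4 (λ k l i e → e :* ((k :+ l) :* i :- con 1ℚ) := l :* (i :* e) :- (e :- k :* (i :* e))) refl
        (seq k n) (seq l n) (seq ι n) (seq ε n))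
      (null-* ε {(k + l) * ι - 1ℝ} e))

-- A quadratic shear is a bijection of the plane, so bent segments with the same `k` meet exactly
-- where the straight ones do.
bend : ℝ → Point → Point
bend k (x , y) = x + k * (y * y) , y

lipschitz-affine : ∀ a b → Lipschitz (λ s → (1ℝ - val s) * a + val s * b)
lipschitz-affine a b = lipschitz-≐ {λ s → a + (b - a) * val s}
  (λ s n → solve 3 (λ a b s → a :+ (b :- a) :* s := (con 1ℚ :- s) :* a :+ s :* b) refl
    (seq a n) (seq b n) (seq (val s) n))
  (lipschitz-+ {λ _ → a} {λ s → (b - a) * val s} (lipschitz-const a) (lipschitz-* (b - a) {val} lipschitz-val))

bentSegment : ℝ → Point → Point → Curve
bentSegment k p@(p₁ , p₂) q@(q₁ , q₂) = lipschitz-curve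
  (λ s → proj₁ (bend k (between p q s))) (λ s → proj₂ (bend k (between p q s)))
  (lipschitz-+ {λ s → (1ℝ - val s) * p₁ + val s * q₁} {λ s → k * (y s * y s)} (lipschitz-affine p₁ q₁)
    -- The squared height is a quadratic polynomial in the parameter, so constants, `val` and its
    -- square suffice.
    (lipschitz-* k {λ s → y s * y s} (lipschitz-≐ {λ s → p₂ * p₂ + (b * val s + (e * e) * (val s * val s))}
      (λ s n → solve 3 (λ p q s →
          p :* p :+ ((p :* (q :- p) :+ p :* (q :- p)) :* s :+ ((q :- p) :* (q :- p)) :* (s :* s)) :=
          ((con 1ℚ :- s) :* p :+ s :* q) :* ((con 1ℚ :- s) :* p :+ s :* q)) refl
        (seq p₂ n) (seq q₂ n) (seq (val s) n))
      (lipschitz-+ {λ _ → p₂ * p₂} {λ s → b * val s + (e * e) * (val s * val s)} (lipschitz-const (p₂ * p₂))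
        (lipschitz-+ {λ s → b * val s} {λ s → (e * e) * (val s * val s)}
          (lipschitz-* b {val} lipschitz-val) (lipschitz-* (e * e) {λ s → val s * val s} lipschitz-square))))))
  (lipschitz-affine p₂ q₂)
  where
  e b : ℝ
  e = q₂ - p₂
  b = p₂ * e + p₂ * e
  y : UnitInterval → ℝ
  y s = (1ℝ - val s) * p₂ + val s * q₂

-- Integer coordinates

-- The second argument of `mkℚᵘ` is the denominator minus one, so this is `i / 1`.
fromℤ : ℤ → ℚ
fromℤ i = fromℚᵘ (mkℚᵘ i 0)

fromℤ-+ : ∀ i j → fromℤ i ℚ.+ fromℤ j ≡ fromℤ (i ℤ.+ j)
fromℤ-+ i j = ℚ.toℚᵘ-injective (ℚᵘ.≃-trans (ℚ.toℚᵘ-homo-+ (fromℤ i) (fromℤ j))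
  (ℚᵘ.≃-trans (ℚᵘ.+-cong (ℚ.toℚᵘ-fromℚᵘ (mkℚᵘ i 0)) (ℚ.toℚᵘ-fromℚᵘ (mkℚᵘ j 0)))
    (ℚᵘ.≃-trans (*≡* (cong (ℤ._* ℤ.1ℤ) (cong₂ ℤ._+_ (ℤ.*-identityʳ i) (ℤ.*-identityʳ j))))
      (ℚᵘ.≃-sym (ℚ.toℚᵘ-fromℚᵘ (mkℚᵘ (i ℤ.+ j) 0))))))

fromℤ-* : ∀ i j → fromℤ i ℚ.* fromℤ j ≡ fromℤ (i ℤ.* j)
fromℤ-* i j = ℚ.toℚᵘ-injective (ℚᵘ.≃-trans (ℚ.toℚᵘ-homo-* (fromℤ i) (fromℤ j))
  (ℚᵘ.≃-trans (ℚᵘ.*-cong (ℚ.toℚᵘ-fromℚᵘ (mkℚᵘ i 0)) (ℚ.toℚᵘ-fromℚᵘ (mkℚᵘ j 0)))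
    (ℚᵘ.≃-trans (*≡* refl) (ℚᵘ.≃-sym (ℚ.toℚᵘ-fromℚᵘ (mkℚᵘ (i ℤ.* j) 0))))))

fromℤ-neg : ∀ i → ℚ.- fromℤ i ≡ fromℤ (ℤ.- i)
fromℤ-neg i = ℚ.toℚᵘ-injective (ℚᵘ.≃-trans (ℚ.toℚᵘ-homo‿- (fromℤ i))
  (ℚᵘ.≃-trans (ℚᵘ.-‿cong (ℚ.toℚᵘ-fromℚᵘ (mkℚᵘ i 0)))
    (ℚᵘ.≃-sym (ℚ.toℚᵘ-fromℚᵘ (mkℚᵘ (ℤ.- i) 0)))))

fromℤ-minus : ∀ i j → fromℤ i ℚ.- fromℤ j ≡ fromℤ (i ℤ.- j)
fromℤ-minus i j = trans (cong (fromℤ i ℚ.+_) (fromℤ-neg j)) (fromℤ-+ i (ℤ.- j))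

ι : ℤ → ℝ
ι i = fromℚ (fromℤ i)

ι-pos : ∀ n → Pos (ι (+ ℕ.suc n))
ι-pos n = pos {ι (+ ℕ.suc n)} (fromℤ (+ ℕ.suc n))
  (ℚ.toℚᵘ-cancel-< (ℚᵘ.<-≤-trans 0<n (ℚᵘ.≤-reflexive (ℚᵘ.≃-sym (ℚ.toℚᵘ-fromℚᵘ (mkℚᵘ (+ ℕ.suc n) 0))))))
  0 λ _ _ → ℚ.≤-refl
  where
  0<n : toℚᵘ 0ℚ ℚᵘ.< mkℚᵘ (+ ℕ.suc n) 0
  0<n = ℚᵘ.positive⁻¹ (mkℚᵘ (+ ℕ.suc n) 0)

ι-neg : ∀ n → Pos (- ι -[1+ n ])
ι-neg n = pos-≐ {ι (+ ℕ.suc n)} { - ι -[1+ n ]} (λ _ → sym (fromℤ-neg -[1+ n ])) (ι-pos n)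

ℤPoint : Set
ℤPoint = ℤ × ℤ

infix 9 ⟦_⟧

⟦_⟧ : ℤPoint → Point
⟦ x , y ⟧ = ι x , ι y

-- On the concrete drawing this evaluates to a numeral, so orientations there are decided by
-- computation.
Dℤ : ℤPoint → ℤPoint → ℤPoint → ℤ
Dℤ (a , b) (c , d) (e , f) = (c ℤ.- a) ℤ.* (f ℤ.- b) ℤ.- (d ℤ.- b) ℤ.* (e ℤ.- a)

D-ι : ∀ p q r → D ⟦ p ⟧ ⟦ q ⟧ ⟦ r ⟧ ≐ ι (Dℤ p q r)
D-ι (a , b) (c , d) (e , f) _ = trans
  (cong₂ ℚ._-_
    (trans (cong₂ ℚ._*_ (fromℤ-minus c a) (fromℤ-minus f b)) (fromℤ-* (c ℤ.- a) (f ℤ.- b)))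
    (trans (cong₂ ℚ._*_ (fromℤ-minus d b) (fromℤ-minus e a)) (fromℤ-* (d ℤ.- b) (e ℤ.- a))))
  (fromℤ-minus ((c ℤ.- a) ℤ.* (f ℤ.- b)) ((d ℤ.- b) ℤ.* (e ℤ.- a)))

nonzero : ℤ → Bool
nonzero (+ 0)         = false
nonzero (+ ℕ.suc _)   = true
nonzero -[1+ _ ]      = true

sameSign : ℤ → ℤ → Bool
sameSign (+ ℕ.suc _) (+ ℕ.suc _) = true
sameSign -[1+ _ ]    -[1+ _ ]    = true
sameSign _           _           = false

Signed : ℝ → Set
Signed x = Pos x ⊎ Pos (- x)

signed-ι : ∀ i → T (nonzero i) → Signed (ι i)
signed-ι (+ ℕ.suc n) _ = inj₁ (ι-pos n)
signed-ι -[1+ n ]    _ = inj₂ (ι-neg n)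

sameSign-ι : ∀ i j → T (sameSign i j) → SameSign (ι i) (ι j)
sameSign-ι (+ ℕ.suc m) (+ ℕ.suc n) _ = inj₁ (ι-pos m , ι-pos n)
sameSign-ι -[1+ m ]    -[1+ n ]    _ = inj₂ (ι-neg m , ι-neg n)
sameSign-ι (+ 0)       (+ 0)       ()
sameSign-ι (+ 0)       (+ ℕ.suc _) ()
sameSign-ι (+ ℕ.suc _) (+ 0)       ()

signed-≐ : ∀ {x y} → x ≐ y → Signed x → Signed y
signed-≐ {x} {y} e (inj₁ p) = inj₁ (pos-≐ {x} {y} e p)
signed-≐ {x} {y} e (inj₂ p) = inj₂ (pos-≐ { - x} { - y} (λ n → cong ℚ.-_ (e n)) p)

null-cancel : ∀ {c x} → Signed c → Null (c * x) → Null x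
null-cancel {c} {x} (inj₁ c>0) n =
  let i , _ , ci≈1 = inverse {c} c>0 in
  null-≐ {i * (c * x) + (- x) * (c * i - 1ℝ)} {x}
    (λ n → solve 3 (λ c i x → i :* (c :* x) :+ (:- x) :* (c :* i :- con 1ℚ) := x) refl
      (seq c n) (seq i n) (seq x n))
    (null-+ {i * (c * x)} {(- x) * (c * i - 1ℝ)} (null-* i {c * x} n) (null-* (- x) {c * i - 1ℝ} ci≈1))
null-cancel {c} {x} (inj₂ c<0) n = null-cancel { - c} {x} (inj₁ c<0)
  (null-≐ { - (c * x)} {(- c) * x}
    (λ n → solve 2 (λ c x → :- (c :* x) := (:- c) :* x) refl (seq c n) (seq x n)) (null-neg {c * x} n))

signed⇒¬null : ∀ {x} → Signed x → ¬ Null x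
signed⇒¬null {x} (inj₁ p) = pos⇒¬null {x} p
signed⇒¬null {x} (inj₂ p) n = pos⇒¬null { - x} p (null-neg {x} n)

≈ₚ-sym : ∀ {p q} → p ≈ₚ q → q ≈ₚ p
≈ₚ-sym (a , b) = ≈-sym a , ≈-sym b

≈ₚ-trans : ∀ {p q r} → p ≈ₚ q → q ≈ₚ r → p ≈ₚ r
≈ₚ-trans (a , b) (c , d) = ≈-trans a c , ≈-trans b d

bend-cong : ∀ k {p q} → p ≈ₚ q → bend k p ≈ₚ bend k q
bend-cong k {a , b} {c , d} (e , f) = null⇒≈ {a + k * (b * b)} {c + k * (d * d)}
    (null-≐ {(a - c) + (k * (b + d)) * (b - d)} {(a + k * (b * b)) - (c + k * (d * d))}
      (λ n → solve 5 (λ k a b c d → (a :- c) :+ (k :* (b :+ d)) :* (b :- d) :=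
          (a :+ k :* (b :* b)) :- (c :+ k :* (d :* d))) refl
        (seq k n) (seq a n) (seq b n) (seq c n) (seq d n))
      (null-+ {a - c} {(k * (b + d)) * (b - d)} (≈⇒null {a} {c} e)
        (null-* (k * (b + d)) {b - d} (≈⇒null {b} {d} f))))
  , f

bend-injective : ∀ k {p q} → bend k p ≈ₚ bend k q → p ≈ₚ q
bend-injective k {a , b} {c , d} (e , f) = null⇒≈ {a} {c}
    (null-≐ {((a + k * (b * b)) - (c + k * (d * d))) + (- (k * (b + d))) * (b - d)} {a - c}
      (λ n → solve 5 (λ k a b c d →
          ((a :+ k :* (b :* b)) :- (c :+ k :* (d :* d))) :+ (:- (k :* (b :+ d))) :* (b :- d) := a :- c) refl
        (seq k n) (seq a n) (seq b n) (seq c n) (seq d n))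
      (null-+ {(a + k * (b * b)) - (c + k * (d * d))} {(- (k * (b + d))) * (b - d)}
        (≈⇒null {a + k * (b * b)} {c + k * (d * d)} e)
        (null-* (- (k * (b + d))) {b - d} (≈⇒null {b} {d} f))))
  , f

on-segment-cong : ∀ p q {x y} → OnSegment p q x → x ≈ₚ y → OnSegment p q y
on-segment-cong p q (t , e) f = t , ≈ₚ-trans e f

D-cong₃ : ∀ p q {x y} → x ≈ₚ y → Null (D p q x - D p q y)
D-cong₃ p@(a , b) q@(c , d) {x@(x₁ , x₂)} {y@(y₁ , y₂)} (e , f) =
  null-≐ {(c - a) * (x₂ - y₂) + (b - d) * (x₁ - y₁)} {D p q x - D p q y}
    (λ n → solve 8 (λ a b c d x x′ y y′ → (c :- a) :* (x′ :- y′) :+ (b :- d) :* (x :- y) :=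
        Dₚ (a , b) (c , d) (x , x′) :- Dₚ (a , b) (c , d) (y , y′)) refl
      (seq a n) (seq b n) (seq c n) (seq d n) (seq x₁ n) (seq x₂ n) (seq y₁ n) (seq y₂ n))
    (null-+ {(c - a) * (x₂ - y₂)} {(b - d) * (x₁ - y₁)}
      (null-* (c - a) {x₂ - y₂} (≈⇒null {x₂} {y₂} f)) (null-* (b - d) {x₁ - y₁} (≈⇒null {x₁} {y₁} e)))

D-between : ∀ p q r s t → D p q (between r s t) ≐ (1ℝ - val t) * D p q r + val t * D p q s
D-between (a , b) (c , d) (e , f) (g , h) t n = solve 9 (λ a b c d e f g h t →
  let p = a , b ; q = c , d ; r = e , f ; s = g , h in
  Dₚ p q ((con 1ℚ :- t) :* e :+ t :* g , (con 1ℚ :- t) :* f :+ t :* h) :=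
  (con 1ℚ :- t) :* Dₚ p q r :+ t :* Dₚ p q s) refl
  (seq a n) (seq b n) (seq c n) (seq d n) (seq e n) (seq f n) (seq g n) (seq h n) (seq (val t) n)

D-between-self : ∀ p q t → D p q (between p q t) ≐ 0ℝ
D-between-self (a , b) (c , d) t n = solve 5 (λ a b c d t →
  Dₚ (a , b) (c , d) ((con 1ℚ :- t) :* a :+ t :* c , (con 1ℚ :- t) :* b :+ t :* d) := con 0ℚ) refl
  (seq a n) (seq b n) (seq c n) (seq d n) (seq (val t) n)

on-segment⇒D-null : ∀ p q {x} → OnSegment p q x → Null (D p q x)
on-segment⇒D-null p q {x} (t , e) =
  null-≐ {D p q (between p q t) - (D p q (between p q t) - D p q x)} {D p q x}
    (λ n → solve 2 (λ a b → a :- (a :- b) := b) refl (seq (D p q (between p q t)) n) (seq (D p q x) n))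
    (null-+ {D p q (between p q t)} { - (D p q (between p q t) - D p q x)}
      (≐⇒≈ {D p q (between p q t)} {0ℝ} (D-between-self p q t))
      (null-neg {D p q (between p q t) - D p q x} (D-cong₃ p q e)))

same-sign-mix : ∀ {α β} t → SameSign α β → ¬ Null ((1ℝ - val t) * α + val t * β)
same-sign-mix {α} {β} t (inj₁ (a , b)) z = tri (val t)
  (λ t>0 → pos⇒¬null {val t * β + (1ℝ - val t) * α}
    (pos-nn {val t * β} {(1ℝ - val t) * α} (pos-* {val t} {β} t>0 b)
      (nn-* {1ℝ - val t} {α} (nn-1-val t) (pos⇒nn {α} a)))
    (null-≐ {(1ℝ - val t) * α + val t * β} {val t * β + (1ℝ - val t) * α}
      (λ n → ℚ.+-comm (seq ((1ℝ - val t) * α) n) (seq (val t * β) n)) z))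
  (λ t≈0 → pos⇒¬null {α} a (null-≐ {((1ℝ - val t) * α + val t * β) + (α - β) * val t} {α}
    (λ n → solve 3 (λ a b t → ((con 1ℚ :- t) :* a :+ t :* b) :+ (a :- b) :* t := a) refl
      (seq α n) (seq β n) (seq (val t) n))
    (null-+ {(1ℝ - val t) * α + val t * β} {(α - β) * val t} z (null-* (α - β) {val t} t≈0))))
  (nn-val t)
same-sign-mix {α} {β} t (inj₂ (a , b)) z = same-sign-mix { - α} { - β} t (inj₁ (a , b))
  (null-≐ { - ((1ℝ - val t) * α + val t * β)} {(1ℝ - val t) * - α + val t * - β}
    (λ n → solve 3 (λ a b t → :- ((con 1ℚ :- t) :* a :+ t :* b) :=
        (con 1ℚ :- t) :* (:- a) :+ t :* (:- b)) refl (seq α n) (seq β n) (seq (val t) n))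
    (null-neg {(1ℝ - val t) * α + val t * β} z))

-- The function `D p q` vanishes on the segment `p q` and is affine along `r s`, where it keeps the
-- common sign of the two ends.
one-side-disjoint : ∀ p q r s → SameSign (D p q r) (D p q s) → ¬ Meet p q r s
one-side-disjoint p q r s σ (x , on-pq , t , e) = same-sign-mix {D p q r} {D p q s} t σ
  (null-≐ {(D p q (between r s t) - D p q x) + D p q x} {(1ℝ - val t) * D p q r + val t * D p q s}
    (λ n → trans (solve 2 (λ a b → (a :- b) :+ b := a) refl (seq (D p q (between r s t)) n) (seq (D p q x) n))
      (D-between p q r s t n))
    (null-+ {D p q (between r s t) - D p q x} {D p q x} (D-cong₃ p q e) (on-segment⇒D-null p q on-pq)))

-- At parameter `t` of the segment `p r` the function `D p q` has the value `t * D p q r`, so its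
-- vanishing forces `t` to be 0.
common-end : ∀ p q r x → Signed (D p q r) → OnSegment p q x → OnSegment p r x → x ≈ₚ p
common-end p@(p₁ , p₂) q r@(r₁ , r₂) x@(x₁ , x₂) σ on-pq (t , e@(e₁ , e₂)) =
  at-start p₁ r₁ x₁ e₁ , at-start p₂ r₂ x₂ e₂
  where
  t≈0 : Null (val t)
  t≈0 = null-cancel {D p q r} {val t} σ
    (null-≐ {(D p q (between p r t) - D p q x) + D p q x} {D p q r * val t}
      (λ n → trans (solve 2 (λ a b → (a :- b) :+ b := a) refl (seq (D p q (between p r t)) n) (seq (D p q x) n))
        (trans (D-between p q p r t n)
          (solve 7 (λ a b c d e f t → let P = a , b ; Q = c , d ; R = e , f in
            (con 1ℚ :- t) :* Dₚ P Q P :+ t :* Dₚ P Q R := Dₚ P Q R :* t) refl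
            (seq p₁ n) (seq p₂ n) (seq (proj₁ q) n) (seq (proj₂ q) n) (seq r₁ n) (seq r₂ n) (seq (val t) n))))
      (null-+ {D p q (between p r t) - D p q x} {D p q x} (D-cong₃ p q e) (on-segment⇒D-null p q on-pq)))
  at-start : ∀ a b c → (1ℝ - val t) * a + val t * b ≈ c → c ≈ a
  at-start a b c e = null⇒≈ {c} {a}
    (null-≐ { - (((1ℝ - val t) * a + val t * b) - c) + (b - a) * val t} {c - a}
      (λ n → solve 4 (λ a b c t → :- (((con 1ℚ :- t) :* a :+ t :* b) :- c) :+ (b :- a) :* t := c :- a) refl
        (seq a n) (seq b n) (seq c n) (seq (val t) n))
      (null-+ { - (((1ℝ - val t) * a + val t * b) - c)} {(b - a) * val t}
        (null-neg {((1ℝ - val t) * a + val t * b) - c} (≈⇒null {(1ℝ - val t) * a + val t * b} {c} e))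
        (null-* (b - a) {val t} t≈0)))

between-injective : ∀ p q s t → Signed (proj₁ q - proj₁ p) ⊎ Signed (proj₂ q - proj₂ p) →
  between p q s ≈ₚ between p q t → val s ≈ val t
between-injective (p₁ , p₂) (q₁ , q₂) s t σ (e₁ , e₂) = cases σ
  where
  along : ∀ a b → Signed (b - a) → (1ℝ - val s) * a + val s * b ≈ (1ℝ - val t) * a + val t * b → val s ≈ val t
  along a b σ e = null⇒≈ {val s} {val t} (null-cancel {b - a} {val s - val t} σ
    (null-≐ {((1ℝ - val s) * a + val s * b) - ((1ℝ - val t) * a + val t * b)} {(b - a) * (val s - val t)}
      (λ n → solve 4 (λ a b s t →
          ((con 1ℚ :- s) :* a :+ s :* b) :- ((con 1ℚ :- t) :* a :+ t :* b) := (b :- a) :* (s :- t)) refl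
        (seq a n) (seq b n) (seq (val s) n) (seq (val t) n))
      (≈⇒null {(1ℝ - val s) * a + val s * b} {(1ℝ - val t) * a + val t * b} e)))
  cases : Signed (q₁ - p₁) ⊎ Signed (q₂ - p₂) → val s ≈ val t
  cases (inj₁ σ₁) = along p₁ q₁ σ₁ e₁
  cases (inj₂ σ₂) = along p₂ q₂ σ₂ e₂

sameSign-≐ : ∀ {x y x′ y′} → x ≐ x′ → y ≐ y′ → SameSign x y → SameSign x′ y′
sameSign-≐ {x} {y} {x′} {y′} e f (inj₁ (p , q)) = inj₁ (pos-≐ {x} {x′} e p , pos-≐ {y} {y′} f q)
sameSign-≐ {x} {y} {x′} {y′} e f (inj₂ (p , q)) = inj₂
  (pos-≐ { - x} { - x′} (λ n → cong ℚ.-_ (e n)) p , pos-≐ { - y} { - y′} (λ n → cong ℚ.-_ (f n)) q)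

-- The graph

-- The thirteen vertices of a frame, by their roles.
Label : Set
Label = Fin 13

pattern A = zero
pattern C = suc zero
pattern W = suc (suc zero)
pattern W′ = suc (suc (suc zero))
pattern X = suc (suc (suc (suc zero)))
pattern Z j = suc (suc (suc (suc (suc j))))

link : Fin 3 → Label → Label → Bool
link i A     A     = false
link i A     C     = true
link i A     W     = true
link i A     W′    = true
link i A     X     = true
link i A     (Z _) = false
link i C     A     = true
link i C     C     = false
link i C     W     = true
link i C     W′    = true
link i C     X     = true
link i C     (Z _) = false
link i W     A     = true
link i W     C     = true
link i W     W     = false
link i W     W′    = false
link i W     X     = true
link i W     (Z j) = bit i j
link i W′    A     = true
link i W′    C     = true
link i W′    W     = false
link i W′    W′    = false
link i W′    X     = true
link i W′    (Z j) = not (bit i j)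
link i X     X     = false
link i X     A     = true
link i X     C     = true
link i X     W     = true
link i X     W′    = true
link i X     (Z _) = true
link i (Z _) A     = false
link i (Z _) C     = false
link i (Z j) W     = bit i j
link i (Z j) W′    = not (bit i j)
link i (Z _) X     = true
link i (Z _) (Z _) = false

coreLabel : Fin 10 → Label
coreLabel 0F            = A
coreLabel 1F            = C
coreLabel (suc (suc j)) = Z j

privateLabel : Fin 5 → Label
privateLabel 0F = W
privateLabel 1F = W′
privateLabel _  = X

-- Vertices 0 to 9 are A, C and the points Z j.  Each gadget has five private
-- vertices: W, W′ and the three copies of X.
data Node : Set where
  core    : Fin 10 → Node
  gadget : Fin 3 → Fin 5 → Node

node : Fin 25 → Node
node v with splitAt 10 v
... | inj₁ c = core c
... | inj₂ p = gadget (proj₁ (remQuot {3} 5 p)) (proj₂ (remQuot {3} 5 p))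

label : Fin 25 → Label
label v with node v
... | core c = coreLabel c
... | gadget _ p = privateLabel p

adjacent : Node → Node → Bool
-- On core labels `link i` is the same for every `i`, so `0F` is an arbitrary choice.
adjacent (core c)       (core d)       = link 0F (coreLabel c) (coreLabel d)
adjacent (core c)       (gadget i p) = link i (coreLabel c) (privateLabel p)
adjacent (gadget i p) (core c)       = link i (privateLabel p) (coreLabel c)
adjacent (gadget i p) (gadget j q) =
  does (i Fin.≟ j) ∧ link i (privateLabel p) (privateLabel q)

-- The frame of gadget `i` with copy `k` of its hub. Core vertices come first, then five vertices
-- for each gadget, the hubs starting at offset 2.
vertex : Fin 3 → Fin 3 → Label → Fin 25
vertex i k A     = 0F
vertex i k C     = 1F
vertex i k W     = 10 ↑ʳ combine i (zero {4})
vertex i k W′    = 10 ↑ʳ combine i (suc (zero {3}))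
vertex i k X     = 10 ↑ʳ combine i (2 ↑ʳ k)
vertex i k (Z j) = (2 ↑ʳ j) ↑ˡ 15

G : Graph
G = record
  { order  = 25
  ; adj    = λ u v → adjacent (node u) (node v)
  ; symm   = toWitness {a? = Fin.all? λ u → Fin.all? λ v → adjacent (node u) (node v) Bool.≟ adjacent (node v) (node u)} _
  ; noLoop = toWitness {a? = Fin.all? λ v → adjacent (node v) (node v) Bool.≟ false} _
  }

open Graph G using (adj; Vertex; Edge; edge; source; target; EndpointOf; EdgeWithin)

adj-vertex : ∀ i k l m → adj (vertex i k l) (vertex i k m) ≡ link i l m
adj-vertex = toWitness {a? = Fin.all? λ i → Fin.all? λ k → Fin.all? λ l → Fin.all? λ m →
  adj (vertex i k l) (vertex i k m) Bool.≟ link i l m} _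

label-vertex : ∀ i k l → label (vertex i k l) ≡ l
label-vertex = toWitness {a? = Fin.all? λ i → Fin.all? λ k → Fin.all? λ l →
  label (vertex i k l) Fin.≟ l} _

vertex-injective : ∀ {i k k′ l m} → vertex i k l ≡ vertex i k′ m → l ≡ m
vertex-injective {i} {k} {k′} {l} {m} e =
  trans (sym (label-vertex i k l)) (trans (cong label e) (label-vertex i k′ m))

hub-injective : ∀ i k k′ → vertex i k X ≡ vertex i k′ X → k ≡ k′
hub-injective = toWitness {a? = Fin.all? λ i → Fin.all? λ k → Fin.all? λ k′ →
  (vertex i k X Fin.≟ vertex i k′ X) →-dec (k Fin.≟ k′)} _

vertex-shared : ∀ i k k′ l → l ≢ X → vertex i k l ≡ vertex i k′ l
vertex-shared i k k′ A     _ = refl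
vertex-shared i k k′ C     _ = refl
vertex-shared i k k′ W     _ = refl
vertex-shared i k k′ W′    _ = refl
vertex-shared i k k′ X     n = ⊥-elim (n refl)
vertex-shared i k k′ (Z _) _ = refl

-- Overlapping visible intervals

latest : ∀ {n ℓ} (s : Fin (ℕ.suc n) → Fin ℓ) → ∃[ p ] (∀ q → s q Fin.≤ s p)
latest {ℕ.zero} s = zero , λ { zero → ℕ.≤-refl }
latest {ℕ.suc n} s with latest (λ q → s (suc q))
... | p , max with Fin.≤-total (s zero) (s (suc p))
...   | inj₁ l = suc p , λ { zero → l ; (suc q) → max q }
...   | inj₂ l = zero , λ { zero → ℕ.≤-refl ; (suc q) → ℕ.≤-trans (max q) l }

module _ {ℓ : ℕ} (S : Storyplan G ℓ) where
  open Storyplan S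

  infix 4 _≺_

  -- Half of an overlap: two intervals meet exactly if the relation holds in both directions, and
  -- `¬ (u ≺ v)` says that `u` appears only after `v` has vanished.
  _≺_ : Vertex → Vertex → Set
  u ≺ v = start u Fin.≤ end v

  -- Helly's theorem for intervals.
  common-time : ∀ {n} (f : Fin (ℕ.suc n) → Vertex) → (∀ p q → f p ≺ f q) →
    ∃[ t ] (∀ p → VisibleAt t (f p))
  common-time f h with latest (λ p → start (f p))
  ... | p , max = start (f p) , λ q → max q , h p q

  adj⇒≺ : ∀ u v → T (adj u v) → u ≺ v × v ≺ u
  adj⇒≺ u v e = let t , (su , eu) , (sv , ev) = meet u v e in
    ℕ.≤-trans su ev , ℕ.≤-trans sv eu

  link⇒≺ : ∀ i k l m → T (link i l m) → vertex i k l ≺ vertex i k m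
  link⇒≺ i k l m e = proj₁ (adj⇒≺ _ _ (subst T (sym (adj-vertex i k l m)) e))

  module _ (i : Fin 3) where
    hub : Fin 3 → Vertex
    hub k = vertex i k X

    hubs-together : (∀ k k′ → hub k ≺ hub k′) →
      ∃[ t ] (VisibleAt t (vertex i 0F A) × VisibleAt t (vertex i 0F C) × VisibleAt t (vertex i 0F W)
        × (∀ k → VisibleAt t (hub k)))
    hubs-together h =
      let t , v = common-time f pairwise in
      t , v 0F , v 1F , v 2F , λ { 0F → v 3F ; 1F → v 4F ; 2F → v 5F }
      where
      f : Fin 6 → Vertex
      f 0F = vertex i 0F A
      f 1F = vertex i 0F C
      f 2F = vertex i 0F W
      f (suc (suc (suc k))) = hub k
      pairwise : ∀ p q → f p ≺ f q
      pairwise 0F 0F = nonempty _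
      pairwise 0F 1F = link⇒≺ i 0F A C _
      pairwise 0F 2F = link⇒≺ i 0F A W _
      pairwise 1F 0F = link⇒≺ i 0F C A _
      pairwise 1F 1F = nonempty _
      pairwise 1F 2F = link⇒≺ i 0F C W _
      pairwise 2F 0F = link⇒≺ i 0F W A _
      pairwise 2F 1F = link⇒≺ i 0F W C _
      pairwise 2F 2F = nonempty _
      pairwise 0F (suc (suc (suc k))) = link⇒≺ i k A X _
      pairwise 1F (suc (suc (suc k))) = link⇒≺ i k C X _
      pairwise 2F (suc (suc (suc k))) = link⇒≺ i k W X _
      pairwise (suc (suc (suc k))) 0F = link⇒≺ i k X A _
      pairwise (suc (suc (suc k))) 1F = link⇒≺ i k X C _
      pairwise (suc (suc (suc k))) 2F = link⇒≺ i k X W _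
      pairwise (suc (suc (suc k))) (suc (suc (suc k′))) = h k k′

    hub-link : ∀ l → l ≢ X → T (link i X l) × T (link i l X)
    hub-link A     _ = _
    hub-link C     _ = _
    hub-link W     _ = _
    hub-link W′    _ = _
    hub-link X     n = ⊥-elim (n refl)
    hub-link (Z _) _ = _

    -- The common neighbours of two hubs with disjoint intervals are visible in
    -- the gap between them.
    gap : ∀ k k′ → ¬ (hub k ≺ hub k′) → ∃[ t ] (∀ l → VisibleAt t (vertex i 0F l))
    gap k k′ ¬h = common-time (vertex i 0F) pairwise
      where
      before : ∀ l → l ≢ X → hub k ≺ vertex i 0F l × vertex i 0F l ≺ hub k′
      before l n =
          subst (hub k ≺_) (vertex-shared i k 0F l n) (link⇒≺ i k X l (proj₁ (hub-link l n)))
        , subst (_≺ hub k′) (vertex-shared i k′ 0F l n) (link⇒≺ i k′ l X (proj₂ (hub-link l n)))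
      pairwise : ∀ l m → vertex i 0F l ≺ vertex i 0F m
      pairwise l m with l Fin.≟ X | m Fin.≟ X
      ... | yes refl | yes refl = nonempty _
      -- The hub of the frame is copy `0F`, whether or not it is one of `k` and `k′`: it overlaps
      -- each of its neighbours, and Helly's theorem needs no more.
      ... | yes refl | no n = link⇒≺ i 0F X m (proj₁ (hub-link m n))
      ... | no n | yes refl = link⇒≺ i 0F l X (proj₂ (hub-link l n))
      -- Vertex `l` starts no later than `hub k′` ends, which is before `hub k` starts, and `m`
      -- lasts at least until then.
      ... | no n | no n′ = ℕ.≤-trans (proj₂ (before l n))
        (ℕ.≤-trans (ℕ.<⇒≤ (ℕ.≰⇒> ¬h)) (proj₁ (before m n′)))

    -- Time steps are finite, so here the alternative is decided and given as a sum.
    hubs-or-frame : (∀ k k′ → hub k ≺ hub k′) ⊎ ∃[ t ] (∀ l → VisibleAt t (vertex i 0F l))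
    hubs-or-frame with Fin.all? (λ k → Fin.all? λ k′ → start (hub k) Fin.≤? end (hub k′))
    ... | yes h = inj₁ h
    ... | no ¬h with Fin.¬∀⟶∃¬ 3 _ (λ k → Fin.all? λ k′ → start (hub k) Fin.≤? end (hub k′)) ¬h
    ...   | k , ¬hk with Fin.¬∀⟶∃¬ 3 _ (λ k′ → start (hub k) Fin.≤? end (hub k′)) ¬hk
    ...     | k′ , ¬hkk′ = inj₂ (gap k k′ ¬hkk′)

-- Geometric storyplans

-- Exactly one of `w` and `w′` is in the triangle, and `side` records which. Every `z j` is joined
-- to one of them by an edge that crosses no side of the triangle, so it is inside together with
-- that neighbour.
splitting : ∀ (z : Fin 8 → Point) i u v t w w′ → K₅⁻ u v t w w′ →
  (∀ j → T (bit i j) → ¬ Meet w (z j) u v × ¬ Meet w (z j) v t × ¬ Meet w (z j) t u) →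
  (∀ j → T (not (bit i j)) → ¬ Meet w′ (z j) u v × ¬ Meet w′ (z j) v t × ¬ Meet w′ (z j) t u) →
  (Splits z i u v t → ⊥) → ⊥
splitting z i u v t w w′ K m m′ k = K₅⁻.not-both-outside K
  (λ w-in → k record
    { side = true ; positive = Δ>0
    ; inside = λ j e out → into j (subst T (sym e) _) w-in out
    ; outside = λ j e z-in → out-of′ j (subst (λ b → T (not b)) (sym e) _) z-in (K₅⁻.not-both-inside K w-in) })
  (λ w′-in → k record
    { side = false ; positive = Δ>0
    ; inside = λ j e out → into′ j (subst (λ b → T (not b)) (sym e) _) w′-in out
    ; outside = λ j e z-in → out-of j (subst T (sym e) _) z-in (λ w-in → K₅⁻.not-both-inside K w-in w′-in) })
  where
  open K₅⁻ K using (Δ>0)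
  reverse : ∀ {w z p q} → ¬ Meet w z p q → ¬ Meet z w p q
  reverse {w} {z} ¬m (x , h , l) = ¬m (x , on-segment-sym z w x h , l)
  into : ∀ j → T (bit i j) → Inside u v t w → (Inside u v t (z j) → ⊥) → ⊥
  into j e w-in = let a , b , c = m j e in inside-transfer u v t w (z j) Δ>0 w-in a b c
  out-of : ∀ j → T (bit i j) → Inside u v t (z j) → (Inside u v t w → ⊥) → ⊥
  out-of j e z-in = let a , b , c = m j e in
    inside-transfer u v t (z j) w Δ>0 z-in (reverse a) (reverse b) (reverse c)
  into′ : ∀ j → T (not (bit i j)) → Inside u v t w′ → (Inside u v t (z j) → ⊥) → ⊥
  into′ j e w-in = let a , b , c = m′ j e in inside-transfer u v t w′ (z j) Δ>0 w-in a b c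
  out-of′ : ∀ j → T (not (bit i j)) → Inside u v t (z j) → (Inside u v t w′ → ⊥) → ⊥
  out-of′ j e z-in = let a , b , c = m′ j e in
    inside-transfer u v t (z j) w′ Δ>0 z-in (reverse a) (reverse b) (reverse c)

K₅-link : Fin 5 → Fin 5 → Bool
K₅-link 3F 4F = false
K₅-link 4F 3F = false
K₅-link p  q  = not (does (p Fin.≟ q))

-- Adjacent vertices are distinct because there are no loops, so only the corners `3F` and `4F` need
-- a separate argument.
link-or-34 : ∀ p q → p ≢ q → T (K₅-link p q) ⊎ (p ≡ 3F × q ≡ 4F) ⊎ (p ≡ 4F × q ≡ 3F)
link-or-34 = toWitness {a? = Fin.all? λ p → Fin.all? λ q → ¬? (p Fin.≟ q) →-dec
  (Bool.T? (K₅-link p q) ⊎-dec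
    ((p Fin.≟ 3F) ×-dec (q Fin.≟ 4F)) ⊎-dec ((p Fin.≟ 4F) ×-dec (q Fin.≟ 3F)))} _

link⇒adj : ∀ i k l m → T (link i l m) → T (adj (vertex i k l) (vertex i k m))
link⇒adj i k l m = subst T (sym (adj-vertex i k l m))

module _ {ℓ : ℕ} (S : Storyplan G ℓ) (geometric : PlanarGeometric S) where
  open Storyplan S
  open Drawing drawing

  module _ (t : Fin ℓ) where
    open SimpleDrawing (simple t)

    -- Forgets which of `u` and `v` the edge lists first.
    record Shown (u v : Vertex) : Set where
      field
        shown     : Edge
        within    : EdgeWithin (VisibleAt t) shown
        endpoint  : ∀ w → EndpointOf shown w → w ≡ u ⊎ w ≡ v
        onCurve   : ∀ p → OnSegment (point u) (point v) p → p ∈ᶜ curve shown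

    open Shown

    show : ∀ u v → VisibleAt t u → VisibleAt t v → T (adj u v) → Shown u v
    show u v U V uv with Fin.<-cmp u v
    ... | tri< u<v _ _ = record
      { shown = edge u v u<v uv ; within = U , V ; endpoint = λ _ e → e
      ; onCurve = λ p → Equivalence.from (proj₂ (geometric t) (edge u v u<v uv) (U , V) p) }
    ... | tri≈ _ refl _ = ⊥-elim (subst T (Graph.noLoop G u) uv)
    ... | tri> _ _ v<u = record
      { shown = edge v u v<u vu ; within = V , U
      ; endpoint = λ { _ (inj₁ e) → inj₂ e ; _ (inj₂ e) → inj₁ e }
      ; onCurve = λ p h → Equivalence.from (proj₂ (geometric t) (edge v u v<u vu) (V , U) p)
          (on-segment-sym (point u) (point v) p h) }
      where
      vu : T (adj v u)
      vu = subst T (Graph.symm G u v) uv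

    -- By `proper` a common point is a shared endpoint or a crossing; the four inequalities exclude
    -- the former, planarity the latter.
    disjoint-edges : ∀ {u v r s} → VisibleAt t u → VisibleAt t v → VisibleAt t r → VisibleAt t s →
      T (adj u v) → T (adj r s) → u ≢ r → u ≢ s → v ≢ r → v ≢ s →
      ¬ Meet (point u) (point v) (point r) (point s)
    disjoint-edges {u} {v} {r} {s} U V R S uv rs u≢r u≢s v≢r v≢s (x , on-uv , on-rs) =
      impossible (proper (shown e) (shown f) (within e) (within f) e≢f x (onCurve e x on-uv) (onCurve f x on-rs))
      where
      e : Shown u v
      e = show u v U V uv
      f : Shown r s
      f = show r s R S rs
      clash : ∀ {w} → w ≡ u ⊎ w ≡ v → w ≡ r ⊎ w ≡ s → ⊥
      clash (inj₁ refl) (inj₁ refl) = u≢r refl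
      clash (inj₁ refl) (inj₂ refl) = u≢s refl
      clash (inj₂ refl) (inj₁ refl) = v≢r refl
      clash (inj₂ refl) (inj₂ refl) = v≢s refl
      e≢f : shown e ≢ shown f
      e≢f e≡f = clash (endpoint e (source (shown e)) (inj₁ refl))
        (endpoint f (source (shown e)) (subst (λ g → EndpointOf g (source (shown e))) e≡f (inj₁ refl)))
      impossible : CommonEndpointAt drawing (VisibleAt t) (shown e) (shown f) x ⊎ CrossAt (curve (shown e)) (curve (shown f)) x → ⊥
      impossible (inj₁ (w , h , k , _)) = clash (endpoint e w h) (endpoint f w k)
      impossible (inj₂ c) = proj₁ (geometric t) (shown e) (shown f) (within e) (within f) e≢f x c

    avoided : ∀ {u v r} → VisibleAt t u → VisibleAt t v → VisibleAt t r → T (adj u v) →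
      u ≢ r → v ≢ r → ¬ OnSegment (point u) (point v) (point r)
    avoided {u} {v} {r} U V R uv u≢r v≢r on = avoiding (shown e) r (within e) R
      (λ h → clash (endpoint e r h)) (onCurve e (point r) on)
      where
      e : Shown u v
      e = show u v U V uv
      clash : r ≡ u ⊎ r ≡ v → ⊥
      clash (inj₁ r≡u) = u≢r (sym r≡u)
      clash (inj₂ r≡v) = v≢r (sym r≡v)

    record AlmostK₅ : Set where
      field
        corner        : Fin 5 → Vertex
        visible   : ∀ p → VisibleAt t (corner p)
        different : ∀ p q → p ≢ q → corner p ≢ corner q
        linked    : ∀ p q → T (K₅-link p q) → T (adj (corner p) (corner q))

      pt : Fin 5 → Point
      pt p = point (corner p)

      apart : ∀ p q r s → T (K₅-link p q) → T (K₅-link r s) → p ≢ r → p ≢ s → q ≢ r → q ≢ s →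
        ¬ Meet (pt p) (pt q) (pt r) (pt s)
      apart p q r s pq rs p≢r p≢s q≢r q≢s = disjoint-edges
        (visible p) (visible q) (visible r) (visible s) (linked p q pq) (linked r s rs)
        (different p r p≢r) (different p s p≢s) (different q r q≢r) (different q s q≢s)

      K₅⁻-corner : Pos (D (pt 0F) (pt 1F) (pt 2F)) → K₅⁻ (pt 0F) (pt 1F) (pt 2F) (pt 3F) (pt 4F)
      K₅⁻-corner Δ>0 = record
        { Δ>0   = Δ>0
        ; uv-bt = apart 0F 1F 3F 2F _ _ (λ ()) (λ ()) (λ ()) (λ ())
        ; vt-bu = apart 1F 2F 3F 0F _ _ (λ ()) (λ ()) (λ ()) (λ ())
        ; tu-bv = apart 2F 0F 3F 1F _ _ (λ ()) (λ ()) (λ ()) (λ ())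
        ; uv-dt = apart 0F 1F 4F 2F _ _ (λ ()) (λ ()) (λ ()) (λ ())
        ; vt-du = apart 1F 2F 4F 0F _ _ (λ ()) (λ ()) (λ ()) (λ ())
        ; tu-dv = apart 2F 0F 4F 1F _ _ (λ ()) (λ ()) (λ ()) (λ ())
        ; bu-dv = apart 3F 0F 4F 1F _ _ (λ ()) (λ ()) (λ ()) (λ ())
        ; bv-du = apart 3F 1F 4F 0F _ _ (λ ()) (λ ()) (λ ()) (λ ())
        ; bv-dt = apart 3F 1F 4F 2F _ _ (λ ()) (λ ()) (λ ()) (λ ())
        ; bt-dv = apart 3F 2F 4F 1F _ _ (λ ()) (λ ()) (λ ()) (λ ())
        ; bt-du = apart 3F 2F 4F 0F _ _ (λ ()) (λ ()) (λ ()) (λ ())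
        ; bu-dt = apart 3F 0F 4F 2F _ _ (λ ()) (λ ()) (λ ()) (λ ())
        }

      on-edge : ∀ p q r → T (K₅-link p q) → p ≢ r → q ≢ r → ¬ OnSegment (pt p) (pt q) (pt r)
      on-edge p q r pq p≢r q≢r = avoided (visible p) (visible q) (visible r) (linked p q pq)
        (different p r p≢r) (different q r q≢r)

      not-collinear : ¬ Null (D (pt 0F) (pt 1F) (pt 2F))
      not-collinear z = collinear (pt 0F) (pt 1F) (pt 2F)
        (distinct (corner 0F) (corner 1F) (visible 0F) (visible 1F) (different 0F 1F λ ())) z
        (on-edge 0F 1F 2F _ (λ ()) (λ ()))
        (on-edge 1F 2F 0F _ (λ ()) (λ ()))
        (on-edge 2F 0F 1F _ (λ ()) (λ ()))

    swap₀₁ : Fin 5 → Fin 5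
    swap₀₁ 0F = 1F
    swap₀₁ 1F = 0F
    swap₀₁ p  = p

    swapped : AlmostK₅ → AlmostK₅
    swapped K = record
      { corner = λ p → corner (swap₀₁ p)
      ; visible = λ p → visible (swap₀₁ p)
      ; different = λ p q p≢q → different (swap₀₁ p) (swap₀₁ q) (λ e → p≢q (swap₀₁-injective p q e))
      ; linked = λ p q e → linked (swap₀₁ p) (swap₀₁ q) (swap₀₁-link p q e)
      }
      where
      open AlmostK₅ K
      swap₀₁-injective : ∀ p q → swap₀₁ p ≡ swap₀₁ q → p ≡ q
      swap₀₁-injective = toWitness {a? = Fin.all? λ p → Fin.all? λ q →
        (swap₀₁ p Fin.≟ swap₀₁ q) →-dec (p Fin.≟ q)} _
      swap₀₁-link : ∀ p q → T (K₅-link p q) → T (K₅-link (swap₀₁ p) (swap₀₁ q))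
      swap₀₁-link = toWitness {a? = Fin.all? λ p → Fin.all? λ q →
        Bool.T? (K₅-link p q) →-dec Bool.T? (K₅-link (swap₀₁ p) (swap₀₁ q))} _

    -- The results on `K₅⁻` assume a positively oriented triangle; exchanging its first two corners
    -- corrects the sign.
    orient : (K : AlmostK₅) → let open AlmostK₅ K in
      (K₅⁻ (pt 0F) (pt 1F) (pt 2F) (pt 3F) (pt 4F) → ⊥) →
      (K₅⁻ (pt 1F) (pt 0F) (pt 2F) (pt 3F) (pt 4F) → ⊥) → ⊥
    orient K f g = tri (D (pt 0F) (pt 1F) (pt 2F))
      (λ p → f (K₅⁻-corner p)) not-collinear
      (λ n → g (AlmostK₅.K₅⁻-corner (swapped K) (pos-swap (pt 0F) (pt 1F) (pt 2F) n)))
      where open AlmostK₅ K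

  -- Pigeonhole: two of three hubs are on the same side. Membership need not be decidable, since the
  -- second hypothesis asks only for negations.
  three-hubs : (In : Fin 3 → Set) → (∀ k k′ → k ≢ k′ → In k → In k′ → ⊥) →
    (∀ k k′ → k ≢ k′ → ¬ In k → ¬ In k′ → ⊥) → ⊥
  three-hubs In ¬both ¬neither = ¬neither 0F 1F (λ ())
    (λ in₀ → ¬neither 1F 2F (λ ()) (¬both 0F 1F (λ ()) in₀) (¬both 0F 2F (λ ()) in₀))
    (λ in₁ → ¬neither 0F 2F (λ ()) (λ in₀ → ¬both 0F 1F (λ ()) in₀ in₁) (¬both 1F 2F (λ ()) in₁))

  module _ (i : Fin 3) where

    hubs-not-together : ∀ t → VisibleAt t (vertex i 0F A) → VisibleAt t (vertex i 0F C) →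
      VisibleAt t (vertex i 0F W) → (∀ k → VisibleAt t (hub S i k)) → ⊥
    -- The pair `0F`, `1F` serves to orient the triangle `A C W`, which is the same for all pairs of
    -- hubs.
    hubs-not-together t VA VC VW VX = orient t (clique 0F 1F λ ())
      (λ K → three-hubs (λ k → Inside (pt A) (pt C) (pt W) (point (hub S i k)))
        (λ k k′ n → K₅⁻.not-both-inside (AlmostK₅.K₅⁻-corner (clique k k′ n) (K₅⁻.Δ>0 K)))
        (λ k k′ n → K₅⁻.not-both-outside (AlmostK₅.K₅⁻-corner (clique k k′ n) (K₅⁻.Δ>0 K))))
      (λ K → three-hubs (λ k → Inside (pt C) (pt A) (pt W) (point (hub S i k)))
        (λ k k′ n → K₅⁻.not-both-inside (AlmostK₅.K₅⁻-corner (swapped t (clique k k′ n)) (K₅⁻.Δ>0 K)))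
        (λ k k′ n → K₅⁻.not-both-outside (AlmostK₅.K₅⁻-corner (swapped t (clique k k′ n)) (K₅⁻.Δ>0 K))))
      where
      pt : Label → Point
      pt l = point (vertex i 0F l)
      clique : ∀ k k′ → k ≢ k′ → AlmostK₅ t
      clique k k′ k≢k′ = record { corner = corner ; visible = visible ; different = different ; linked = linked }
        where
        corner : Fin 5 → Vertex
        corner 0F = vertex i 0F A
        corner 1F = vertex i 0F C
        corner 2F = vertex i 0F W
        corner 3F = hub S i k
        corner 4F = hub S i k′
        visible : ∀ p → VisibleAt t (corner p)
        visible 0F = VA
        visible 1F = VC
        visible 2F = VW
        visible 3F = VX k
        visible 4F = VX k′
        linked : ∀ p q → T (K₅-link p q) → T (adj (corner p) (corner q))
        linked 0F 0F ()
        linked 0F 1F _ = link⇒adj i 0F A C _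
        linked 0F 2F _ = link⇒adj i 0F A W _
        linked 1F 0F _ = link⇒adj i 0F C A _
        linked 1F 1F ()
        linked 1F 2F _ = link⇒adj i 0F C W _
        linked 2F 0F _ = link⇒adj i 0F W A _
        linked 2F 1F _ = link⇒adj i 0F W C _
        linked 2F 2F ()
        linked 0F 3F _ = link⇒adj i k A X _
        linked 3F 0F _ = link⇒adj i k X A _
        linked 1F 3F _ = link⇒adj i k C X _
        linked 3F 1F _ = link⇒adj i k X C _
        linked 2F 3F _ = link⇒adj i k W X _
        linked 3F 2F _ = link⇒adj i k X W _
        linked 0F 4F _ = link⇒adj i k′ A X _
        linked 4F 0F _ = link⇒adj i k′ X A _
        linked 1F 4F _ = link⇒adj i k′ C X _
        linked 4F 1F _ = link⇒adj i k′ X C _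
        linked 2F 4F _ = link⇒adj i k′ W X _
        linked 4F 2F _ = link⇒adj i k′ X W _
        linked 3F 3F ()
        linked 3F 4F ()
        linked 4F 3F ()
        linked 4F 4F ()
        different : ∀ p q → p ≢ q → corner p ≢ corner q
        different p q p≢q e with link-or-34 p q p≢q
        ... | inj₂ (inj₁ (refl , refl)) = k≢k′ (hub-injective i k k′ e)
        ... | inj₂ (inj₂ (refl , refl)) = k≢k′ (sym (hub-injective i k′ k e))
        ... | inj₁ pq = subst T (trans (cong (adj (corner p)) (sym e)) (Graph.noLoop G (corner p))) (linked p q pq)

    splits : ∀ t → (∀ l → VisibleAt t (vertex i 0F l)) → let pt = λ l → point (vertex i 0F l) in
      (Splits (λ j → pt (Z j)) i (pt A) (pt C) (pt X) → ⊥) →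
      (Splits (λ j → pt (Z j)) i (pt C) (pt A) (pt X) → ⊥) → ⊥
    splits t visible f g = orient t frame
      (λ K → splitting (λ j → pt (Z j)) i (pt A) (pt C) (pt X) (pt W) (pt W′) K
        (λ j e → apart W (Z j) A C e _ (λ ()) (λ ()) (λ ()) (λ ())
               , apart W (Z j) C X e _ (λ ()) (λ ()) (λ ()) (λ ())
               , apart W (Z j) X A e _ (λ ()) (λ ()) (λ ()) (λ ()))
        (λ j e → apart W′ (Z j) A C e _ (λ ()) (λ ()) (λ ()) (λ ())
               , apart W′ (Z j) C X e _ (λ ()) (λ ()) (λ ()) (λ ())
               , apart W′ (Z j) X A e _ (λ ()) (λ ()) (λ ()) (λ ())) f)
      (λ K → splitting (λ j → pt (Z j)) i (pt C) (pt A) (pt X) (pt W) (pt W′) K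
        (λ j e → apart W (Z j) C A e _ (λ ()) (λ ()) (λ ()) (λ ())
               , apart W (Z j) A X e _ (λ ()) (λ ()) (λ ()) (λ ())
               , apart W (Z j) X C e _ (λ ()) (λ ()) (λ ()) (λ ()))
        (λ j e → apart W′ (Z j) C A e _ (λ ()) (λ ()) (λ ()) (λ ())
               , apart W′ (Z j) A X e _ (λ ()) (λ ()) (λ ()) (λ ())
               , apart W′ (Z j) X C e _ (λ ()) (λ ()) (λ ()) (λ ())) g)
      where
      pt : Label → Point
      pt l = point (vertex i 0F l)
      apart : ∀ l m n o → T (link i l m) → T (link i n o) → l ≢ n → l ≢ o → m ≢ n → m ≢ o →
        ¬ Meet (pt l) (pt m) (pt n) (pt o)
      apart l m n o lm on l≢n l≢o m≢n m≢o = disjoint-edges t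
        (visible l) (visible m) (visible n) (visible o) (link⇒adj i 0F l m lm) (link⇒adj i 0F n o on)
        (λ e → l≢n (vertex-injective {i} {0F} {0F} e)) (λ e → l≢o (vertex-injective {i} {0F} {0F} e))
        (λ e → m≢n (vertex-injective {i} {0F} {0F} e)) (λ e → m≢o (vertex-injective {i} {0F} {0F} e))
      role : Fin 5 → Label
      role 0F = A
      role 1F = C
      role 2F = X
      role 3F = W
      role 4F = W′
      role-injective : ∀ p q → role p ≡ role q → p ≡ q
      role-injective = toWitness {a? = Fin.all? λ p → Fin.all? λ q → (role p Fin.≟ role q) →-dec (p Fin.≟ q)} _
      role-link : ∀ i p q → T (K₅-link p q) → T (link i (role p) (role q))
      role-link = toWitness {a? = Fin.all? λ i → Fin.all? λ p → Fin.all? λ q →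
        Bool.T? (K₅-link p q) →-dec Bool.T? (link i (role p) (role q))} _
      frame : AlmostK₅ t
      frame = record
        { corner = λ p → vertex i 0F (role p)
        ; visible = λ p → visible (role p)
        ; different = λ p q p≢q e → p≢q (role-injective p q (vertex-injective {i} {0F} {0F} e))
        ; linked = λ p q e → link⇒adj i 0F (role p) (role q) (role-link i p q e)
        }

  no-storyplan : ⊥
  no-storyplan = three-splits (λ j → point (vertex 0F 0F (Z j))) (point (vertex 0F 0F A)) (point (vertex 0F 0F C))
    (λ i → point (vertex i 0F X)) λ i f g → frame-or-not i f g (hubs-or-frame S i)
    where
    frame-or-not : ∀ i → let pt = λ l → point (vertex i 0F l) in
      (Splits (λ j → pt (Z j)) i (pt A) (pt C) (pt X) → ⊥) →
      (Splits (λ j → pt (Z j)) i (pt C) (pt A) (pt X) → ⊥) →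
      (∀ k k′ → _≺_ S (hub S i k) (hub S i k′)) ⊎ ∃[ t ] (∀ l → VisibleAt t (vertex i 0F l)) → ⊥
    frame-or-not i f g (inj₁ h) = let t , a , c , w , x = hubs-together S i h in hubs-not-together i t a c w x
    frame-or-not i f g (inj₂ (t , v)) = splits i t v f g

-- A planar storyplan

-- In the frames of the i-th gadget everything is drawn as the image of a
-- straight-line drawing under the shear (x , y) ↦ (x + k y² , y), which fixes
-- the line through A and C.  The positions were found by computer search.
shear : Fin 3 → ℤ
shear 0F = + 0
shear 1F = + 2
shear 2F = ℤ.- + 2

-- Coordinates before the shear. At `A`, `C` and the points `Z j` they compensate for it, so that
-- the three drawings agree there: `Z 0F` always ends at `900 , 60`, as
-- `-6300 + 2 · 60² = 8100 - 2 · 60² = 900`.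
shape : Fin 3 → Label → ℤPoint
shape _ A      = ℤ.- + 240 , + 0
shape _ C      = + 240 , + 0
shape 0F W      = ℤ.- + 93 , + 15
shape 0F W′     = ℤ.- + 9824 , ℤ.- + 12000
shape 0F X      = ℤ.- + 15 , + 2507
shape 0F (Z 0F) = + 900 , + 60
shape 0F (Z 1F) = ℤ.- + 50 , + 65
shape 0F (Z 2F) = + 845 , + 65
shape 0F (Z 3F) = + 0 , + 58
shape 0F (Z 4F) = + 715 , + 55
shape 0F (Z 5F) = + 10 , + 62
shape 0F (Z 6F) = + 320 , + 60
shape 0F (Z 7F) = + 90 , + 60
shape 1F W      = ℤ.- + 271 , + 2
shape 1F W′     = + 872421 , ℤ.- + 7500
shape 1F X      = ℤ.- + 83000 , + 709
shape 1F (Z 0F) = ℤ.- + 6300 , + 60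
shape 1F (Z 1F) = ℤ.- + 8500 , + 65
shape 1F (Z 2F) = ℤ.- + 7605 , + 65
shape 1F (Z 3F) = ℤ.- + 6728 , + 58
shape 1F (Z 4F) = ℤ.- + 5335 , + 55
shape 1F (Z 5F) = ℤ.- + 7678 , + 62
shape 1F (Z 6F) = ℤ.- + 6880 , + 60
shape 1F (Z 7F) = ℤ.- + 7110 , + 60
shape 2F W      = + 1662 , + 14
shape 2F W′     = ℤ.- + 89387 , ℤ.- + 720
shape 2F X      = + 184926 , + 1503
shape 2F (Z 0F) = + 8100 , + 60
shape 2F (Z 1F) = + 8400 , + 65
shape 2F (Z 2F) = + 9295 , + 65
shape 2F (Z 3F) = + 6728 , + 58
shape 2F (Z 4F) = + 6765 , + 55
shape 2F (Z 5F) = + 7698 , + 62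
shape 2F (Z 6F) = + 7520 , + 60
shape 2F (Z 7F) = + 7290 , + 60

-- General position with respect to the edges. It keeps vertices off foreign edges and makes edges
-- with a common end meet only there.
generic : ∀ i l m o → T (link i l m) → o ≢ l → o ≢ m → T (nonzero (Dℤ (shape i l) (shape i m) (shape i o)))
generic = toWitness {a? = Fin.all? λ i → Fin.all? λ l → Fin.all? λ m → Fin.all? λ o →
  Bool.T? (link i l m) →-dec ¬? (o Fin.≟ l) →-dec ¬? (o Fin.≟ m) →-dec Bool.T? _} _

every : ∀ {n} → (Fin n → Bool) → Bool
every {ℕ.zero}  p = true
every {ℕ.suc n} p = p zero ∧ every (λ i → p (suc i))

every-sound : ∀ {n} (p : Fin n → Bool) → T (every p) → ∀ i → T (p i)
every-sound {ℕ.suc n} p h zero    with p zero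
... | true = _
every-sound {ℕ.suc n} p h (suc i) with p zero
... | true = every-sound (λ i → p (suc i)) h i

infixr 5 _⇒_

-- A short-circuiting test: in `edgeᵇ` pairs that are no edges are discarded before the inner loops
-- over a second edge.
_⇒_ : Bool → Bool → Bool
true  ⇒ b = b
false ⇒ _ = true

⇒-elim : ∀ {a b} → T (a ⇒ b) → T a → T b
⇒-elim {true} h _ = h

_≠_ : ∀ {n} → Fin n → Fin n → Bool
i ≠ j = not (Fin.toℕ i ℕ.≡ᵇ Fin.toℕ j)

≠-intro : ∀ {n} {i j : Fin n} → i ≢ j → T (i ≠ j)
≠-intro {i = i} {j} i≢j with Fin.toℕ i ℕ.≡ᵇ Fin.toℕ j in e
... | false = _
... | true = i≢j (Fin.toℕ-injective (ℕ.≡ᵇ⇒≡ (Fin.toℕ i) (Fin.toℕ j) (subst T (sym e) _)))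

-- Links directed by the order of the vertices rather than of the labels.
forward : Label → Label → Bool
forward A     (Z _) = false
forward C     (Z _) = false
forward A     l     = A ≠ l
forward C     l     = A ≠ l
forward (Z _) W     = true
forward (Z _) W′    = true
forward (Z _) X     = true
forward W     X     = true
forward W′    X     = true
forward _     _     = false

-- A certificate for disjoint segments: the ends of one are strictly on one side of the line through
-- the other.
apartᵇ : Fin 3 → Label → Label → Label → Label → Bool
apartᵇ i l m n o =
  sameSign (Dℤ (shape i l) (shape i m) (shape i n)) (Dℤ (shape i l) (shape i m) (shape i o)) ∨
  sameSign (Dℤ (shape i n) (shape i o) (shape i l)) (Dℤ (shape i n) (shape i o) (shape i m))

pairᵇ : Fin 3 → Label → Label → Label → Label → Bool
pairᵇ i l m n o = forward n o ⇒ link i n o ⇒ l ≠ n ⇒ l ≠ o ⇒ m ≠ n ⇒ m ≠ o ⇒ apartᵇ i l m n o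

edgeᵇ : Fin 3 → Label → Label → Bool
edgeᵇ i l m = forward l m ⇒ link i l m ⇒ every λ n → every λ o → pairᵇ i l m n o

separatedᵇ : Fin 3 → Bool
separatedᵇ i = every λ l → every λ m → edgeᵇ i l m

separated : ∀ i l m → T (forward l m) → T (link i l m) → ∀ n o → T (forward n o) → T (link i n o) →
  l ≢ n → l ≢ o → m ≢ n → m ≢ o → T (apartᵇ i l m n o)
separated i l m lm lm′ n o on on′ l≢n l≢o m≢n m≢o =
  ⇒-elim {m ≠ o} (⇒-elim {m ≠ n} (⇒-elim {l ≠ o} (⇒-elim {l ≠ n}
    (⇒-elim {link i n o} (⇒-elim {forward n o} pair on) on′)
    (≠-intro l≢n)) (≠-intro l≢o)) (≠-intro m≢n)) (≠-intro m≢o)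
  where
  -- For each numeral the test is a closed Boolean and evaluates to `true`.
  holds : ∀ i → T (separatedᵇ i)
  holds 0F = _
  holds 1F = _
  holds 2F = _
  row : T (edgeᵇ i l m)
  row = every-sound (λ m → edgeᵇ i l m) (every-sound (λ l → every λ m → edgeᵇ i l m) (holds i) l) m
  pair : T (pairᵇ i l m n o)
  pair = every-sound (λ o → pairᵇ i l m n o)
    (every-sound (λ n → every λ o → pairᵇ i l m n o)
      (⇒-elim {link i l m} (⇒-elim {forward l m} row lm) lm′) n) o

shape-distinct : ∀ i l m → l ≢ m → T (nonzero (proj₁ (shape i m) ℤ.- proj₁ (shape i l)) ∨
  nonzero (proj₂ (shape i m) ℤ.- proj₂ (shape i l)))
shape-distinct = toWitness {a? = Fin.all? λ i → Fin.all? λ l → Fin.all? λ m →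
  ¬? (l Fin.≟ m) →-dec Bool.T? _} _

placed : Fin 3 → Label → ℤPoint
placed i l = proj₁ (shape i l) ℤ.+ shear i ℤ.* (proj₂ (shape i l) ℤ.* proj₂ (shape i l)) , proj₂ (shape i l)

owner : Node → Fin 3
owner (core _)     = 0F
owner (gadget i _) = i

-- The gadget whose shear bends the edge. The only edge within the core, `A C`, falls to `0F`, but
-- all shears fix it.
edgeOwner : Node → Node → Fin 3
edgeOwner (core _)     n = owner n
edgeOwner (gadget i _) _ = i

-- Time `combine i k` shows gadget `i` with copy `k` of its hub. W and W′ stay for the three times
-- of their gadget, each copy of X for one, the core throughout.
firstTime lastTime : Node → Fin 9
firstTime (core _)                   = 0F
firstTime (gadget i (suc (suc k)))   = combine i k
firstTime (gadget i _)               = combine i (zero {2})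
lastTime (core _)                    = 8F
lastTime (gadget i (suc (suc k)))    = combine i k
lastTime (gadget i _)                = combine i (Fin.fromℕ 2)

Visible : Fin 9 → Vertex → Set
Visible t v = firstTime (node v) Fin.≤ t × t Fin.≤ lastTime (node v)

visible? : ∀ t v → Dec (Visible t v)
visible? t v = (firstTime (node v) Fin.≤? t) ×-dec (t Fin.≤? lastTime (node v))

gadgetAt copyAt : Fin 9 → Fin 3
gadgetAt t = proj₁ (remQuot {3} 3 t)
copyAt t   = proj₂ (remQuot {3} 3 t)

_≟ₚ_ : (p q : ℤPoint) → Dec (p ≡ q)
(a , b) ≟ₚ (c , d) = map′ (λ (e , f) → cong₂ _,_ e f) (λ e → cong proj₁ e , cong proj₂ e)
  ((a ℤ.≟ c) ×-dec (b ℤ.≟ d))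

visible⇒vertex : ∀ t v → Visible t v → v ≡ vertex (gadgetAt t) (copyAt t) (label v)
visible⇒vertex = toWitness {a? = Fin.all? λ t → Fin.all? λ v → visible? t v →-dec (v Fin.≟ _)} _

visible⇒placed : ∀ t v → Visible t v →
  placed (owner (node v)) (label v) ≡ placed (gadgetAt t) (label v)
visible⇒placed = toWitness {a? = Fin.all? λ t → Fin.all? λ v → visible? t v →-dec (_ ≟ₚ _)} _

edge-placed : ∀ u v → T (adj u v) →
  placed (edgeOwner (node u) (node v)) (label u) ≡ placed (owner (node u)) (label u) ×
  placed (edgeOwner (node u) (node v)) (label v) ≡ placed (owner (node v)) (label v)
edge-placed = toWitness {a? = Fin.all? λ u → Fin.all? λ v → Bool.T? (adj u v) →-dec
  ((_ ≟ₚ _) ×-dec (_ ≟ₚ _))} _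

OnBase : Label → Set
OnBase l = l ≡ A ⊎ l ≡ C

onBase? : ∀ l → Dec (OnBase l)
onBase? l = (l Fin.≟ A) ⊎-dec (l Fin.≟ C)

edge-owner : ∀ t u v → T (adj u v) → Visible t u → Visible t v →
  edgeOwner (node u) (node v) ≡ gadgetAt t ⊎ OnBase (label u) × OnBase (label v)
edge-owner = toWitness {a? = Fin.all? λ t → Fin.all? λ u → Fin.all? λ v → Bool.T? (adj u v) →-dec
  visible? t u →-dec visible? t v →-dec
  ((_ Fin.≟ _) ⊎-dec (onBase? (label u) ×-dec onBase? (label v)))} _

meeting : ∀ u v → T (adj u v) → ∃[ t ] (Visible t u × Visible t v)
meeting = toWitness {a? = Fin.all? λ u → Fin.all? λ v → Bool.T? (adj u v) →-dec
  Fin.any? λ t → visible? t u ×-dec visible? t v} _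

first≤last : ∀ v → firstTime (node v) Fin.≤ lastTime (node v)
first≤last = toWitness {a? = Fin.all? λ v → firstTime (node v) Fin.≤? lastTime (node v)} _

edge-forward : ∀ t u v → u Fin.< v → T (adj u v) → Visible t u → Visible t v →
  T (forward (label u) (label v)) × T (link (gadgetAt t) (label u) (label v))
edge-forward = toWitness {a? = Fin.all? λ t → Fin.all? λ u → Fin.all? λ v → (u Fin.<? v) →-dec
  Bool.T? (adj u v) →-dec visible? t u →-dec visible? t v →-dec (Bool.T? _ ×-dec Bool.T? _)} _

straight : Fin 3 → Label → Point
straight i l = ⟦ shape i l ⟧

bend-straight : ∀ i l → bend (ι (shear i)) (straight i l) ≈ₚ ⟦ placed i l ⟧
bend-straight i l = ≐⇒≈ (λ _ → trans
    (cong (fromℤ x ℚ.+_) (trans (cong (fromℤ k ℚ.*_) (fromℤ-* y y)) (fromℤ-* k (y ℤ.* y))))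
    (fromℤ-+ x (k ℤ.* (y ℤ.* y))))
  , ≐⇒≈ (λ _ → refl)
  where
  x y k : ℤ
  x = proj₁ (shape i l)
  y = proj₂ (shape i l)
  k = shear i

≈ₚ-refl : ∀ {p} → p ≈ₚ p
≈ₚ-refl {x , y} = ≐⇒≈ {x} {x} (λ _ → refl) , ≐⇒≈ {y} {y} (λ _ → refl)

≈ₚ-reflexive : ∀ {p q} → p ≡ q → p ≈ₚ q
≈ₚ-reflexive refl = ≈ₚ-refl

source<target : ∀ e → source e Fin.< target e
source<target (edge u v u<v _) = recompute (u Fin.<? v) u<v

joined : ∀ e → T (adj (source e) (target e))
joined (edge u v _ uv) = recompute (Bool.T? (adj u v)) uv

edge-≡ : ∀ {e f} → source e ≡ source f → target e ≡ target f → e ≡ f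
edge-≡ {edge _ _ _ _} {edge _ _ _ _} refl refl = refl

ownerOf : Edge → Fin 3
ownerOf e = edgeOwner (node (source e)) (node (target e))

position : Vertex → Point
position v = ⟦ placed (owner (node v)) (label v) ⟧

arc : Edge → Curve
arc e = bentSegment (ι (shear (ownerOf e)))
  (straight (ownerOf e) (label (source e))) (straight (ownerOf e) (label (target e)))

between-0 : ∀ p q → between p q 0I ≈ₚ p
between-0 (a , b) (c , d) = start a c , start b d
  where
  start : ∀ a c → (1ℝ - 0ℝ) * a + 0ℝ * c ≈ a
  start a c = ≐⇒≈ (λ n → solve 2 (λ a c → (con 1ℚ :- con 0ℚ) :* a :+ con 0ℚ :* c := a) refl (seq a n) (seq c n))

between-1 : ∀ p q → between p q 1I ≈ₚ q
between-1 (a , b) (c , d) = end a c , end b d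
  where
  end : ∀ a c → (1ℝ - 1ℝ) * a + 1ℝ * c ≈ c
  end a c = ≐⇒≈ (λ n → solve 2 (λ a c → (con 1ℚ :- con 1ℚ) :* a :+ con 1ℚ :* c := c) refl (seq a n) (seq c n))

picture : Drawing G
picture = record
  { point  = position
  ; curve  = arc
  ; begins = λ e → ≈ₚ-trans (bend-cong (ι (shear (ownerOf e))) (between-0 _ _))
      (≈ₚ-trans (bend-straight (ownerOf e) (label (source e)))
        (≈ₚ-reflexive (cong ⟦_⟧ (proj₁ (edge-placed (source e) (target e) (joined e))))))
  ; ends = λ e → ≈ₚ-trans (bend-cong (ι (shear (ownerOf e))) (between-1 _ _))
      (≈ₚ-trans (bend-straight (ownerOf e) (label (target e)))
        (≈ₚ-reflexive (cong ⟦_⟧ (proj₂ (edge-placed (source e) (target e) (joined e))))))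
  }

open Drawing picture using (begins; ends)

-- Both ends have height 0 and the same coordinates in all drawings, so the quadratic term vanishes
-- along the segment.
bend-base : ∀ g i {l m} → OnBase l → OnBase m → ∀ s →
  bend (ι (shear g)) (between (straight g l) (straight g m) s) ≈ₚ
  bend (ι (shear i)) (between (straight i l) (straight i m) s)
bend-base g i l-base m-base s = along l-base m-base
  where
  level : ∀ x y → bend (ι (shear g)) (between (x , ι (+ 0)) (y , ι (+ 0)) s) ≈ₚ
    bend (ι (shear i)) (between (x , ι (+ 0)) (y , ι (+ 0)) s)
  level x y = ≐⇒≈ (λ n → solve 5 (λ k k′ x y s →
      let b = (con 1ℚ :- s) :* x :+ s :* y ; h = (con 1ℚ :- s) :* con 0ℚ :+ s :* con 0ℚ in
      b :+ k :* (h :* h) := b :+ k′ :* (h :* h)) refl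
      (seq (ι (shear g)) n) (seq (ι (shear i)) n) (seq x n) (seq y n) (seq (val s) n))
    , ≐⇒≈ (λ _ → refl)
  along : ∀ {l m} → OnBase l → OnBase m →
    bend (ι (shear g)) (between (straight g l) (straight g m) s) ≈ₚ
    bend (ι (shear i)) (between (straight i l) (straight i m) s)
  along (inj₁ refl) (inj₁ refl) = level _ _
  along (inj₁ refl) (inj₂ refl) = level _ _
  along (inj₂ refl) (inj₁ refl) = level _ _
  along (inj₂ refl) (inj₂ refl) = level _ _

-- One frame, pulled back to its straight-line drawing

module Frame (t : Fin 9) where
  i : Fin 3
  i = gadgetAt t

  spot : Vertex → Point
  spot v = straight i (label v)

  position-spot : ∀ v → Visible t v → bend (ι (shear i)) (spot v) ≈ₚ position v
  position-spot v V = ≈ₚ-trans (bend-straight i (label v))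
    (≈ₚ-reflexive (cong ⟦_⟧ (sym (visible⇒placed t v V))))

  label-injective : ∀ {u v} → Visible t u → Visible t v → label u ≡ label v → u ≡ v
  label-injective {u} {v} U V e = trans (visible⇒vertex t u U)
    (trans (cong (vertex i (copyAt t)) e) (sym (visible⇒vertex t v V)))

  Within : Edge → Set
  Within = EdgeWithin (Visible t)

  arc-spot : ∀ e → Within e → ∀ s →
    at (arc e) s ≈ₚ bend (ι (shear i)) (between (spot (source e)) (spot (target e)) s)
  arc-spot e (U , V) s = owned (edge-owner t (source e) (target e) (joined e) U V)
    where
    owned : ownerOf e ≡ i ⊎ OnBase (label (source e)) × OnBase (label (target e)) →
      at (arc e) s ≈ₚ bend (ι (shear i)) (between (spot (source e)) (spot (target e)) s)
    owned (inj₁ g≡i) = ≈ₚ-reflexive (cong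
      (λ g → bend (ι (shear g)) (between (straight g (label (source e))) (straight g (label (target e))) s)) g≡i)
    owned (inj₂ (a , b)) = bend-base (ownerOf e) i a b s

  on-arc : ∀ e → Within e → ∀ {x} → x ∈ᶜ arc e →
    ∃[ y ] (OnSegment (spot (source e)) (spot (target e)) y × bend (ι (shear i)) y ≈ₚ x)
  on-arc e E (s , h) = between (spot (source e)) (spot (target e)) s , (s , ≈ₚ-refl)
    , ≈ₚ-trans (≈ₚ-sym (arc-spot e E s)) h

  spots-apart : ∀ u v → Visible t u → Visible t v → u ≢ v →
    Signed (proj₁ (spot v) - proj₁ (spot u)) ⊎ Signed (proj₂ (spot v) - proj₂ (spot u))
  spots-apart u v U V u≢v = choose (Equivalence.to Bool.T-∨
      (shape-distinct i (label u) (label v) (λ e → u≢v (label-injective U V e))))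
    where
    p q : ℤPoint
    p = shape i (label u)
    q = shape i (label v)
    choose : T (nonzero (proj₁ q ℤ.- proj₁ p)) ⊎ T (nonzero (proj₂ q ℤ.- proj₂ p)) → _
    choose (inj₁ h) = inj₁ (signed-≐ {ι (proj₁ q ℤ.- proj₁ p)} (λ _ → sym (fromℤ-minus (proj₁ q) (proj₁ p))) (signed-ι _ h))
    choose (inj₂ h) = inj₂ (signed-≐ {ι (proj₂ q ℤ.- proj₂ p)} (λ _ → sym (fromℤ-minus (proj₂ q) (proj₂ p))) (signed-ι _ h))

  source≢target : ∀ e → source e ≢ target e
  source≢target e h = Fin.<⇒≢ (source<target e) h

  simple-arc : ∀ e → Within e → SimpleArc (arc e)
  simple-arc e E@(U , V) s s′ h = between-injective (spot (source e)) (spot (target e)) s s′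
    (spots-apart (source e) (target e) U V (source≢target e))
    (bend-injective (ι (shear i)) (≈ₚ-trans (≈ₚ-sym (arc-spot e E s)) (≈ₚ-trans h (arc-spot e E s′))))

  linked : ∀ e → Within e → T (link i (label (source e)) (label (target e)))
  linked e (U , V) = proj₂ (edge-forward t (source e) (target e) (source<target e) (joined e) U V)

  turn : ∀ {e w} → Within e → Visible t w → w ≢ source e → w ≢ target e →
    Signed (D (spot (source e)) (spot (target e)) (spot w))
  turn {e} {w} E@(U , V) W≤ w≢u w≢v = signed-≐ {ι (Dℤ p q r)} {D ⟦ p ⟧ ⟦ q ⟧ ⟦ r ⟧}
    (λ n → sym (D-ι p q r n))
    (signed-ι (Dℤ p q r) (generic i _ _ (label w) (linked e E)
      (λ h → w≢u (label-injective W≤ U h)) (λ h → w≢v (label-injective W≤ V h))))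
    where
    p q r : ℤPoint
    p = shape i (label (source e))
    q = shape i (label (target e))
    r = shape i (label w)

  turn′ : ∀ {e w} → Within e → Visible t w → w ≢ source e → w ≢ target e →
    Signed (D (spot (target e)) (spot (source e)) (spot w))
  turn′ {e} {w} E W≤ w≢u w≢v = flipped (turn {e} {w} E W≤ w≢u w≢v)
    where
    p = spot (source e)
    q = spot (target e)
    r = spot w
    flipped : Signed (D p q r) → Signed (D q p r)
    flipped (inj₁ h) = inj₂ (pos-≐ {D p q r} { - D q p r}
      (λ n → trans (sym (neg-neg (seq (D p q r) n))) (cong ℚ.-_ (D-swap p q r n))) h)
      where
      neg-neg : ∀ x → ℚ.- (ℚ.- x) ≡ x
      neg-neg = solve 1 (λ x → :- (:- x) := x) refl
    flipped (inj₂ h) = inj₁ (pos-swap p q r h)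

  disjoint : ∀ {e f} → Within e → Within f → source e ≢ source f → source e ≢ target f →
    target e ≢ source f → target e ≢ target f →
    ¬ Meet (spot (source e)) (spot (target e)) (spot (source f)) (spot (target f))
  disjoint {e} {f} E@(U , V) F@(R , Q) ur us vr vs (x , on-e , on-f) = sides (Equivalence.to Bool.T-∨
      (separated i (label (source e)) (label (target e)) (forwards e E) (linked e E)
        (label (source f)) (label (target f)) (forwards f F) (linked f F)
        (λ h → ur (label-injective U R h)) (λ h → us (label-injective U Q h))
        (λ h → vr (label-injective V R h)) (λ h → vs (label-injective V Q h))))
    where
    forwards : ∀ e → Within e → T (forward (label (source e)) (label (target e)))
    forwards e (U , V) = proj₁ (edge-forward t (source e) (target e) (source<target e) (joined e) U V)
    a b c d : ℤPoint
    a = shape i (label (source e))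
    b = shape i (label (target e))
    c = shape i (label (source f))
    d = shape i (label (target f))
    real-sides : ∀ p q r s → T (sameSign (Dℤ p q r) (Dℤ p q s)) →
      SameSign (D ⟦ p ⟧ ⟦ q ⟧ ⟦ r ⟧) (D ⟦ p ⟧ ⟦ q ⟧ ⟦ s ⟧)
    real-sides p q r s h = sameSign-≐ (λ n → sym (D-ι p q r n)) (λ n → sym (D-ι p q s n))
      (sameSign-ι (Dℤ p q r) (Dℤ p q s) h)
    sides : T (sameSign (Dℤ a b c) (Dℤ a b d)) ⊎ T (sameSign (Dℤ c d a) (Dℤ c d b)) → ⊥
    sides (inj₁ h) = one-side-disjoint ⟦ a ⟧ ⟦ b ⟧ ⟦ c ⟧ ⟦ d ⟧ (real-sides a b c d h) (x , on-e , on-f)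
    sides (inj₂ h) = one-side-disjoint ⟦ c ⟧ ⟦ d ⟧ ⟦ a ⟧ ⟦ b ⟧ (real-sides c d a b h) (x , on-f , on-e)

  -- Injectivity of `bend` pulls `x` back to one point `y` of both straight segments. If the edges
  -- share an end, `common-end` places `y` there, by general position; otherwise the segments are
  -- disjoint.
  common : ∀ e f → Within e → Within f → e ≢ f → ∀ x → x ∈ᶜ arc e → x ∈ᶜ arc f →
    CommonEndpointAt picture (Visible t) e f x
  common e f E@(U , V) F@(R , Q) e≢f x x∈e x∈f =
    cases (source e Fin.≟ source f) (source e Fin.≟ target f) (target e Fin.≟ source f) (target e Fin.≟ target f)
    where
    u v r s : Vertex
    u = source e
    v = target e
    r = source f
    s = target f
    y : Point
    y = proj₁ (on-arc e E x∈e)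
    bend-y : bend (ι (shear i)) y ≈ₚ x
    bend-y = proj₂ (proj₂ (on-arc e E x∈e))
    on-e : OnSegment (spot u) (spot v) y
    on-e = proj₁ (proj₂ (on-arc e E x∈e))
    on-f : OnSegment (spot r) (spot s) y
    on-f = let z , on-z , bend-z = on-arc f F x∈f in
      on-segment-cong (spot r) (spot s) on-z (bend-injective (ι (shear i)) (≈ₚ-trans bend-z (≈ₚ-sym bend-y)))
    on-e′ : OnSegment (spot v) (spot u) y
    on-e′ = on-segment-sym (spot u) (spot v) y on-e
    on-f′ : OnSegment (spot s) (spot r) y
    on-f′ = on-segment-sym (spot r) (spot s) y on-f
    at-vertex : ∀ w → Visible t w → y ≈ₚ spot w → position w ≈ₚ x
    at-vertex w V h = ≈ₚ-trans (≈ₚ-sym (position-spot w V)) (≈ₚ-trans (bend-cong (ι (shear i)) (≈ₚ-sym h)) bend-y)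
    u≢v : u ≢ v
    u≢v = source≢target e
    r≢s : r ≢ s
    r≢s = source≢target f
    cases : Dec (u ≡ r) → Dec (u ≡ s) → Dec (v ≡ r) → Dec (v ≡ s) → CommonEndpointAt picture (Visible t) e f x
    cases (yes u≡r) _ _ _ = u , inj₁ refl , inj₁ u≡r , at-vertex u U
      (common-end (spot u) (spot v) (spot s) y
        (turn {e} E Q (λ h → r≢s (trans (sym u≡r) (sym h))) (λ h → e≢f (edge-≡ u≡r (sym h))))
        on-e (subst (λ w → OnSegment (spot w) (spot s) y) (sym u≡r) on-f))
    cases (no _) (yes u≡s) _ _ = u , inj₁ refl , inj₂ u≡s , at-vertex u U
      (common-end (spot u) (spot v) (spot r) y
        (turn {e} E R (λ h → r≢s (trans h u≡s))
          -- With both ends shared crosswise, one of the edges would be listed from its larger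
          -- endpoint.
          (λ h → ℕ.<-asym (source<target e) (subst₂ Fin._<_ h (sym u≡s) (source<target f))))
        on-e (subst (λ w → OnSegment (spot w) (spot r) y) (sym u≡s) on-f′))
    cases (no _) (no _) (yes v≡r) _ = v , inj₂ refl , inj₁ v≡r , at-vertex v V
      (common-end (spot v) (spot u) (spot s) y
        (turn′ {e} E Q
          (λ h → ℕ.<-asym (source<target e) (subst₂ Fin._<_ (sym v≡r) h (source<target f)))
          (λ h → r≢s (trans (sym v≡r) (sym h))))
        on-e′ (subst (λ w → OnSegment (spot w) (spot s) y) (sym v≡r) on-f))
    cases (no u≢r) (no _) (no _) (yes v≡s) = v , inj₂ refl , inj₂ v≡s , at-vertex v V
      (common-end (spot v) (spot u) (spot r) y
        (turn′ {e} E R (λ h → u≢r (sym h)) (λ h → r≢s (trans h v≡s)))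
        on-e′ (subst (λ w → OnSegment (spot w) (spot r) y) (sym v≡s) on-f′))
    cases (no ur) (no us) (no vr) (no vs) = ⊥-elim (disjoint {e} {f} E F ur us vr vs (y , on-e , on-f))

  one-common : ∀ e f → e ≢ f → ∀ v w → EndpointOf e v → EndpointOf f v → EndpointOf e w → EndpointOf f w → v ≡ w
  one-common e f e≢f v w (inj₁ a) (inj₁ b) (inj₁ c) _ = trans a (sym c)
  one-common e f e≢f v w (inj₁ a) (inj₁ b) (inj₂ c) (inj₁ d) = trans b (sym d)
  one-common e f e≢f v w (inj₁ a) (inj₁ b) (inj₂ c) (inj₂ d) =
    ⊥-elim (e≢f (edge-≡ (trans (sym a) b) (trans (sym c) d)))
  one-common e f e≢f v w (inj₁ a) (inj₂ b) (inj₁ c) _ = trans a (sym c)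
  one-common e f e≢f v w (inj₁ a) (inj₂ b) (inj₂ c) (inj₂ d) = trans b (sym d)
  one-common e f e≢f v w (inj₁ a) (inj₂ b) (inj₂ c) (inj₁ d) = ⊥-elim (ℕ.<-asym (source<target e)
    (subst₂ Fin._<_ (trans (sym d) c) (trans (sym b) a) (source<target f)))
  one-common e f e≢f v w (inj₂ a) (inj₁ b) (inj₂ c) _ = trans a (sym c)
  one-common e f e≢f v w (inj₂ a) (inj₁ b) (inj₁ c) (inj₁ d) = trans b (sym d)
  one-common e f e≢f v w (inj₂ a) (inj₁ b) (inj₁ c) (inj₂ d) = ⊥-elim (ℕ.<-asym (source<target e)
    (subst₂ Fin._<_ (trans (sym b) a) (trans (sym d) c) (source<target f)))
  one-common e f e≢f v w (inj₂ a) (inj₂ b) (inj₂ c) _ = trans a (sym c)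
  one-common e f e≢f v w (inj₂ a) (inj₂ b) (inj₁ c) (inj₂ d) = trans b (sym d)
  one-common e f e≢f v w (inj₂ a) (inj₂ b) (inj₁ c) (inj₁ d) =
    ⊥-elim (e≢f (edge-≡ (trans (sym c) d) (trans (sym a) b)))

  simple-frame : SimpleDrawing picture (Visible t)
  simple-frame = record
    { distinct  = λ u v U V u≢v h → same-spot (spots-apart u v U V u≢v) (bend-injective (ι (shear i))
        (≈ₚ-trans (position-spot u U) (≈ₚ-trans h (≈ₚ-sym (position-spot v V)))))
    ; arcs      = simple-arc
    ; avoiding  = λ e v E V ¬end v∈e → let y , on-y , bend-y = on-arc e E v∈e in
        signed⇒¬null (turn {e} E V (λ h → ¬end (inj₁ h)) (λ h → ¬end (inj₂ h)))
          (on-segment⇒D-null (spot (source e)) (spot (target e))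
            (on-segment-cong (spot (source e)) (spot (target e)) on-y
              (bend-injective (ι (shear i)) (≈ₚ-trans bend-y (≈ₚ-sym (position-spot v V))))))
    ; atMostOne = λ e f E F e≢f p q p∈e p∈f q∈e q∈f →
        let v , ev , fv , v≈p = common e f E F e≢f p p∈e p∈f
            w , ew , fw , w≈q = common e f E F e≢f q q∈e q∈f
        in ≈ₚ-trans (≈ₚ-sym v≈p) (≈ₚ-trans (≈ₚ-reflexive (cong position (one-common e f e≢f v w ev fv ew fw))) w≈q)
    ; proper    = λ e f E F e≢f x x∈e x∈f → inj₁ (common e f E F e≢f x x∈e x∈f)
    }
    where
    same-spot : ∀ {p q} → Signed (proj₁ q - proj₁ p) ⊎ Signed (proj₂ q - proj₂ p) → ¬ (p ≈ₚ q)
    same-spot (inj₁ σ) (a , _) = signed⇒¬null σ (≈⇒null (≈-sym a))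
    same-spot (inj₂ σ) (_ , b) = signed⇒¬null σ (≈⇒null (≈-sym b))

  -- An end is reached at parameter 0 or 1, and a simple arc reaches it only once.
  not-interior : ∀ e → Within e → ∀ v x → EndpointOf e v → position v ≈ₚ x → ¬ InteriorOf (arc e) x
  not-interior e E v x (inj₁ refl) v≈x (s , 0<s , _ , s≈x) = pos⇒¬null {val s} 0<s
    (≈-sym (simple-arc e E 0I s (≈ₚ-trans (begins e) (≈ₚ-trans v≈x (≈ₚ-sym s≈x)))))
  not-interior e E v x (inj₂ refl) v≈x (s , _ , s<1 , s≈x) = pos⇒¬null {1ℝ - val s} (<⇒pos {val s} {1ℝ} s<1)
    (≈⇒null (simple-arc e E 1I s (≈ₚ-trans (ends e) (≈ₚ-trans v≈x (≈ₚ-sym s≈x)))))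

  -- A crossing is interior to both arcs, whereas every common point is an endpoint.
  no-crossings : CrossingFree picture (Visible t)
  no-crossings e f E F e≢f x c = not-interior e E (proj₁ shared) x
    (proj₁ (proj₂ shared)) (proj₂ (proj₂ (proj₂ shared))) interiorˡ
    where
    open CrossAt c
    on-curve : ∀ {γ} → InteriorOf γ x → x ∈ᶜ γ
    on-curve (s , _ , _ , h) = s , h
    shared : CommonEndpointAt picture (Visible t) e f x
    shared = common e f E F e≢f x (on-curve {arc e} interiorˡ) (on-curve {arc f} interiorʳ)

storyplan : Storyplan G 9
storyplan = record
  { start    = λ v → firstTime (node v)
  ; end      = λ v → lastTime (node v)
  ; nonempty = first≤last
  ; meet     = meeting
  ; drawing  = picture
  ; simple   = Frame.simple-frame
  }

planar : Planar storyplan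
planar = Frame.no-crossings

theorem1 : Σ[ G ∈ Graph ] (AdmitsPlanarStoryplan G × ¬ AdmitsPlanarGeometricStoryplan G)
theorem1 = G , (9 , storyplan , planar) , λ (ℓ , S , geometric) → no-storyplan S geometric
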